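{- Let $q=p^e$ with $p$ an odd prime, $A=\mathbb{F}_q[T]$, and let $C$ be the Carlitz module. Let $m,u\in A$ be monic polynomials such that at least one of them has positive degree. Then there exists a Zsigmondy prime for $(u,m)$, except exactly in the following case: $q=3$, $u=1$, and $m=(\wp-1)\wp$, where $\wp$ is an arbitrary monic prime of degree $1$ in $\mathbb{F}_3[T]$.
   Context: $A=\mathbb{F}_q[T]$, $k=\mathbb{F}_q(T)$. The Carlitz module is the $\mathbb{F}_q$-algebra homomorphism $a\mapsto C_a$ from $A$ to the twisted polynomial ring $k\langle\tau\rangle$ (with $\tau(x)=x^q$) determined by $C_T=T+\tau$; thus $C_T(x)=Tx+x^q$ and for each $a\in A$, $C_a(x)\in A[x]$ is an $\mathbb{F}_q$-linear polynomial, with $C_{ab}(x)=C_a(C_b(x))$ and $C_{a+b}=C_a+C_b$. For nonzero $m,u\in A$, a Zsigmondy prime for $(u,m)$ is a monic prime $\wp\in A$ such that $C_m(u)\equiv 0\pmod{\wp}$ and $C_n(u)\not\equiv 0\pmod{\wp}$ for every nonzero $n\in A$ with $\deg(n)<\deg(m)$. -}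

module Defs where

open import Level using (0ℓ)
open import Data.Nat as ℕ using (ℕ; zero; suc)
open import Data.Fin using (Fin)
open import Data.List using (List; []; _∷_; length; last)
open import Data.Maybe using (Maybe; just)
open import Data.Product using (Σ; _×_)
open import Data.Sum using (_⊎_)
open import Relation.Nullary using (¬_; yes; no)
open import Relation.Binary.PropositionalEquality using (_≡_; _≢_)
open import Relation.Binary.Definitions using (DecidableEquality)
open import Algebra.Structures using (IsCommutativeRing)
open import Function.Bundles using (_↔_)

-- A finite field with exactly q elements (equality is propositional).
-- Since F_q is unique up to isomorphism, quantifying over all such
-- records is the same as working with "the" field F_q.
record FiniteField (q : ℕ) : Set₁ where
  infixl 6 _+_
  infixl 7 _*_
  field
    Carrier      : Set
    _+_ _*_      : Carrier → Carrier → Carrier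
    -_           : Carrier → Carrier
    0# 1#        : Carrier
    isCommRing   : IsCommutativeRing _≡_ _+_ _*_ -_ 0# 1#
    0≢1          : 0# ≢ 1#
    inv          : (x : Carrier) → x ≢ 0# → Carrier
    inv-correct  : (x : Carrier) (nz : x ≢ 0#) → x * inv x nz ≡ 1#
    _≟_          : DecidableEquality Carrier
    card         : Carrier ↔ Fin q

module PolyDefs {q : ℕ} (F : FiniteField q) where
  open FiniteField F renaming (_+_ to _+F_; _*_ to _*F_; -_ to -F_)

  -- coefficient lists, lowest degree first; trailing zeros allowed
  Poly : Set
  Poly = List Carrier

  norm : Poly → Poly
  norm [] = []
  norm (a ∷ as) with norm as
  ... | [] with a ≟ 0#
  ...   | yes _ = []
  ...   | no  _ = a ∷ []
  norm (a ∷ as) | b ∷ bs = a ∷ b ∷ bs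

  infix 4 _≈_
  _≈_ : Poly → Poly → Set
  f ≈ g = norm f ≡ norm g

  zeroP oneP Tp : Poly
  zeroP = []
  oneP  = 1# ∷ []
  Tp    = 0# ∷ 1# ∷ []

  infixl 6 _+P_ _-P_
  infixl 7 _*P_

  _+P_ : Poly → Poly → Poly
  [] +P g = g
  (a ∷ f) +P [] = a ∷ f
  (a ∷ f) +P (b ∷ g) = (a +F b) ∷ (f +P g)

  negP : Poly → Poly
  negP [] = []
  negP (a ∷ f) = (-F a) ∷ negP f

  _-P_ : Poly → Poly → Poly
  f -P g = f +P negP g

  scal : Carrier → Poly → Poly
  scal c [] = []
  scal c (a ∷ f) = (c *F a) ∷ scal c f

  _*P_ : Poly → Poly → Poly
  [] *P g = []
  (a ∷ f) *P g = scal a g +P (0# ∷ (f *P g))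

  _^P_ : Poly → ℕ → Poly
  f ^P zero = oneP
  f ^P suc n = f *P (f ^P n)

  -- degree of a nonzero polynomial (the zero polynomial gets 0; it is
  -- only ever applied to nonzero polynomials below)
  deg : Poly → ℕ
  deg f = length (norm f) ℕ.∸ 1

  Monic : Poly → Set
  Monic f = last (norm f) ≡ just 1#

  infix 4 _∣_
  _∣_ : Poly → Poly → Set
  d ∣ f = Σ Poly λ r → d *P r ≈ f

  IsUnit : Poly → Set
  IsUnit f = Σ Poly λ g → f *P g ≈ oneP

  IsPrime : Poly → Set
  IsPrime P = ¬ (P ≈ zeroP) × ¬ IsUnit P
            × (∀ a b → P ∣ a *P b → P ∣ a ⊎ P ∣ b)

  MonicPrime : Poly → Set
  MonicPrime P = Monic P × IsPrime P

  -- Carlitz module: carlitz a u = C_a(u), with C_T(x) = T x + x^q.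
  -- Horner: for a = a₀ + T a', C_a(u) = a₀ u + C_T(C_{a'}(u)).
  carlitz : Poly → Poly → Poly
  carlitz [] u = []
  carlitz (a ∷ as) u =
    scal a u +P (Tp *P carlitz as u +P (carlitz as u) ^P q)

  Zsigmondy : Poly → Poly → Poly → Set
  Zsigmondy u m P =
    MonicPrime P × P ∣ carlitz m u
    × (∀ n → ¬ (n ≈ zeroP) → deg n ℕ.< deg m → ¬ (P ∣ carlitz n u))

  Exceptional : Poly → Poly → Set
  Exceptional u m =
    q ≡ 3 × u ≈ oneP
    × Σ Poly λ P → MonicPrime P × deg P ≡ 1 × m ≈ (P -P oneP) *P P

{-# OPTIONS --safe #-}

-- Let cₙ = Cₙ(u) and let S be the set of primes dividing m.  Since
-- gcd(cₐ, c_b) = c_gcd(a,b), inclusion-exclusion gives the degree of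
-- Ψ = cₘ / lcm { c_{m/ℓ} : ℓ ∈ S } exactly; up to a factor q^j or q^j deg u it is
-- the totient ∏ (q^deg ℓ − 1), with a correction of ±1/q when u = 1 and m is
-- squarefree.  From C_ℓ(x) ≡ ℓ x (mod x³) one sees that a prime P ∣ Ψ that is not
-- a Zsigmondy prime is associated to some ℓ ∈ S and divides Ψ only once.  So a
-- Zsigmondy prime exists as soon as deg Ψ > ∑ deg ℓ.  This inequality can fail
-- only for u = 1 and m a prime, where every prime divisor of Ψ is a Zsigmondy
-- prime because c₁ = 1, and for u = 1, q = 3 and m a product of two or three
-- distinct linear primes.  Over 𝔽₃ two distinct monic linear polynomials differ by
-- ±1, so the products of two are the exceptional case, while for the product of
-- all three no ℓ ∈ S divides Ψ.

module Submission where

open import Defs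
open import Algebra.Bundles using (CommutativeRing; CommutativeSemiring)
import Algebra.Properties.CommutativeMonoid.Sum
import Algebra.Properties.CommutativeSemiring.Binomial
import Algebra.Properties.CommutativeSemiring.Exp
import Algebra.Properties.Ring
import Algebra.Properties.Semiring.Exp
import Algebra.Properties.Semiring.Mult
import Algebra.Solver.Ring.NaturalCoefficients.Default
open import Data.Empty using (⊥)
open import Data.Fin as Fin using (Fin)
open import Data.Fin.Permutation using (Permutation′; _⟨$⟩ʳ_)
import Data.Fin.Properties as Fin
open import Data.List using (List; []; _∷_; foldr; map; length; last)
open import Data.List.Membership.Propositional using (_∈_)
open import Data.List.Properties using (∷-injectiveˡ; ∷-injectiveʳ)
open import Data.List.Relation.Unary.All as All using (All; []; _∷_)
open import Data.List.Relation.Unary.AllPairs using (AllPairs; []; _∷_)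
open import Data.List.Relation.Unary.Any using (here; there)
open import Data.Maybe using (just)
open import Data.Maybe.Properties using (just-injective)
open import Data.Nat as ℕ using (ℕ; zero; suc; _<_; _≤_; z≤n; s≤s; _∸_)
open import Data.Nat.Combinatorics using (_C_; nCn≡1; nC1≡n; nCk≡nC[n∸k]; nCk+nC[k+1]≡[n+1]C[k+1]; k>n⇒nCk≡0)
import Data.Nat.Divisibility as ℕ
open import Data.Nat.Induction using (<-wellFounded)
open import Data.Nat.ListAction using (sum)
open import Data.Nat.Primality using (Prime; euclidsLemma; prime⇒nonZero; prime⇒nonTrivial)
import Data.Nat.Properties as ℕ
import Data.Nat.Solver
open import Data.Product using (Σ; ∃; ∃₂; _×_; _,_; proj₁; proj₂)
open import Data.Sum using (_⊎_; inj₁; inj₂; [_,_]′)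
open import Data.Vec.Functional using (removeAt)
open import Function.Bundles using (_⇔_; mk⇔; _↔_; mk↔ₛ′; Inverse)
open import Function.Construct.Composition using (_↔-∘_)
open import Function.Construct.Symmetry using (↔-sym)
open import Induction.WellFounded using (Acc; acc)
open import Level using (0ℓ)
open import Relation.Binary.PropositionalEquality as ≡ using (_≡_; _≢_)
open import Relation.Nullary using (¬_; Dec; yes; no; contradiction)
open import Relation.Nullary.Decidable using (map′)

-- Divisibility in Euclidean domains

-- Oddness of p enters through q ≥ 3 and q ≠ 4. By q ≥ 3, x^q is a multiple of x³, so `c m` divided
-- by `c k` is ℓ up to a multiple of (c k)², and a square dividing Ψ can be passed on to ℓ. The
-- condition q ≠ 4 excludes a borderline: for u = 1 and m a product of two distinct linear primes,
-- deg Ψ = q - 2, which at q = 4 only equals ∑ deg ℓ = 2. At q = 3 two linear primes give deg Ψ = 1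
-- and three give 9 - 9 + 3 = 3, so there the primes themselves have to be inspected. Sums over
-- subsets of S never appear. With m written as w ∏ S, a prime is moved from S into w, one at a
-- time, and every statement about lcms and degrees is proved for arbitrary w by induction on S.

record EuclideanDomain : Set₁ where
  field
    commutativeRing : CommutativeRing 0ℓ 0ℓ
  open CommutativeRing commutativeRing public
  field
    1≉0       : ¬ 1# ≈ 0#
    _≟0       : ∀ x → Dec (x ≈ 0#)
    *-≉0      : ∀ {x y} → ¬ x ≈ 0# → ¬ y ≈ 0# → ¬ x * y ≈ 0#
    deg       : Carrier → ℕ
    deg-cong  : ∀ {x y} → x ≈ y → deg x ≡ deg y
    deg-0     : deg 0# ≡ 0
    deg-*     : ∀ {x y} → ¬ x ≈ 0# → ¬ y ≈ 0# → deg (x * y) ≡ deg x ℕ.+ deg y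
    divMod    : ∀ a b → ¬ b ≈ 0# → ∃₂ λ q r → a ≈ q * b + r × (r ≈ 0# ⊎ deg r < deg b)
    deg0⇒unit : ∀ {x} → ¬ x ≈ 0# → deg x ≡ 0 → ∃ λ y → x * y ≈ 1#
    -- Holds in 𝔽q[T] because, up to `≈`, only finitely many elements have degree below n. It makes
    -- the existence of a proper factor decidable, hence the existence of prime divisors
    -- constructive.
    search    : ∀ n {P : Carrier → Set} → (∀ {x y} → x ≈ y → P x → P y) → (∀ x → Dec (P x)) →
                Dec (∃ λ x → deg x < n × P x)
    Monic        : Carrier → Set
    monic-1      : Monic 1#
    monic-cong   : ∀ {x y} → x ≈ y → Monic x → Monic y
    monic⇒≉0     : ∀ {x} → Monic x → ¬ x ≈ 0#
    monic-*      : ∀ {x y} → Monic x → Monic y → Monic (x * y)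
    monic-cancel : ∀ {x y} → Monic (x * y) → Monic x → Monic y
    monic-deg0   : ∀ {x} → Monic x → deg x ≡ 0 → x ≈ 1#
    normalize    : ∀ {x} → ¬ x ≈ 0# → ∃ λ v → (∃ λ v′ → v * v′ ≈ 1#) × Monic (x * v)

module Divisibility (E : EuclideanDomain) where
  open EuclideanDomain E
  open import Relation.Binary.Reasoning.Setoid setoid
  open Algebra.Properties.Ring ring
    using (-‿distribʳ-*; x∙y⁻¹≈ε⇒x≈y; x≈y⇒x∙y⁻¹≈ε)
  open Algebra.Solver.Ring.NaturalCoefficients.Default commutativeSemiring
    using (solve; _:=_; _:+_; _:*_)

  infix 4 _∣_ _∤_
  _∣_ _∤_ : Carrier → Carrier → Set
  d ∣ f = Σ Carrier λ r → d * r ≈ f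
  d ∤ f = ¬ d ∣ f

  IsUnit : Carrier → Set
  IsUnit f = Σ Carrier λ g → f * g ≈ 1#

  IsPrime : Carrier → Set
  IsPrime p = ¬ (p ≈ 0#) × ¬ IsUnit p × (∀ a b → p ∣ a * b → p ∣ a ⊎ p ∣ b)

  Coprime : Carrier → Carrier → Set
  Coprime x y = ∃₂ λ s t → s * x + t * y ≈ 1#

  *-cancelˡ : ∀ {x y z} → ¬ x ≈ 0# → x * y ≈ x * z → y ≈ z
  *-cancelˡ {x} {y} {z} x≉0 eq with (y - z) ≟0
  ... | yes y-z≈0 = x∙y⁻¹≈ε⇒x≈y y z y-z≈0
  ... | no  y-z≉0 = contradiction x[y-z]≈0 (*-≉0 x≉0 y-z≉0)
    where
    x[y-z]≈0 : x * (y - z) ≈ 0#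
    x[y-z]≈0 = begin
      x * (y - z)        ≈⟨ distribˡ x y (- z) ⟩
      x * y + x * - z    ≈⟨ +-congˡ (sym (-‿distribʳ-* x z)) ⟩
      x * y - x * z      ≈⟨ x≈y⇒x∙y⁻¹≈ε eq ⟩
      0#                 ∎

  *-cancelʳ : ∀ {x y z} → ¬ x ≈ 0# → y * x ≈ z * x → y ≈ z
  *-cancelʳ {x} {y} {z} x≉0 eq = *-cancelˡ x≉0 (trans (*-comm x y) (trans eq (*-comm z x)))

  *-≉0ˡ : ∀ {x y z} → x * y ≈ z → ¬ z ≈ 0# → ¬ x ≈ 0#
  *-≉0ˡ {x} {y} xy≈z z≉0 x≈0 = z≉0 (trans (sym xy≈z) (trans (*-congʳ x≈0) (zeroˡ y)))

  *-≉0ʳ : ∀ {x y z} → x * y ≈ z → ¬ z ≈ 0# → ¬ y ≈ 0#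
  *-≉0ʳ {x} {y} xy≈z z≉0 y≈0 = z≉0 (trans (sym xy≈z) (trans (*-congˡ y≈0) (zeroʳ x)))

  ∣-refl : ∀ {x} → x ∣ x
  ∣-refl {x} = 1# , *-identityʳ x

  ∣-respʳ : ∀ {x y z} → y ≈ z → x ∣ y → x ∣ z
  ∣-respʳ y≈z (r , eq) = r , trans eq y≈z

  ∣-respˡ : ∀ {x y z} → x ≈ y → x ∣ z → y ∣ z
  ∣-respˡ x≈y (r , eq) = r , trans (*-congʳ (sym x≈y)) eq

  ∣-trans : ∀ {x y z} → x ∣ y → y ∣ z → x ∣ z
  ∣-trans {x} (r , xr≈y) (s , ys≈z) = r * s , trans (sym (*-assoc x r s)) (trans (*-congʳ xr≈y) ys≈z)

  ∣m⇒∣m*n : ∀ {x y} z → x ∣ y → x ∣ y * z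
  ∣m⇒∣m*n {x} z (r , eq) = r * z , trans (sym (*-assoc x r z)) (*-congʳ eq)

  ∣n⇒∣m*n : ∀ {x z} y → x ∣ z → x ∣ y * z
  ∣n⇒∣m*n {x} {z} y x∣z = ∣-respʳ (*-comm z y) (∣m⇒∣m*n y x∣z)

  ∣-+ : ∀ {x y z} → x ∣ y → x ∣ z → x ∣ y + z
  ∣-+ {x} (r , xr≈y) (s , xs≈z) = r + s , trans (distribˡ x r s) (+-cong xr≈y xs≈z)

  ∣-cancelʳ-+ : ∀ {x y z} → x ∣ y + z → x ∣ z → x ∣ y
  ∣-cancelʳ-+ {x} {y} {z} (r , xr≈y+z) (s , xs≈z) = r - s , (begin
    x * (r - s)          ≈⟨ distribˡ x r (- s) ⟩
    x * r + x * - s      ≈⟨ +-cong xr≈y+z (trans (sym (-‿distribʳ-* x s)) (-‿cong xs≈z)) ⟩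
    (y + z) - z          ≈⟨ +-assoc y z (- z) ⟩
    y + (z - z)          ≈⟨ +-congˡ (-‿inverseʳ z) ⟩
    y + 0#               ≈⟨ +-identityʳ y ⟩
    y                    ∎)

  *-monoˡ-∣ : ∀ {x y} z → x ∣ y → z * x ∣ z * y
  *-monoˡ-∣ {x} z (r , eq) = r , trans (*-assoc z x r) (*-congˡ eq)

  ∣-unit : ∀ {x y} → x ∣ y → IsUnit y → IsUnit x
  ∣-unit = ∣-trans

  ∣⇒deg≤ : ∀ {x y} → x ∣ y → ¬ y ≈ 0# → deg x ≤ deg y
  ∣⇒deg≤ {x} {y} (r , eq) y≉0 =
    ℕ.≤-trans (ℕ.m≤m+n (deg x) (deg r))
      (ℕ.≤-reflexive (≡.trans (≡.sym (deg-* (*-≉0ˡ eq y≉0) (*-≉0ʳ eq y≉0))) (deg-cong eq)))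

  deg-1 : deg 1# ≡ 0
  deg-1 = ℕ.+-cancelˡ-≡ (deg 1#) (deg 1#) 0
    (≡.trans (≡.sym (deg-* 1≉0 1≉0)) (≡.trans (deg-cong (*-identityˡ 1#)) (≡.sym (ℕ.+-identityʳ _))))

  unit⇒deg0 : ∀ {x} → IsUnit x → deg x ≡ 0
  unit⇒deg0 u = ℕ.n≤0⇒n≡0 (ℕ.≤-trans (∣⇒deg≤ u 1≉0) (ℕ.≤-reflexive deg-1))

  _∣?_ : ∀ x y → ¬ x ≈ 0# → Dec (x ∣ y)
  (x ∣? y) x≉0 with divMod y x x≉0
  ... | q , r , eq , small with r ≟0
  ...   | yes r≈0 = yes (q , trans (*-comm x q) (sym (trans eq (trans (+-congˡ r≈0) (+-identityʳ _)))))
  ...   | no  r≉0 = no λ x∣y → ¬small small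
    (∣-cancelʳ-+ (∣-respʳ (trans eq (+-comm _ r)) x∣y) (q , *-comm x q))
    where
    ¬small : r ≈ 0# ⊎ deg r < deg x → x ∤ r
    ¬small (inj₁ r≈0) _   = r≉0 r≈0
    ¬small (inj₂ r<x) x∣r = ℕ.<⇒≱ r<x (∣⇒deg≤ x∣r r≉0)

  factor? : ∀ f → Dec (∃ λ g → deg g < deg f × 0 < deg g × g ∣ f)
  factor? f = search (deg f) (λ x≈y (0<x , x∣f) → ≡.subst (0 <_) (deg-cong x≈y) 0<x , ∣-respˡ x≈y x∣f) decide
    where
    0<deg⇒≉0 : ∀ {x} → 0 < deg x → ¬ x ≈ 0#
    0<deg⇒≉0 0<x x≈0 = ℕ.<-irrefl (≡.sym (≡.trans (deg-cong x≈0) deg-0)) 0<x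
    decide : ∀ g → Dec (0 < deg g × g ∣ f)
    decide g with 0 ℕ.<? deg g
    ... | no  ≮g  = no λ (0<g , _) → ≮g 0<g
    ... | yes 0<g = map′ (0<g ,_) proj₂ ((g ∣? f) (0<deg⇒≉0 0<g))

  record Bézout (a b : Carrier) : Set where
    constructor bézout
    field
      {gcd s t} : Carrier
      gcd∣a     : gcd ∣ a
      gcd∣b     : gcd ∣ b
      identity  : s * a + t * b ≈ gcd

  opaque
    bezout : ∀ a b → Bézout a b
    bezout a b = go a b (<-wellFounded (deg b))
      where
      0∣⇒ : ∀ {x} → x ∣ 0#
      0∣⇒ {x} = 0# , zeroʳ x
      by0 : ∀ x y → y ≈ 0# → Bézout x y
      by0 x y y≈0 = bézout {s = 1#} {t = 0#} ∣-refl (∣-respʳ (sym y≈0) 0∣⇒)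
        (trans (+-cong (*-identityˡ x) (zeroˡ y)) (+-identityʳ x))
      step : ∀ {x y q r} → x ≈ q * y + r → Bézout y r → Bézout x y
      step {x} {y} {q} {r} eq (bézout {g} {s} {t} g∣y g∣r id) =
        bézout {s = t} {t = s - t * q}
          (∣-respʳ (sym eq) (∣-+ (∣n⇒∣m*n q g∣y) g∣r)) g∣y (begin
          t * x + (s - t * q) * y          ≈⟨ +-congʳ (*-congˡ eq) ⟩
          -- The solver works in semirings, so - t q is passed to it as the independent variable m
          -- and cancelled by hand afterwards.
          t * (q * y + r) + (s - t * q) * y ≈⟨ solve 6 (λ t q y r s m → t :* (q :* y :+ r) :+ (s :+ m) :* y
                                                 := (s :* y :+ t :* r) :+ (t :* q :+ m) :* y) refl t q y r s (- (t * q)) ⟩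
          (s * y + t * r) + (t * q - t * q) * y ≈⟨ +-congˡ (*-congʳ (-‿inverseʳ (t * q))) ⟩
          (s * y + t * r) + 0# * y         ≈⟨ +-congˡ (zeroˡ y) ⟩
          (s * y + t * r) + 0#             ≈⟨ +-identityʳ _ ⟩
          s * y + t * r                    ≈⟨ id ⟩
          g                                ∎)
      go : ∀ x y → Acc _<_ (deg y) → Bézout x y
      go x y (acc rec) with y ≟0
      ... | yes y≈0 = by0 x y y≈0
      ... | no  y≉0 with divMod x y y≉0
      ...   | q , r , eq , inj₁ r≈0 = step eq (by0 y r r≈0)
      ...   | q , r , eq , inj₂ r<  = step eq (go y r (rec r<))

  bezout-≉0 : ∀ {a b} (B : Bézout a b) → ¬ a ≈ 0# → ¬ Bézout.gcd B ≈ 0#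
  bezout-≉0 (bézout (_ , eq) _ _) = *-≉0ˡ eq

  -- Here c * l′ is the lcm of c and L.
  gcd-distrib-lcm : ∀ {D c L g c′ l′ Y} → ¬ g ≈ 0# → g * c′ ≈ c → g * l′ ≈ L →
                    Coprime c′ l′ → D ∣ c * l′ →
                    (B₁ : Bézout D c) → Bézout.gcd B₁ ∣ Y →
                    (B₂ : Bézout D L) → Bézout.gcd B₂ ∣ Y → D ∣ Y
  gcd-distrib-lcm {D} {c} {L} {g} {c′} {l′} {Y} g≉0 gc′ gl′ (σ , τ , στ) D∣
    (bézout {g₁} {a₁} {b₁} _ _ id₁) (y₁ , eq₁) (bézout {g₂} {a₂} {b₂} _ _ id₂) (y₂ , eq₂) =
    -- Y is split as Y σ c′ + Y τ l′. The first summand is a multiple of gcd(D , L) c′, and D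
    -- divides both D c′ and L c′ = c l′. The second is a multiple of gcd(D , c) l′, and D divides
    -- both D l′ and c l′.
    ∣-respʳ (begin
      (D * (a₂ * y₂ * σ * c′) + c * l′ * (b₂ * y₂ * σ)) + (D * (a₁ * y₁ * τ * l′) + c * l′ * (b₁ * y₁ * τ))
        ≈⟨ +-congʳ (+-congˡ (*-congʳ swap)) ⟩
      (D * (a₂ * y₂ * σ * c′) + c′ * L * (b₂ * y₂ * σ)) + (D * (a₁ * y₁ * τ * l′) + c * l′ * (b₁ * y₁ * τ))
        ≈⟨ +-cong
             (solve 7 (λ D a₂ y₂ σ c′ L b₂ → D :* (a₂ :* y₂ :* σ :* c′) :+ c′ :* L :* (b₂ :* y₂ :* σ)
                         := (a₂ :* D :+ b₂ :* L) :* y₂ :* (σ :* c′)) refl D a₂ y₂ σ c′ L b₂)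
             (solve 7 (λ D a₁ y₁ τ l′ c b₁ → D :* (a₁ :* y₁ :* τ :* l′) :+ c :* l′ :* (b₁ :* y₁ :* τ)
                         := (a₁ :* D :+ b₁ :* c) :* y₁ :* (τ :* l′)) refl D a₁ y₁ τ l′ c b₁) ⟩
      (a₂ * D + b₂ * L) * y₂ * (σ * c′) + (a₁ * D + b₁ * c) * y₁ * (τ * l′)
        ≈⟨ +-cong (*-congʳ (trans (*-congʳ id₂) eq₂)) (*-congʳ (trans (*-congʳ id₁) eq₁)) ⟩
      Y * (σ * c′) + Y * (τ * l′)  ≈⟨ sym (distribˡ Y _ _) ⟩
      Y * (σ * c′ + τ * l′)        ≈⟨ *-congˡ στ ⟩
      Y * 1#                       ≈⟨ *-identityʳ Y ⟩
      Y                            ∎)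
      (∣-+ (∣-+ (_ , refl) (∣m⇒∣m*n _ D∣)) (∣-+ (_ , refl) (∣m⇒∣m*n _ D∣)))
    where
    swap : c * l′ ≈ c′ * L
    swap = trans (*-congʳ (sym gc′))
      (trans (solve 3 (λ g c l → g :* c :* l := c :* (g :* l)) refl g c′ l′) (*-congˡ gl′))

  coprime-sym : ∀ {x y} → Coprime x y → Coprime y x
  coprime-sym (s , t , eq) = t , s , trans (+-comm _ _) eq

  coprime-∣ : ∀ {x y z} → Coprime x y → z ∣ x → z ∣ y → IsUnit z
  coprime-∣ (s , t , eq) z∣x z∣y = ∣-respʳ eq (∣-+ (∣n⇒∣m*n s z∣x) (∣n⇒∣m*n t z∣y))

  ∣-deg≡⇒∣ : ∀ {x y} → x ∣ y → ¬ y ≈ 0# → deg x ≡ deg y → y ∣ x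
  ∣-deg≡⇒∣ {x} {y} (r , eq) y≉0 d≡ with deg0⇒unit (*-≉0ʳ eq y≉0) r≡0
    where
    r≡0 : deg r ≡ 0
    r≡0 = ℕ.+-cancelˡ-≡ (deg x) _ _ (≡.trans (≡.sym (deg-* (*-≉0ˡ eq y≉0) (*-≉0ʳ eq y≉0)))
            (≡.trans (deg-cong eq) (≡.trans (≡.sym d≡) (≡.sym (ℕ.+-identityʳ _)))))
  ... | s , rs≈1 = s , (begin
    y * s       ≈⟨ *-congʳ (sym eq) ⟩
    x * r * s   ≈⟨ *-assoc x r s ⟩
    x * (r * s) ≈⟨ *-congˡ rs≈1 ⟩
    x * 1#      ≈⟨ *-identityʳ x ⟩
    x           ∎)

  coprime-*∣ : ∀ {x y z} → Coprime x y → x ∣ y * z → x ∣ z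
  coprime-*∣ {x} {y} {z} (s , t , eq) x∣yz =
    ∣-respʳ (begin
      x * (s * z) + t * (y * z) ≈⟨ solve 5 (λ x s z t y → x :* (s :* z) :+ t :* (y :* z)
                                     := (s :* x :+ t :* y) :* z) refl x s z t y ⟩
      (s * x + t * y) * z       ≈⟨ *-congʳ eq ⟩
      1# * z                    ≈⟨ *-identityˡ z ⟩
      z                         ∎)
      (∣-+ (_ , refl) (∣n⇒∣m*n t x∣yz))

  gcd-unit⇒coprime : ∀ {x y} (B : Bézout x y) → IsUnit (Bézout.gcd B) → Coprime x y
  gcd-unit⇒coprime {x} {y} (bézout {g} {s} {t} _ _ id) (v , gv≈1) = v * s , v * t , (begin
    v * s * x + v * t * y ≈⟨ solve 5 (λ v s x t y → v :* s :* x :+ v :* t :* y := (s :* x :+ t :* y) :* v) refl v s x t y ⟩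
    (s * x + t * y) * v   ≈⟨ *-congʳ id ⟩
    g * v                 ≈⟨ gv≈1 ⟩
    1#                    ∎)

  irreducible⇒coprime⊎∣ : ∀ {f} → ¬ f ≈ 0# → (∀ g → g ∣ f → 0 < deg g → ¬ deg g < deg f) →
                          ∀ a → Coprime f a ⊎ f ∣ a
  irreducible⇒coprime⊎∣ {f} f≉0 irr a with bezout f a
  ... | B@(bézout {g} g∣f g∣a _) with deg g in dg
  ...   | zero  = inj₁ (gcd-unit⇒coprime B (deg0⇒unit (bezout-≉0 B f≉0) dg))
  ...   | suc d = inj₂ (∣-trans (∣-deg≡⇒∣ g∣f f≉0 (ℕ.≤-antisym (∣⇒deg≤ g∣f f≉0)
                    (ℕ.≮⇒≥ (irr g g∣f (≡.subst (0 <_) (≡.sym dg) (s≤s z≤n)))))) g∣a)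

  irreducible⇒prime : ∀ {f} → ¬ f ≈ 0# → 0 < deg f →
                      (∀ g → g ∣ f → 0 < deg g → ¬ deg g < deg f) → IsPrime f
  irreducible⇒prime {f} f≉0 0<f irr = f≉0 , (λ u → ℕ.<-irrefl (≡.sym (unit⇒deg0 u)) 0<f) , split
    where
    split : ∀ a b → f ∣ a * b → f ∣ a ⊎ f ∣ b
    split a b f∣ab with irreducible⇒coprime⊎∣ f≉0 irr a
    ... | inj₁ cop = inj₂ (coprime-*∣ cop f∣ab)
    ... | inj₂ f∣a = inj₁ f∣a

  MonicPrime : Carrier → Set
  MonicPrime p = Monic p × IsPrime p

  prime-≈unit : ∀ {p v v′} → v * v′ ≈ 1# → IsPrime p → IsPrime (p * v)
  prime-≈unit {p} {v} {v′} vv′ (p≉0 , ¬u , split) =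
    *-≉0 p≉0 (*-≉0ˡ vv′ 1≉0) , (λ u → ¬u (∣-trans (v , refl) u)) , split′
    where
    pv∣p : p * v ∣ p
    pv∣p = v′ , trans (*-assoc p v v′) (trans (*-congˡ vv′) (*-identityʳ p))
    split′ : ∀ a b → p * v ∣ a * b → p * v ∣ a ⊎ p * v ∣ b
    split′ a b d with split a b (∣-trans (v , refl) d)
    ... | inj₁ x = inj₁ (∣-trans pv∣p x)
    ... | inj₂ x = inj₂ (∣-trans pv∣p x)

  opaque
    prime-divisor : ∀ {f} → ¬ f ≈ 0# → 0 < deg f → ∃ λ p → MonicPrime p × p ∣ f
    prime-divisor {f} f≉0 0<f with go f f≉0 0<f (<-wellFounded (deg f))
      where
      go : ∀ f → ¬ f ≈ 0# → 0 < deg f → Acc _<_ (deg f) → ∃ λ p → IsPrime p × p ∣ f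
      go f f≉0 0<f (acc rec) with factor? f
      ... | no ¬factor = f , irreducible⇒prime f≉0 0<f (λ g g∣f 0<g g<f → ¬factor (g , g<f , 0<g , g∣f)) , ∣-refl
      ... | yes (g , g<f , 0<g , g∣f) with go g (*-≉0ˡ (proj₂ g∣f) f≉0) 0<g (rec g<f)
      ...   | p , pp , p∣g = p , pp , ∣-trans p∣g g∣f
    ... | p , pp , p∣f with normalize (proj₁ pp)
    ...   | v , (v′ , vv′) , mon = p * v , (mon , prime-≈unit vv′ pp)
            , ∣-trans (v′ , trans (*-assoc p v v′) (trans (*-congˡ vv′) (*-identityʳ p))) p∣f

  -- From l = p r, primality of l leaves only l ∣ r as an alternative, and that would make p a unit.
  prime∣prime : ∀ {p l} → IsPrime p → IsPrime l → p ∣ l → l ∣ p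
  prime∣prime {p} {l} (_ , ¬up , _) (l≉0 , _ , split) (r , pr≈l) with split p r (1# , trans (*-identityʳ l) (sym pr≈l))
  ... | inj₁ l∣p = l∣p
  ... | inj₂ (t , lt≈r) = contradiction (t , *-cancelˡ l≉0 (begin
    l * (p * t) ≈⟨ solve 3 (λ l p t → l :* (p :* t) := p :* (l :* t)) refl l p t ⟩
    p * (l * t) ≈⟨ *-congˡ lt≈r ⟩
    p * r       ≈⟨ pr≈l ⟩
    l           ≈⟨ sym (*-identityʳ l) ⟩
    l * 1#      ∎)) ¬up

  prime⇒0<deg : ∀ {p} → IsPrime p → 0 < deg p
  prime⇒0<deg {p} (p≉0 , ¬u , _) = ℕ.n≢0⇒n>0 λ d≡0 → ¬u (deg0⇒unit p≉0 d≡0)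

  prime-²∤ : ∀ {p} → IsPrime p → p * p ∤ p
  prime-²∤ {p} (p≉0 , ¬u , _) (r , eq) = ¬u (r , *-cancelˡ p≉0
    (trans (sym (*-assoc p p r)) (trans eq (sym (*-identityʳ p)))))

  prime∤⇒coprime : ∀ {p a} → IsPrime p → p ∤ a → Coprime p a
  prime∤⇒coprime {p} {a} pp@(p≉0 , _ , split) p∤a with bezout p a
  ... | B@(bézout {g} (r , gr≈p) g∣a _) with split g r (∣-respʳ (sym gr≈p) ∣-refl)
  ...   | inj₁ p∣g = contradiction (∣-trans p∣g g∣a) p∤a
  ...   | inj₂ (t , pt≈r) = gcd-unit⇒coprime B (t , *-cancelˡ p≉0 (begin
    p * (g * t) ≈⟨ solve 3 (λ p g t → p :* (g :* t) := g :* (p :* t)) refl p g t ⟩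
    g * (p * t) ≈⟨ *-congˡ pt≈r ⟩
    g * r       ≈⟨ gr≈p ⟩
    p           ≈⟨ sym (*-identityʳ p) ⟩
    p * 1#      ∎))

  prod : List Carrier → Carrier
  prod = foldr _*_ 1#

  degs : List Carrier → List ℕ
  degs = map deg

  prime∣prod : ∀ {p} S → IsPrime p → p ∣ prod S → ∃ λ l → l ∈ S × p ∣ l
  prime∣prod [] (_ , ¬u , _) p∣1 = contradiction p∣1 ¬u
  prime∣prod (l ∷ S) pp@(_ , _ , split) p∣ with split l (prod S) p∣
  ... | inj₁ p∣l = l , here ≡.refl , p∣l
  ... | inj₂ p∣S with prime∣prod S pp p∣S
  ...   | l′ , l′∈S , p∣l′ = l′ , there l′∈S , p∣l′

  ∈⇒∣prod : ∀ {l S} → l ∈ S → l ∣ prod S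
  ∈⇒∣prod (here ≡.refl) = _ , refl
  ∈⇒∣prod (there l∈S)   = ∣n⇒∣m*n _ (∈⇒∣prod l∈S)

  -- S lists each prime divisor of m once, so `prod S` is the radical of m and w the complementary
  -- factor; m is squarefree exactly when w has degree 0. Distinctness of the primes is recorded as
  -- coprimality, and `divisors` speaks of p ∣ l instead of p ∈ S because p is determined only up to
  -- a unit.
  record Radical (m : Carrier) : Set where
    field
      w         : Carrier
      S         : List Carrier
      w-monic   : Monic w
      primes    : All MonicPrime S
      coprime   : AllPairs Coprime S
      m≈        : m ≈ w * prod S
      divisors  : ∀ {p} → IsPrime p → p ∣ m → ∃ λ l → l ∈ S × p ∣ l

  opaque
    radical : ∀ m → Monic m → Radical m
    radical m mm = go m mm (<-wellFounded (deg m))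
      where
      extend : ∀ {m l m′} → MonicPrime l → l * m′ ≈ m → Radical m′ → Radical m
      -- Whether l is already represented in S is decided by dividing `prod S`, which ignores
      -- associates; a repeated prime goes into w.
      extend {m} {l} {m′} lp@(ml , l≉0 , pl) lm′≈m rad with (l ∣? prod (Radical.S rad)) l≉0
      ... | yes l∣S = record
        { w = l * w ; S = S ; w-monic = monic-* ml w-monic ; primes = primes ; coprime = coprime
        ; m≈ = trans (sym lm′≈m) (trans (*-congˡ m≈) (sym (*-assoc l w _)))
        ; divisors = λ pp p∣m → aux pp (proj₂ (proj₂ pp) l m′ (∣-respʳ (sym lm′≈m) p∣m)) }
        where
        open Radical rad
        aux : ∀ {p} → IsPrime p → p ∣ l ⊎ p ∣ m′ → ∃ λ l → l ∈ S × p ∣ l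
        aux pp (inj₁ p∣l)  = prime∣prod S pp (∣-trans p∣l l∣S)
        aux pp (inj₂ p∣m′) = divisors pp p∣m′
      ... | no l∤S = record
        { w = w ; S = l ∷ S ; w-monic = w-monic ; primes = lp ∷ primes
        ; coprime = All.tabulate (λ l′∈S → prime∤⇒coprime (proj₂ lp) λ l∣l′ → l∤S (∣-trans l∣l′ (∈⇒∣prod l′∈S))) ∷ coprime
        ; m≈ = trans (sym lm′≈m) (trans (*-congˡ m≈) (solve 3 (λ l w s → l :* (w :* s) := w :* (l :* s)) refl l w (prod S)))
        ; divisors = λ pp p∣m → aux pp (proj₂ (proj₂ pp) l m′ (∣-respʳ (sym lm′≈m) p∣m)) }
        where
        open Radical rad
        aux : ∀ {p} → IsPrime p → p ∣ l ⊎ p ∣ m′ → ∃ λ l′ → l′ ∈ l ∷ S × p ∣ l′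
        aux pp (inj₁ p∣l)  = l , here ≡.refl , p∣l
        aux pp (inj₂ p∣m′) with divisors pp p∣m′
        ... | l′ , l′∈ , p∣l′ = l′ , there l′∈ , p∣l′
      go : ∀ m → Monic m → Acc _<_ (deg m) → Radical m
      go m mm (acc rec) with deg m in dm
      ... | zero = record
        { w = 1# ; S = [] ; w-monic = monic-1 ; primes = [] ; coprime = []
        ; m≈ = trans (monic-deg0 mm dm) (sym (*-identityˡ 1#))
        ; divisors = λ pp p∣m → contradiction (∣-respʳ (monic-deg0 mm dm) p∣m) (proj₁ (proj₂ pp)) }
      ... | suc d with prime-divisor (monic⇒≉0 mm) (≡.subst (0 <_) (≡.sym dm) (s≤s z≤n))
      ...   | p , pp , (m′ , pm′≈m) = extend pp pm′≈m (go m′ (monic-cancel (monic-cong (sym pm′≈m) mm) (proj₁ pp)) (rec m′<))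
        where
        m≉0 : ¬ m ≈ 0#
        m≉0 = monic⇒≉0 mm
        m′< : deg m′ < suc d
        m′< = ≡.subst (deg m′ <_) (≡.trans (≡.sym (deg-* (*-≉0ˡ pm′≈m m≉0) (*-≉0ʳ pm′≈m m≉0))) (≡.trans (deg-cong pm′≈m) dm))
                (ℕ.m<n+m (deg m′) (prime⇒0<deg (proj₂ pp)))

-- The quotient Ψ

-- An abstraction of n ↦ Cₙ(u); c-lift is Cₗ(x) ≡ l x (mod x³) at x = c k.
record CarlitzSequence (E : EuclideanDomain) : Set where
  open EuclideanDomain E
  open Divisibility E using (_∣_)
  field
    c      : Carrier → Carrier
    c-cong : ∀ {a b} → a ≈ b → c a ≈ c b
    c-≉0   : ∀ {n} → ¬ n ≈ 0# → ¬ c n ≈ 0#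
    c-comb : ∀ {d a b} s t → d ∣ c a → d ∣ c b → d ∣ c (s * a + t * b)
    c-lift : ∀ k l → ∃ λ z → c (k * l) ≈ c k * (l + c k * c k * z)
    δ      : ℕ → ℕ
    deg-c  : ∀ {n} → ¬ n ≈ 0# → deg (c n) ≡ δ (deg n)

module Primitive (E : EuclideanDomain) (C : CarlitzSequence E) where
  open EuclideanDomain E
  open Divisibility E
  open CarlitzSequence C
  open import Relation.Binary.Reasoning.Setoid setoid
  open Algebra.Solver.Ring.NaturalCoefficients.Default commutativeSemiring
    using (solve; _:=_; _:+_; _:*_)

  ∣c-cong : ∀ {d a b} → a ≈ b → d ∣ c a → d ∣ c b
  ∣c-cong a≈b = ∣-respʳ (c-cong a≈b)

  ∣c-* : ∀ k l → c k ∣ c (k * l)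
  ∣c-* k l = _ , sym (proj₂ (c-lift k l))

  -- With m = w ∏ S, this is the lcm of the `c (m/l)` for l ∈ S, the quotient m/l being any k with k
  -- l ≈ m. At D = L, `local` is the universal property of the lcm; other D are needed to compare L
  -- with a gcd.
  record Lcm (w : Carrier) (S : List Carrier) : Set where
    field
      L      : Carrier
      L≉0    : ¬ L ≈ 0#
      c∣L    : ∀ {l k} → l ∈ S → k * l ≈ w * prod S → c k ∣ L
      -- D = lcm (gcd (D , c k)) over the k for every D ∣ L, phrased through divisors
      local  : ∀ {D Y} → D ∣ L →
               (∀ {l k G} → l ∈ S → k * l ≈ w * prod S → G ∣ D → G ∣ c k → G ∣ Y) → D ∣ Y

  -- Merges primality and pairwise coprimality, so that recursion on this evidence peels off one
  -- prime together with its coprimality to the rest.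
  data Admissible : List Carrier → Set where
    []  : Admissible []
    _∷_ : ∀ {l S} → MonicPrime l × All (Coprime l) S → Admissible S → Admissible (l ∷ S)

  admissible : ∀ {S} → All MonicPrime S → AllPairs Coprime S → Admissible S
  admissible []       []       = []
  admissible (p ∷ ps) (c ∷ cs) = (p , c) ∷ admissible ps cs

  admissible⇒prod≉0 : ∀ {S} → Admissible S → ¬ prod S ≈ 0#
  admissible⇒prod≉0 []                          = 1≉0
  admissible⇒prod≉0 (((_ , p≉0 , _) , _) ∷ adm) = *-≉0 p≉0 (admissible⇒prod≉0 adm)

  reassoc : ∀ x y z → x * (y * z) ≈ (x * z) * y
  reassoc = solve 3 (λ x y z → x :* (y :* z) := (x :* z) :* y) refl

  opaque
    -- Moving l from S into w leaves m, and hence the cofactors m/l₁ for l₁ ∈ S, unchanged. So only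
    -- the lcm of `c (m/l)` with the lcm L′ for (w l , S) has to be formed: `c k₁` times L′ divided
    -- by their gcd.
    lcm : ∀ {S} → Admissible S → ∀ w → ¬ w ≈ 0# → Lcm w S
    lcm [] w w≉0 = record
      { L = 1# ; L≉0 = 1≉0 ; c∣L = λ () ; local = λ D∣1 _ → ∣-trans D∣1 (_ , *-identityˡ _) }
    lcm {l ∷ S} (((_ , l≉0 , _) , _) ∷ adm) w w≉0 = go (bezout (c k₁) L′)
      where
      k₁ : Carrier
      k₁ = w * prod S
      open Lcm (lcm adm (w * l) (*-≉0 w≉0 l≉0)) renaming (L to L′; L≉0 to L′≉0; c∣L to c∣L′; local to local′)
      ck₁≉0 : ¬ c k₁ ≈ 0#
      ck₁≉0 = c-≉0 (*-≉0 w≉0 (admissible⇒prod≉0 adm))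
      go : Bézout (c k₁) L′ → Lcm w (l ∷ S)
      go B@(bézout {g} {s} {t} (c′ , gc′) (l′ , gl′) id) = record
        { L = c k₁ * l′
        ; L≉0 = *-≉0 ck₁≉0 (*-≉0ʳ gl′ L′≉0)
        ; c∣L = below
        ; local = λ {D} {Y} D∣ H → gcd-distrib-lcm g≉0 gc′ gl′ cop D∣
            (bezout D (c k₁))
            (H (here ≡.refl) (sym (reassoc w l (prod S))) (Bézout.gcd∣a (bezout D (c k₁))) (Bézout.gcd∣b (bezout D (c k₁))))
            (bezout D L′)
            (local′ (Bézout.gcd∣b (bezout D L′)) λ l∈S kl G∣ G∣ck →
              H (there l∈S) (trans kl (*-assoc w l (prod S))) (∣-trans G∣ (Bézout.gcd∣a (bezout D L′))) G∣ck)
        }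
        where
        g≉0 : ¬ g ≈ 0#
        g≉0 = bezout-≉0 B ck₁≉0
        cop : Coprime c′ l′
        cop = s , t , *-cancelˡ g≉0 (begin
          g * (s * c′ + t * l′)         ≈⟨ solve 5 (λ g s c t l → g :* (s :* c :+ t :* l) := s :* (g :* c) :+ t :* (g :* l)) refl g s c′ t l′ ⟩
          s * (g * c′) + t * (g * l′)   ≈⟨ +-cong (*-congˡ gc′) (*-congˡ gl′) ⟩
          s * c k₁ + t * L′             ≈⟨ id ⟩
          g                             ≈⟨ sym (*-identityʳ g) ⟩
          g * 1#                        ∎)
        L′∣ : L′ ∣ c k₁ * l′
        L′∣ = c′ , (begin
          L′ * c′       ≈⟨ *-congʳ (sym gl′) ⟩
          g * l′ * c′   ≈⟨ solve 3 (λ g l c → g :* l :* c := g :* c :* l) refl g l′ c′ ⟩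
          g * c′ * l′   ≈⟨ *-congʳ gc′ ⟩
          c k₁ * l′     ∎)
        below : ∀ {l₁ k} → l₁ ∈ l ∷ S → k * l₁ ≈ w * (l * prod S) → c k ∣ c k₁ * l′
        below (here ≡.refl) eq = ∣m⇒∣m*n l′ (1# , trans (*-identityʳ _) (c-cong (*-cancelʳ l≉0 (trans eq (reassoc w l (prod S))))))
        below (there l₁∈S) eq = ∣-trans (c∣L′ l₁∈S (trans eq (sym (*-assoc w l (prod S))))) L′∣

    deg-lcm-[] : ∀ w (w≉0 : ¬ w ≈ 0#) → deg (Lcm.L (lcm [] w w≉0)) ≡ 0
    deg-lcm-[] w w≉0 = deg-1

    -- The gcd removed when l is added to S is the lcm attached to (w , S),
    -- because gcd (c k , c k′) = c (gcd (k , k′)).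
    deg-lcm : ∀ {l S} (p : MonicPrime l × All (Coprime l) S) (adm : Admissible S) w (w≉0 : ¬ w ≈ 0#) (wl≉0 : ¬ w * l ≈ 0#) →
              deg (Lcm.L (lcm (p ∷ adm) w w≉0)) ℕ.+ deg (Lcm.L (lcm adm w w≉0))
              ≡ deg (c (w * prod S)) ℕ.+ deg (Lcm.L (lcm adm (w * l) wl≉0))
    deg-lcm {l} {S} ((_ , l≉0 , _) , cops) adm w w≉0 wl≉0 = main
      where
      k₁ : Carrier
      k₁ = w * prod S
      open Lcm (lcm adm (w * l) (*-≉0 w≉0 l≉0)) renaming (L to L′; L≉0 to L′≉0; c∣L to c∣L′; local to local′)
      open Lcm (lcm adm w w≉0)
      ck₁≉0 : ¬ c k₁ ≈ 0#
      ck₁≉0 = c-≉0 (*-≉0 w≉0 (admissible⇒prod≉0 adm))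
      B : Bézout (c k₁) L′
      B = bezout (c k₁) L′
      open Bézout B renaming (gcd to g) hiding (s; t)
      g≉0 : ¬ g ≈ 0#
      g≉0 = bezout-≉0 B ck₁≉0
      g∣L : g ∣ L
      g∣L = local′ gcd∣b aux
        where
        aux : ∀ {l₁ k G} → l₁ ∈ S → k * l₁ ≈ w * l * prod S → G ∣ g → G ∣ c k → G ∣ L
        aux {l₁} {k} {G} l₁∈S eq G∣g G∣ck with ∈⇒∣prod l₁∈S
        -- Here k₁ = k₂ l₁ and k = k₂ l. Bézout for l and l₁ writes k₂ as a combination of k₁ and k,
        -- so a common divisor of `c k₁` and `c k` divides `c k₂`, and k₂ is one of the cofactors
        -- whose lcm is L.
        ... | r , l₁r≈ = ∣-trans (∣c-cong comb (c-comb s t (∣-trans G∣g gcd∣a) (∣c-cong k≈ G∣ck))) (c∣L l₁∈S k₂l₁)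
          where
          cop : Coprime l l₁
          cop = All.lookup cops l₁∈S
          t : Carrier
          t = proj₁ cop
          s : Carrier
          s = proj₁ (proj₂ cop)
          k₂ : Carrier
          k₂ = w * r
          l₁≉0 : ¬ l₁ ≈ 0#
          l₁≉0 = *-≉0ˡ l₁r≈ (admissible⇒prod≉0 adm)
          k₂l₁ : k₂ * l₁ ≈ w * prod S
          k₂l₁ = trans (solve 3 (λ w r l → w :* r :* l := w :* (l :* r)) refl w r l₁) (*-congˡ l₁r≈)
          k≈ : k ≈ k₂ * l
          k≈ = *-cancelʳ l₁≉0 (begin
            k * l₁            ≈⟨ eq ⟩
            w * l * prod S    ≈⟨ *-congˡ (sym l₁r≈) ⟩
            w * l * (l₁ * r)  ≈⟨ solve 4 (λ w l m r → w :* l :* (m :* r) := w :* r :* l :* m) refl w l l₁ r ⟩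
            k₂ * l * l₁       ∎)
          comb : s * k₁ + t * (k₂ * l) ≈ k₂
          comb = begin
            s * k₁ + t * (k₂ * l)        ≈⟨ +-congʳ (*-congˡ (sym k₂l₁)) ⟩
            s * (k₂ * l₁) + t * (k₂ * l) ≈⟨ solve 5 (λ s k m t l → s :* (k :* m) :+ t :* (k :* l) := k :* (t :* l :+ s :* m)) refl s k₂ l₁ t l ⟩
            k₂ * (t * l + s * l₁)        ≈⟨ *-congˡ (proj₂ (proj₂ cop)) ⟩
            k₂ * 1#                      ≈⟨ *-identityʳ k₂ ⟩
            k₂                           ∎
      L∣g : L ∣ g
      L∣g = ∣-respʳ identity (∣-+ (∣n⇒∣m*n _ L∣ck₁) (∣n⇒∣m*n _ L∣L′))
        where
        L∣ck₁ : L ∣ c k₁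
        L∣ck₁ = local ∣-refl λ {l₁} {k} _ eq _ G∣ck → ∣-trans G∣ck (∣c-cong eq (∣c-* k l₁))
        L∣L′ : L ∣ L′
        L∣L′ = local ∣-refl λ {l₁} {k} l₁∈S eq _ G∣ck → ∣-trans G∣ck (∣-trans (∣c-* k l) (c∣L′ l₁∈S (begin
          k * l * l₁       ≈⟨ solve 3 (λ k l m → k :* l :* m := k :* m :* l) refl k l l₁ ⟩
          k * l₁ * l       ≈⟨ *-congʳ eq ⟩
          w * prod S * l   ≈⟨ solve 3 (λ w l m → w :* m :* l := w :* l :* m) refl w l (prod S) ⟩
          w * l * prod S   ∎)))
      L≡g : deg L ≡ deg g
      L≡g = ℕ.≤-antisym (∣⇒deg≤ L∣g g≉0) (∣⇒deg≤ g∣L L≉0)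
      l′ : Carrier
      l′ = proj₁ gcd∣b
      l′≉0 : ¬ l′ ≈ 0#
      l′≉0 = *-≉0ʳ (proj₂ gcd∣b) L′≉0
      -- The two lcms come from different proofs of w l ≉ 0; by the universal property each divides
      -- the other.
      lcm-irr : deg (Lcm.L (lcm adm (w * l) wl≉0)) ≡ deg L′
      lcm-irr = ℕ.≤-antisym
        (∣⇒deg≤ (Lcm.local (lcm adm (w * l) wl≉0) ∣-refl λ l∈S eq _ G∣ck → ∣-trans G∣ck (c∣L′ l∈S eq)) L′≉0)
        (∣⇒deg≤ (local′ ∣-refl λ l∈S eq _ G∣ck → ∣-trans G∣ck (Lcm.c∣L (lcm adm (w * l) wl≉0) l∈S eq)) (Lcm.L≉0 (lcm adm (w * l) wl≉0)))
      main : deg (c k₁ * l′) ℕ.+ deg L ≡ deg (c k₁) ℕ.+ deg (Lcm.L (lcm adm (w * l) wl≉0))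
      main = ≡R.begin
        deg (c k₁ * l′) ℕ.+ deg L            ≡R.≡⟨ ≡.cong₂ ℕ._+_ (deg-* ck₁≉0 l′≉0) L≡g ⟩
        deg (c k₁) ℕ.+ deg l′ ℕ.+ deg g      ≡R.≡⟨ ℕ.+-assoc (deg (c k₁)) _ _ ⟩
        deg (c k₁) ℕ.+ (deg l′ ℕ.+ deg g)    ≡R.≡⟨ ≡.cong (deg (c k₁) ℕ.+_) (ℕ.+-comm (deg l′) (deg g)) ⟩
        deg (c k₁) ℕ.+ (deg g ℕ.+ deg l′)    ≡R.≡⟨ ≡.cong (deg (c k₁) ℕ.+_) (≡.sym (deg-* g≉0 l′≉0)) ⟩
        deg (c k₁) ℕ.+ deg (g * l′)          ≡R.≡⟨ ≡.cong (deg (c k₁) ℕ.+_) (≡.trans (deg-cong (proj₂ gcd∣b)) (≡.sym lcm-irr)) ⟩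
        deg (c k₁) ℕ.+ deg (Lcm.L (lcm adm (w * l) wl≉0)) ≡R.∎
        where module ≡R = ≡.≡-Reasoning

  opaque
    Ψ∃ : ∀ {S} (adm : Admissible S) w (w≉0 : ¬ w ≈ 0#) → Lcm.L (lcm adm w w≉0) ∣ c (w * prod S)
    Ψ∃ adm w w≉0 = Lcm.local (lcm adm w w≉0) ∣-refl λ {l} {k} _ eq _ G∣ck → ∣-trans G∣ck (∣c-cong eq (∣c-* k l))

  Ψ : ∀ {S} → Admissible S → ∀ w → ¬ w ≈ 0# → Carrier
  Ψ adm w w≉0 = proj₁ (Ψ∃ adm w w≉0)

  c[w∏S]≉0 : ∀ {S} → Admissible S → ∀ {w} → ¬ w ≈ 0# → ¬ c (w * prod S) ≈ 0#
  c[w∏S]≉0 adm w≉0 = c-≉0 (*-≉0 w≉0 (admissible⇒prod≉0 adm))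

  Ψ≉0 : ∀ {S} (adm : Admissible S) w (w≉0 : ¬ w ≈ 0#) → ¬ Ψ adm w w≉0 ≈ 0#
  Ψ≉0 adm w w≉0 = *-≉0ʳ (proj₂ (Ψ∃ adm w w≉0)) (c[w∏S]≉0 adm w≉0)

  deg-L+Ψ : ∀ {S} (adm : Admissible S) w (w≉0 : ¬ w ≈ 0#) →
            deg (Lcm.L (lcm adm w w≉0)) ℕ.+ deg (Ψ adm w w≉0) ≡ deg (c (w * prod S))
  deg-L+Ψ adm w w≉0 = ≡.trans (≡.sym (deg-* (Lcm.L≉0 (lcm adm w w≉0)) (Ψ≉0 adm w w≉0)))
                              (deg-cong (proj₂ (Ψ∃ adm w w≉0)))

  deg-Ψ-[] : ∀ w (w≉0 : ¬ w ≈ 0#) → deg (Ψ [] w w≉0) ≡ δ (deg w)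
  deg-Ψ-[] w w≉0 = ≡.trans (≡.cong (ℕ._+ deg (Ψ [] w w≉0)) (≡.sym (deg-lcm-[] w w≉0)))
    (≡.trans (deg-L+Ψ [] w w≉0) (≡.trans (deg-cong (c-cong (*-identityʳ w))) (deg-c w≉0)))

  -- Inclusion-exclusion for one prime, obtained from `deg-lcm` by passing to complementary degrees.
  -- It is the analogue of Φₙₗ(x) Φₙ(x) = Φₙ(xˡ) for cyclotomic polynomials and a prime l not
  -- dividing n.
  deg-Ψ-∷ : ∀ {l S} (p : MonicPrime l × All (Coprime l) S) (adm : Admissible S) w (w≉0 : ¬ w ≈ 0#) (wl≉0 : ¬ w * l ≈ 0#) →
            deg (Ψ (p ∷ adm) w w≉0) ℕ.+ deg (Ψ adm w w≉0) ≡ deg (Ψ adm (w * l) wl≉0)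
  deg-Ψ-∷ {l} {S} p adm w w≉0 wl≉0 = ℕ.+-cancelˡ-≡ (a₁ ℕ.+ a₂) _ _
    (≡.trans (N.solve 4 (λ a b x y → (a N.:+ b) N.:+ (x N.:+ y) N.:= (a N.:+ x) N.:+ (b N.:+ y)) ≡.refl a₁ a₂ x₁ x₂)
    (≡.trans (≡.cong₂ ℕ._+_ (≡.trans (deg-L+Ψ (p ∷ adm) w w≉0)
                                      (≡.trans (deg-cong (c-cong (sym (*-assoc w l (prod S))))) (≡.sym (deg-L+Ψ adm (w * l) wl≉0))))
                             (deg-L+Ψ adm w w≉0))
    (≡.trans (N.solve 3 (λ a x y → (a N.:+ x) N.:+ y N.:= (y N.:+ a) N.:+ x) ≡.refl a₃ x₃ (deg (c (w * prod S))))
             (≡.cong (ℕ._+ x₃) (≡.sym (deg-lcm p adm w w≉0 wl≉0))))))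
    where
    module N = Data.Nat.Solver.+-*-Solver
    a₁ = deg (Lcm.L (lcm (p ∷ adm) w w≉0))
    a₂ = deg (Lcm.L (lcm adm w w≉0))
    a₃ = deg (Lcm.L (lcm adm (w * l) wl≉0))
    x₁ = deg (Ψ (p ∷ adm) w w≉0)
    x₂ = deg (Ψ adm w w≉0)
    x₃ = deg (Ψ adm (w * l) wl≉0)

  module _ {S} (adm : Admissible S) {w} (w≉0 : ¬ w ≈ 0#) where
    private Q = Ψ adm w w≉0

    -- As `c k` divides the lcm, Ψ divides the quotient of `c m` by `c k`, and `c-lift` gives that
    -- quotient.
    Ψ∣lift : ∀ {l k} → l ∈ S → k * l ≈ w * prod S → ∃ λ z → Q ∣ l + c k * c k * z
    Ψ∣lift {l} {k} l∈S kl with Lcm.c∣L (lcm adm w w≉0) l∈S kl | c-lift k l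
    ... | L″ , ckL″ | z , eq = z , L″ , *-cancelˡ ck≉0 (begin
      c k * (Q * L″)                     ≈⟨ solve 3 (λ c q l → c :* (q :* l) := c :* l :* q) refl (c k) Q L″ ⟩
      c k * L″ * Q                       ≈⟨ *-congʳ ckL″ ⟩
      Lcm.L (lcm adm w w≉0) * Q          ≈⟨ proj₂ (Ψ∃ adm w w≉0) ⟩
      c (w * prod S)                     ≈⟨ c-cong (sym kl) ⟩
      c (k * l)                          ≈⟨ eq ⟩
      c k * (l + c k * c k * z)          ∎)
      where
      ck≉0 : ¬ c k ≈ 0#
      ck≉0 = c-≉0 (*-≉0ˡ kl (*-≉0 w≉0 (admissible⇒prod≉0 adm)))

    ∣Ψ∣c⇒∣l : ∀ {p l k} → l ∈ S → k * l ≈ w * prod S → p ∣ Q → p ∣ c k → p ∣ l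
    ∣Ψ∣c⇒∣l l∈S kl p∣Q p∣ck = ∣-cancelʳ-+ (∣-trans p∣Q (proj₂ (Ψ∣lift l∈S kl)))
      (∣m⇒∣m*n _ (∣m⇒∣m*n _ p∣ck))

    -- The error term in `Ψ∣lift` contains (c k)², hence p² as soon as p ∣ c k. For p associated to
    -- the prime l the conclusion is absurd.
    ²∣Ψ∣c⇒²∣l : ∀ {p l k} → l ∈ S → k * l ≈ w * prod S → p * p ∣ Q → p ∣ c k → p * p ∣ l
    ²∣Ψ∣c⇒²∣l {p} {k = k} l∈S kl p²∣Q (r , pr≈ck) = ∣-cancelʳ-+ (∣-trans p²∣Q (proj₂ (Ψ∣lift l∈S kl)))
      (∣m⇒∣m*n _ (r * r , trans (solve 2 (λ p r → p :* p :* (r :* r) := (p :* r) :* (p :* r)) refl p r) (*-cong pr≈ck pr≈ck)))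

  ZsigmondyPrime : Carrier → Carrier → Set
  ZsigmondyPrime m p = MonicPrime p × p ∣ c m × (∀ n → ¬ n ≈ 0# → deg n < deg m → p ∤ c n)

  module _ {m} (mm : Monic m) (rad : Radical m) where
    open Radical rad
    private
      adm = admissible primes coprime
      w≉0 = monic⇒≉0 w-monic
      Q = Ψ adm w w≉0

    -- A divisor p of Ψ fails to be a Zsigmondy prime only by dividing some `c (m/l)`, and then it
    -- also divides l; the last hypothesis forbids this combination.
    zsigmondy : ∀ {p} → MonicPrime p → p ∣ Q →
                (∀ {l k} → l ∈ S → k * l ≈ w * prod S → p ∣ l → p ∣ c k → ⊥) → ZsigmondyPrime m p
    zsigmondy {p} pp p∣Q H = pp , p∣cm , new
      where
      p∣cm : p ∣ c m
      p∣cm = ∣c-cong (sym m≈) (∣-trans p∣Q (_ , trans (*-comm _ _) (proj₂ (Ψ∃ adm w w≉0))))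
      new : ∀ n → ¬ n ≈ 0# → deg n < deg m → p ∤ c n
      -- An arbitrary n of smaller degree is replaced by g = gcd(n , m), since p divides `c g` too.
      -- As deg g < deg m, some prime l ∈ S divides m/g, so g divides the cofactor m/l and p ∣ c
      -- (m/l).
      new n n≉0 n<m p∣cn with bezout n m
      ... | B@(bézout {g} {s} {t} g∣n (r , gr≈m) id) with prime-divisor r≉0 0<r
        where
        r≉0 : ¬ r ≈ 0#
        r≉0 = *-≉0ʳ gr≈m (monic⇒≉0 mm)
        0<r : 0 < deg r
        0<r = ℕ.n≢0⇒n>0 λ r≡0 → ℕ.<⇒≱ n<m (≡.subst (_≤ deg n)
          (≡.trans (≡.sym (ℕ.+-identityʳ _)) (≡.trans (≡.cong (deg g ℕ.+_) (≡.sym r≡0))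
            (≡.trans (≡.sym (deg-* (bezout-≉0 B n≉0) r≉0)) (deg-cong gr≈m)))) (∣⇒deg≤ g∣n n≉0))
      ...   | π , (_ , pπ) , π∣r with divisors pπ (∣-respʳ gr≈m (∣n⇒∣m*n g π∣r))
      ...     | l , l∈S , π∣l with ∣-trans (prime∣prime pπ (proj₂ (All.lookup primes l∈S)) π∣l) π∣r
      ...       | r′ , lr′≈r = H l∈S kl≈ (∣Ψ∣c⇒∣l adm w≉0 l∈S kl≈ p∣Q p∣ck) p∣ck
        where
        kl≈ : g * r′ * l ≈ w * prod S
        kl≈ = begin
          g * r′ * l    ≈⟨ solve 3 (λ g r l → g :* r :* l := g :* (l :* r)) refl g r′ l ⟩
          g * (l * r′)  ≈⟨ *-congˡ lr′≈r ⟩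
          g * r         ≈⟨ gr≈m ⟩
          m             ≈⟨ m≈ ⟩
          w * prod S    ∎
        p∣ck : p ∣ c (g * r′)
        p∣ck = ∣-trans (∣c-cong id (c-comb s t p∣cn p∣cm)) (∣c-* g r′)

    opaque
      -- Each l ∈ T is divided out of q at most once, which costs at most its degree. If l still
      -- divides what is left, it must have divided q at least twice.
      strip : ∀ {q} → ¬ q ≈ 0# → ∀ T → All MonicPrime T →
              ∃ λ q′ → q′ ∣ q × deg q ≤ deg q′ ℕ.+ sum (degs T) × (∀ {l} → l ∈ T → l ∣ q′ → l * l ∣ q)
      strip {q} q≉0 [] [] = q , ∣-refl , ℕ.≤-reflexive (≡.sym (ℕ.+-identityʳ _)) , λ ()
      strip {q} q≉0 (l ∷ T) (pl ∷ pT) with strip q≉0 T pT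
      ... | q′ , q′∣q , d≤ , H with (l ∣? q′) (proj₁ (proj₂ pl))
      ...   | no l∤q′ = q′ , q′∣q , ℕ.≤-trans d≤ (ℕ.+-monoʳ-≤ (deg q′) (ℕ.m≤n+m _ (deg l))) , H′
        where
        H′ : ∀ {l₁} → l₁ ∈ l ∷ T → l₁ ∣ q′ → l₁ * l₁ ∣ q
        H′ (here ≡.refl) l∣q′ = contradiction l∣q′ l∤q′
        H′ (there l₁∈T)       = H l₁∈T
      ...   | yes (q″ , lq″≈q′) = q″ , ∣-trans (_ , trans (*-comm q″ l) lq″≈q′) q′∣q , d′ , H′
        where
        q′≉0 : ¬ q′ ≈ 0#
        q′≉0 = *-≉0ˡ (proj₂ q′∣q) q≉0
        d′ : deg q ≤ deg q″ ℕ.+ (deg l ℕ.+ sum (degs T))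
        d′ = ℕ.≤-trans d≤ (ℕ.≤-reflexive (≡.trans (≡.cong (ℕ._+ sum (degs T))
          (≡.trans (≡.sym (deg-cong lq″≈q′)) (≡.trans (deg-* (*-≉0ˡ lq″≈q′ q′≉0) (*-≉0ʳ lq″≈q′ q′≉0)) (ℕ.+-comm (deg l) (deg q″)))))
          (ℕ.+-assoc (deg q″) _ _)))
        H′ : ∀ {l₁} → l₁ ∈ l ∷ T → l₁ ∣ q″ → l₁ * l₁ ∣ q
        H′ (here ≡.refl) l∣q″ = ∣-trans (∣-respʳ lq″≈q′ (*-monoˡ-∣ l l∣q″)) q′∣q
        H′ (there l₁∈T) l₁∣q″ = H l₁∈T (∣-respʳ lq″≈q′ (∣n⇒∣m*n l l₁∣q″))

    large-Ψ⇒zsigmondy : sum (degs S) < deg Q → ∃ (ZsigmondyPrime m)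
    large-Ψ⇒zsigmondy ΣS<Q with strip (Ψ≉0 adm w w≉0) S primes
    ... | q′ , q′∣Q , d≤ , H with prime-divisor (*-≉0ˡ (proj₂ q′∣Q) (Ψ≉0 adm w w≉0))
                                   (ℕ.+-cancelʳ-< (sum (degs S)) 0 (deg q′) (ℕ.<-≤-trans ΣS<Q d≤))
    -- If p divided both l and `c k`, it would be associated to l. Then l divides the stripped
    -- quotient, so l² divides Ψ, and by `²∣Ψ∣c⇒²∣l` it divides l.
    ...   | p , pp , p∣q′ = p , zsigmondy pp (∣-trans p∣q′ q′∣Q) λ {l} {k} l∈S kl p∣l p∣ck →
      let pl = proj₂ (All.lookup primes l∈S)
          l∣p = prime∣prime (proj₂ pp) pl p∣l
      in prime-²∤ pl (²∣Ψ∣c⇒²∣l adm w≉0 l∈S kl (H l∈S (∣-trans l∣p p∣q′)) (∣-trans l∣p p∣ck))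

-- Finite fields

module FieldProperties {q} (F : FiniteField q) where
  open FiniteField F using (0≢1; inv; inv-correct; _≟_; card; isCommRing)
  open ≡ using (cong; cong₂; sym; trans; refl)
  open ≡.≡-Reasoning

  field-ring : CommutativeRing 0ℓ 0ℓ
  field-ring = record { isCommutativeRing = isCommRing }

  open CommutativeRing field-ring hiding (sym; trans; refl; _≈_)
  open Algebra.Properties.Semiring.Mult semiring using (×1-homo-*) renaming (_×_ to _×ₙ_)
  open Algebra.Properties.Semiring.Exp semiring using (_^_)
  module Sum = Algebra.Properties.CommutativeMonoid.Sum +-commutativeMonoid
  module Prod = Algebra.Properties.CommutativeMonoid.Sum *-commutativeMonoid

  *-cancelˡ : ∀ {x y z} → x ≢ 0# → x * y ≡ x * z → y ≡ z
  *-cancelˡ {x} {y} {z} x≢0 eq = begin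
    y                    ≡⟨ undo y ⟨
    inv x x≢0 * (x * y)  ≡⟨ cong (inv x x≢0 *_) eq ⟩
    inv x x≢0 * (x * z)  ≡⟨ undo z ⟩
    z                    ∎
    where
    undo : ∀ y → inv x x≢0 * (x * y) ≡ y
    undo y = trans (sym (*-assoc _ x y)) (trans (cong (_* y) (trans (*-comm _ x) (inv-correct x x≢0))) (*-identityˡ y))

  *-≢0 : ∀ {x y} → x ≢ 0# → y ≢ 0# → x * y ≢ 0#
  *-≢0 {x} x≢0 y≢0 xy≡0 = y≢0 (*-cancelˡ x≢0 (trans xy≡0 (sym (zeroʳ x))))

  inv-≢0 : ∀ {x} (x≢0 : x ≢ 0#) → inv x x≢0 ≢ 0#
  inv-≢0 {x} x≢0 eq = 0≢1 (trans (sym (zeroʳ x)) (trans (cong (x *_) (sym eq)) (inv-correct x x≢0)))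

  private
    elem : Fin q → Carrier
    elem = Inverse.from card

    index : Carrier → Fin q
    index = Inverse.to card

    elem-index : ∀ x → elem (index x) ≡ x
    elem-index = Inverse.strictlyInverseʳ card

    permutation : Carrier ↔ Carrier → Permutation′ q
    permutation π = card ↔-∘ (π ↔-∘ ↔-sym card)

  any? : {P : Carrier → Set} → (∀ x → Dec (P x)) → Dec (∃ P)
  any? {P} P? = map′ (λ (i , Pi) → elem i , Pi) (λ (x , Px) → index x , ≡.subst P (sym (elem-index x)) Px)
                  (Fin.any? (λ i → P? (elem i)))

  pigeonhole : (f : Fin (suc q) → Carrier) → ∃₂ λ i j → i Fin.< j × f i ≡ f j
  pigeonhole f with Fin.pigeonhole ℕ.≤-refl (λ i → index (f i))
  ... | i , j , i<j , eq = i , j , i<j , trans (sym (elem-index (f i))) (trans (cong elem eq) (elem-index (f j)))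

  -- The translation by 1 permutes the field.
  q×1≡0 : q ×ₙ 1# ≡ 0#
  q×1≡0 = +-cancelˡ (Sum.sum elem) (q ×ₙ 1#) 0# (begin
    Sum.sum elem + q ×ₙ 1#                         ≡⟨ cong (Sum.sum elem +_) (Sum.sum-replicate q) ⟨
    Sum.sum elem + Sum.sum {q} (λ _ → 1#)          ≡⟨ Sum.∑-distrib-+ elem (λ _ → 1#) ⟨
    Sum.sum (λ i → elem i + 1#)                    ≡⟨ Sum.sum-cong-≗ (λ i → elem-index (elem i + 1#)) ⟨
    Sum.sum (λ i → elem (permutation shift ⟨$⟩ʳ i)) ≡⟨ Sum.sum-permute elem (permutation shift) ⟨
    Sum.sum elem                                   ≡⟨ +-identityʳ _ ⟨
    Sum.sum elem + 0#                              ∎)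
    where
    open import Algebra.Properties.Ring ring using (+-cancelˡ)
    shift : Carrier ↔ Carrier
    shift = mk↔ₛ′ (_+ 1#) (_+ - 1#)
      (λ x → trans (+-assoc x _ _) (trans (cong (x +_) (-‿inverseˡ 1#)) (+-identityʳ x)))
      (λ x → trans (+-assoc x _ _) (trans (cong (x +_) (-‿inverseʳ 1#)) (+-identityʳ x)))

  -- p^e × 1 is the e-th power of p × 1, and a field has no zero divisors.
  p×1≡0 : ∀ p e → q ≡ p ℕ.^ e → p ×ₙ 1# ≡ 0#
  p×1≡0 p e q≡p^e = go e (≡.subst (λ n → n ×ₙ 1# ≡ 0#) q≡p^e q×1≡0)
    where
    go : ∀ e → (p ℕ.^ e) ×ₙ 1# ≡ 0# → p ×ₙ 1# ≡ 0#
    go zero    eq = contradiction (trans (sym eq) (+-identityʳ 1#)) 0≢1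
    go (suc e) eq with (p ×ₙ 1#) ≟ 0#
    ... | yes p×1≡0 = p×1≡0
    ... | no  p×1≢0 = go e (*-cancelˡ p×1≢0 (trans (sym (×1-homo-* p (p ℕ.^ e))) (trans eq (sym (zeroʳ _)))))

module Fermat {n} (F : FiniteField (suc n)) where
  open FiniteField F using (0≢1; inv; inv-correct; _≟_; card)
  open FieldProperties F
  open CommutativeRing field-ring hiding (sym; trans; refl; _≈_)
  open ≡ using (cong; cong₂; sym; trans; refl)
  open ≡.≡-Reasoning
  open Algebra.Properties.Semiring.Exp semiring using (_^_)

  private
    elem : Fin (suc n) → Carrier
    elem = Inverse.from card

    -- Putting the factor 1 at y = 0 turns a product over the nonzero elements into one over the
    -- whole index set, to which permutations of the field apply.
    unlessZero : Carrier → Carrier → Carrier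
    unlessZero y a with y ≟ 0#
    ... | yes _ = 1#
    ... | no  _ = a

    unlessZero-0 : ∀ {y a} → y ≡ 0# → unlessZero y a ≡ 1#
    unlessZero-0 {y} y≡0 with y ≟ 0#
    ... | yes _   = refl
    ... | no  y≢0 = contradiction y≡0 y≢0

    unlessZero-≢0 : ∀ {y a} → y ≢ 0# → unlessZero y a ≡ a
    unlessZero-≢0 {y} y≢0 with y ≟ 0#
    ... | yes y≡0 = contradiction y≡0 y≢0
    ... | no  _   = refl

    prod-≢0 : ∀ {m} (f : Fin m → Carrier) → (∀ i → f i ≢ 0#) → Prod.sum f ≢ 0#
    prod-≢0 {zero}  f f≢0 eq = 0≢1 (sym eq)
    prod-≢0 {suc m} f f≢0    = *-≢0 (f≢0 Fin.zero) (prod-≢0 (λ i → f (Fin.suc i)) (λ i → f≢0 (Fin.suc i)))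

    -- Multiplication by x permutes the nonzero elements.
    x^n≡1 : ∀ x → x ≢ 0# → x ^ n ≡ 1#
    x^n≡1 x x≢0 = begin
      x ^ n                                   ≡⟨ Prod.sum-replicate n ⟨
      Prod.sum {n} (λ _ → x)                  ≡⟨ Prod.sum-cong-≗ (λ j → unlessZero-≢0 (others j)) ⟨
      Prod.sum (removeAt h i₀)                ≡⟨ *-identityˡ _ ⟨
      1# * Prod.sum (removeAt h i₀)           ≡⟨ cong (_* Prod.sum (removeAt h i₀)) (unlessZero-0 (Inverse.strictlyInverseʳ card 0#)) ⟨
      h i₀ * Prod.sum (removeAt h i₀)         ≡⟨ Prod.sum-remove {i = i₀} h ⟨
      Prod.sum h                              ≡⟨ *-cancelˡ (prod-≢0 f f≢0) ∏h ⟩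
      1#                                      ∎
      where
      f h : Fin (suc n) → Carrier
      f i = unlessZero (elem i) (elem i)
      h i = unlessZero (elem i) x
      i₀ = Inverse.to card 0#
      others : ∀ j → elem (Fin.punchIn i₀ j) ≢ 0#
      others j eq = Fin.punchInᵢ≢i i₀ j (trans (sym (Inverse.strictlyInverseˡ card _)) (cong (Inverse.to card) eq))
      f≢0 : ∀ i → f i ≢ 0#
      f≢0 i with elem i ≟ 0#
      ... | yes _   = λ 1≡0 → 0≢1 (sym 1≡0)
      ... | no  y≢0 = y≢0
      scale : Carrier ↔ Carrier
      scale = mk↔ₛ′ (x *_) (inv x x≢0 *_)
        (λ y → trans (sym (*-assoc x _ y)) (trans (cong (_* y) (inv-correct x x≢0)) (*-identityˡ y)))
        (λ y → trans (sym (*-assoc _ x y)) (trans (cong (_* y) (trans (*-comm _ x) (inv-correct x x≢0))) (*-identityˡ y)))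
      π : Permutation′ (suc n)
      π = card ↔-∘ (scale ↔-∘ ↔-sym card)
      step : ∀ y → unlessZero (x * y) (x * y) ≡ unlessZero y y * unlessZero y x
      step y with y ≟ 0#
      ... | yes y≡0 = trans (unlessZero-0 (trans (cong (x *_) y≡0) (zeroʳ x))) (sym (*-identityˡ 1#))
      ... | no  y≢0 = trans (unlessZero-≢0 (*-≢0 x≢0 y≢0)) (*-comm x y)
      ∏h : Prod.sum f * Prod.sum h ≡ Prod.sum f * 1#
      ∏h = begin
        Prod.sum f * Prod.sum h                ≡⟨ Prod.∑-distrib-+ f h ⟨
        Prod.sum (λ i → f i * h i)             ≡⟨ Prod.sum-cong-≗ (λ i → step (elem i)) ⟨
        Prod.sum (λ i → unlessZero (x * elem i) (x * elem i))
          ≡⟨ Prod.sum-cong-≗ (λ i → cong (λ y → unlessZero y y) (Inverse.strictlyInverseʳ card (x * elem i))) ⟨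
        Prod.sum (λ i → f (π ⟨$⟩ʳ i))          ≡⟨ Prod.sum-permute f π ⟨
        Prod.sum f                             ≡⟨ *-identityʳ _ ⟨
        Prod.sum f * 1#                        ∎

  x^[1+n]≡x : ∀ x → x ^ suc n ≡ x
  x^[1+n]≡x x with x ≟ 0#
  ... | yes x≡0 = trans (cong (_* x ^ n) x≡0) (trans (zeroˡ _) (sym x≡0))
  ... | no  x≢0 = trans (cong (x *_) (x^n≡1 x x≢0)) (*-identityʳ x)

fermat : ∀ {q} (F : FiniteField q) (x : FiniteField.Carrier F) →
         Algebra.Properties.Semiring.Exp._^_ (CommutativeRing.semiring (FieldProperties.field-ring F)) x q ≡ x
fermat {zero}  F x with Inverse.to (FiniteField.card F) x
... | ()
fermat {suc n} F x = Fermat.x^[1+n]≡x F x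

-- The ring 𝔽q[T]

module PolyRing {q} (F : FiniteField q) where
  open FiniteField F using (0≢1; inv; inv-correct; _≟_)
  open FieldProperties F
  open CommutativeRing field-ring hiding (sym; trans; refl; _≈_; *-comm; *-assoc)
  open CommutativeRing field-ring using () renaming (*-comm to ·-comm; *-assoc to ·-assoc)
  open Algebra.Properties.Ring ring using (-0#≈0#)
  open Algebra.Solver.Ring.NaturalCoefficients.Default commutativeSemiring
    using (solve; _:=_; _:+_; _:*_; con)
  open PolyDefs F
  open ≡ using (cong; cong₂; sym; trans; refl)
  open ≡.≡-Reasoning

  coef : Poly → ℕ → Carrier
  coef []      i       = 0#
  coef (a ∷ f) zero    = a
  coef (a ∷ f) (suc i) = coef f i

  infix 4 _≋_
  -- Equivalent to `_≈_`, but blind to trailing zeros by construction and compatible with recursion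
  -- on lists; the ring laws are proved for it and then transferred.
  _≋_ : Poly → Poly → Set
  f ≋ g = ∀ i → coef f i ≡ coef g i

  ∷-cong : ∀ {a b f g} → a ≡ b → f ≋ g → a ∷ f ≋ b ∷ g
  ∷-cong a≡b f≋g zero    = a≡b
  ∷-cong a≡b f≋g (suc i) = f≋g i

  coef-norm : ∀ f → norm f ≋ f
  coef-norm [] i = refl
  coef-norm (a ∷ f) with norm f | coef-norm f
  ... | b ∷ g | ih = ∷-cong refl ih
  ... | []    | ih with a ≟ 0#
  ...   | yes a≡0 = λ { zero → sym a≡0 ; (suc i) → ih i }
  ...   | no  _   = ∷-cong refl ih

  norm-∷-cong : ∀ {a f g} → norm f ≡ norm g → norm (a ∷ f) ≡ norm (a ∷ g)
  norm-∷-cong {a} {f} {g} eq with norm f | norm g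
  norm-∷-cong refl | x | .x = refl

  norm-0∷ : ∀ {a f} → a ≡ 0# → norm f ≡ [] → norm (a ∷ f) ≡ []
  norm-0∷ {a} {f} a≡0 eq with norm f
  norm-0∷ {a} a≡0 refl | .[] with a ≟ 0#
  ... | yes _   = refl
  ... | no  a≢0 = contradiction a≡0 a≢0

  ≋[]⇒norm≡[] : ∀ f → f ≋ [] → norm f ≡ []
  ≋[]⇒norm≡[] []      f≋0 = refl
  ≋[]⇒norm≡[] (a ∷ f) f≋0 = norm-0∷ {a} {f} (f≋0 0) (≋[]⇒norm≡[] f (λ i → f≋0 (suc i)))

  ≋⇒≈ : ∀ {f g} → f ≋ g → f ≈ g
  ≋⇒≈ {[]}    {g}     f≋g = sym (≋[]⇒norm≡[] g (λ i → sym (f≋g i)))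
  ≋⇒≈ {a ∷ f} {[]}    f≋g = ≋[]⇒norm≡[] (a ∷ f) f≋g
  ≋⇒≈ {a ∷ f} {b ∷ g} f≋g with f≋g 0
  ... | refl = norm-∷-cong {a} {f} {g} (≋⇒≈ {f} {g} (λ i → f≋g (suc i)))

  ≈⇒≋ : ∀ {f g} → f ≈ g → f ≋ g
  ≈⇒≋ {f} {g} eq i = trans (sym (coef-norm f i)) (trans (cong (λ h → coef h i) eq) (coef-norm g i))

  coef-+ : ∀ f g i → coef (f +P g) i ≡ coef f i + coef g i
  coef-+ []      g       i       = sym (+-identityˡ _)
  coef-+ (a ∷ f) []      i       = sym (+-identityʳ _)
  coef-+ (a ∷ f) (b ∷ g) zero    = refl
  coef-+ (a ∷ f) (b ∷ g) (suc i) = coef-+ f g i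

  coef-neg : ∀ f i → coef (negP f) i ≡ - coef f i
  coef-neg []      i       = sym -0#≈0#
  coef-neg (a ∷ f) zero    = refl
  coef-neg (a ∷ f) (suc i) = coef-neg f i

  coef-scal : ∀ c f i → coef (scal c f) i ≡ c * coef f i
  coef-scal c []      i       = sym (zeroʳ c)
  coef-scal c (a ∷ f) zero    = refl
  coef-scal c (a ∷ f) (suc i) = coef-scal c f i

  coef-*-∷ : ∀ a f g i → coef ((a ∷ f) *P g) i ≡ a * coef g i + coef (0# ∷ f *P g) i
  coef-*-∷ a f g i = trans (coef-+ (scal a g) _ i) (cong (_+ coef (0# ∷ f *P g) i) (coef-scal a g i))

  *-distribʳ : ∀ h f g i → coef ((f +P g) *P h) i ≡ coef (f *P h) i + coef (g *P h) i
  *-distribʳ h []      g       i = sym (+-identityˡ _)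
  *-distribʳ h (a ∷ f) []      i = sym (+-identityʳ _)
  *-distribʳ h (a ∷ f) (b ∷ g) i = begin
    coef ((a + b ∷ f +P g) *P h) i                        ≡⟨ coef-*-∷ (a + b) (f +P g) h i ⟩
    (a + b) * coef h i + coef (0# ∷ (f +P g) *P h) i      ≡⟨ cong ((a + b) * coef h i +_) (tail i) ⟩
    (a + b) * coef h i + (coef (0# ∷ f *P h) i + coef (0# ∷ g *P h) i)
      ≡⟨ solve 5 (λ a b h x y → (a :+ b) :* h :+ (x :+ y) := (a :* h :+ x) :+ (b :* h :+ y)) refl a b (coef h i) _ _ ⟩
    (a * coef h i + coef (0# ∷ f *P h) i) + (b * coef h i + coef (0# ∷ g *P h) i)
      ≡⟨ cong₂ _+_ (coef-*-∷ a f h i) (coef-*-∷ b g h i) ⟨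
    coef ((a ∷ f) *P h) i + coef ((b ∷ g) *P h) i         ∎
    where
    tail : ∀ i → coef (0# ∷ (f +P g) *P h) i ≡ coef (0# ∷ f *P h) i + coef (0# ∷ g *P h) i
    tail zero    = sym (+-identityˡ 0#)
    tail (suc i) = *-distribʳ h f g i

  *-[] : ∀ f → f *P [] ≋ []
  *-[] []      i       = refl
  *-[] (a ∷ f) zero    = refl
  *-[] (a ∷ f) (suc i) = *-[] f i

  coef-*-∷ʳ : ∀ f b g i → coef (f *P (b ∷ g)) i ≡ b * coef f i + coef (0# ∷ f *P g) i
  coef-*-∷ʳ []      b g zero    = sym (trans (+-identityʳ _) (zeroʳ b))
  coef-*-∷ʳ []      b g (suc i) = sym (trans (+-identityʳ _) (zeroʳ b))
  coef-*-∷ʳ (a ∷ f) b g zero    = trans (+-identityʳ _) (trans (·-comm a b) (sym (+-identityʳ _)))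
  coef-*-∷ʳ (a ∷ f) b g (suc i) = begin
    coef (scal a g +P f *P (b ∷ g)) i                 ≡⟨ coef-+ (scal a g) _ i ⟩
    coef (scal a g) i + coef (f *P (b ∷ g)) i         ≡⟨ cong₂ _+_ (coef-scal a g i) (coef-*-∷ʳ f b g i) ⟩
    a * coef g i + (b * coef f i + coef (0# ∷ f *P g) i) ≡⟨ solve 3 (λ x y z → x :+ (y :+ z) := y :+ (x :+ z)) refl _ _ _ ⟩
    b * coef f i + (a * coef g i + coef (0# ∷ f *P g) i) ≡⟨ cong (b * coef f i +_) (coef-*-∷ a f g i) ⟨
    b * coef f i + coef ((a ∷ f) *P g) i              ∎

  *-comm-≋ : ∀ f g → f *P g ≋ g *P f
  *-comm-≋ []      g i = sym (*-[] g i)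
  *-comm-≋ (a ∷ f) g i = trans (coef-*-∷ a f g i)
    (trans (cong (a * coef g i +_) (∷-cong refl (*-comm-≋ f g) i)) (sym (coef-*-∷ʳ g a f i)))

  *-congʳ-≋ : ∀ f {g h} → g ≋ h → f *P g ≋ f *P h
  *-congʳ-≋ []      g≋h i = refl
  *-congʳ-≋ (a ∷ f) {g} {h} g≋h i = trans (coef-*-∷ a f g i)
    (trans (cong₂ _+_ (cong (a *_) (g≋h i)) (∷-cong refl (*-congʳ-≋ f g≋h) i)) (sym (coef-*-∷ a f h i)))

  coef-scal-* : ∀ c f g i → coef (scal c f *P g) i ≡ c * coef (f *P g) i
  coef-scal-* c []      g i = sym (zeroʳ c)
  coef-scal-* c (a ∷ f) g i = begin
    coef ((c * a ∷ scal c f) *P g) i                        ≡⟨ coef-*-∷ (c * a) (scal c f) g i ⟩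
    c * a * coef g i + coef (0# ∷ scal c f *P g) i          ≡⟨ cong (c * a * coef g i +_) (tail i) ⟩
    c * a * coef g i + c * coef (0# ∷ f *P g) i             ≡⟨ solve 4 (λ c a g x → c :* a :* g :+ c :* x := c :* (a :* g :+ x)) refl c a _ _ ⟩
    c * (a * coef g i + coef (0# ∷ f *P g) i)               ≡⟨ cong (c *_) (coef-*-∷ a f g i) ⟨
    c * coef ((a ∷ f) *P g) i                               ∎
    where
    tail : ∀ i → coef (0# ∷ scal c f *P g) i ≡ c * coef (0# ∷ f *P g) i
    tail zero    = sym (zeroʳ c)
    tail (suc i) = coef-scal-* c f g i

  coef-0∷-* : ∀ f g → (0# ∷ f) *P g ≋ 0# ∷ f *P g
  coef-0∷-* f g i = trans (coef-*-∷ 0# f g i) (trans (cong (_+ coef (0# ∷ f *P g) i) (zeroˡ _)) (+-identityˡ _))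

  *-assoc-≋ : ∀ f g h → (f *P g) *P h ≋ f *P (g *P h)
  *-assoc-≋ []      g h i = refl
  *-assoc-≋ (a ∷ f) g h i = begin
    coef ((scal a g +P (0# ∷ f *P g)) *P h) i                   ≡⟨ *-distribʳ h (scal a g) (0# ∷ f *P g) i ⟩
    coef (scal a g *P h) i + coef ((0# ∷ f *P g) *P h) i        ≡⟨ cong₂ _+_ (coef-scal-* a g h i) (coef-0∷-* (f *P g) h i) ⟩
    a * coef (g *P h) i + coef (0# ∷ (f *P g) *P h) i           ≡⟨ cong (a * coef (g *P h) i +_) (∷-cong refl (*-assoc-≋ f g h) i) ⟩
    a * coef (g *P h) i + coef (0# ∷ f *P (g *P h)) i           ≡⟨ coef-*-∷ a f (g *P h) i ⟨
    coef ((a ∷ f) *P (g *P h)) i                                ∎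

  *-identityˡ-≋ : ∀ f → oneP *P f ≋ f
  *-identityˡ-≋ f i = trans (coef-*-∷ 1# [] f i) (trans (cong₂ _+_ (*-identityˡ _) (zeros i)) (+-identityʳ _))
    where
    zeros : 0# ∷ [] ≋ []
    zeros zero    = refl
    zeros (suc i) = refl

  private
    +-cong-≋ : ∀ {f f′ g g′} → f ≋ f′ → g ≋ g′ → f +P g ≋ f′ +P g′
    +-cong-≋ {f} {f′} {g} {g′} f≋ g≋ i = trans (coef-+ f g i) (trans (cong₂ _+_ (f≋ i) (g≋ i)) (sym (coef-+ f′ g′ i)))

    *-cong-≋ : ∀ {f f′ g g′} → f ≋ f′ → g ≋ g′ → f *P g ≋ f′ *P g′
    *-cong-≋ {f} {f′} {g} {g′} f≋ g≋ i = trans (*-congʳ-≋ f g≋ i)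
      (trans (*-comm-≋ f g′ i) (trans (*-congʳ-≋ g′ f≋ i) (*-comm-≋ g′ f′ i)))

    +-assoc-≋ : ∀ f g h → (f +P g) +P h ≋ f +P (g +P h)
    +-assoc-≋ f g h i = begin
      coef ((f +P g) +P h) i              ≡⟨ trans (coef-+ (f +P g) h i) (cong (_+ coef h i) (coef-+ f g i)) ⟩
      coef f i + coef g i + coef h i      ≡⟨ +-assoc _ _ _ ⟩
      coef f i + (coef g i + coef h i)    ≡⟨ trans (coef-+ f (g +P h) i) (cong (coef f i +_) (coef-+ g h i)) ⟨
      coef (f +P (g +P h)) i              ∎

    +-comm-≋ : ∀ f g → f +P g ≋ g +P f
    +-comm-≋ f g i = trans (coef-+ f g i) (trans (+-comm _ _) (sym (coef-+ g f i)))

    negP-inverseʳ : ∀ f → f +P negP f ≋ []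
    negP-inverseʳ f i = trans (coef-+ f (negP f) i) (trans (cong (coef f i +_) (coef-neg f i)) (-‿inverseʳ _))

  poly-ring : CommutativeRing 0ℓ 0ℓ
  poly-ring = record
    { Carrier = Poly ; _≈_ = _≈_ ; _+_ = _+P_ ; _*_ = _*P_ ; -_ = negP ; 0# = zeroP ; 1# = oneP
    ; isCommutativeRing = record
      { isRing = record
        { +-isAbelianGroup = record
          { isGroup = record
            { isMonoid = record
              { isSemigroup = record
                { isMagma = record
                  { isEquivalence = record { refl = refl ; sym = sym ; trans = trans }
                  ; ∙-cong = λ {f} {f′} {g} {g′} p r → ≋⇒≈ {f +P g} {f′ +P g′} (+-cong-≋ {f} {f′} {g} {g′} (≈⇒≋ {f} {f′} p) (≈⇒≋ {g} {g′} r)) }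
                ; assoc = λ f g h → ≋⇒≈ {(f +P g) +P h} {f +P (g +P h)} (+-assoc-≋ f g h) }
              ; identity = (λ f → refl) , (λ f → ≋⇒≈ {f +P []} {f} (+-comm-≋ f [])) }
            ; inverse = (λ f → ≋⇒≈ {negP f +P f} {[]} (λ i → trans (+-comm-≋ (negP f) f i) (negP-inverseʳ f i))) , (λ f → ≋⇒≈ {f +P negP f} {[]} (negP-inverseʳ f))
            ; ⁻¹-cong = λ {f} {g} p → ≋⇒≈ {negP f} {negP g} (λ i → trans (coef-neg f i) (trans (cong (-_) (≈⇒≋ {f} {g} p i)) (sym (coef-neg g i)))) }
          ; comm = λ f g → ≋⇒≈ {f +P g} {g +P f} (+-comm-≋ f g) }
        ; *-cong = λ {f} {f′} {g} {g′} p r → ≋⇒≈ {f *P g} {f′ *P g′} (*-cong-≋ {f} {f′} {g} {g′} (≈⇒≋ {f} {f′} p) (≈⇒≋ {g} {g′} r))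
        ; *-assoc = λ f g h → ≋⇒≈ {(f *P g) *P h} {f *P (g *P h)} (*-assoc-≋ f g h)
        ; *-identity = (λ f → ≋⇒≈ {oneP *P f} {f} (*-identityˡ-≋ f)) , (λ f → ≋⇒≈ {f *P oneP} {f} (λ i → trans (*-comm-≋ f oneP i) (*-identityˡ-≋ f i)))
        ; distrib = (λ f g h → ≋⇒≈ {f *P (g +P h)} {f *P g +P f *P h} (λ i → trans (*-comm-≋ f (g +P h) i) (trans (*-distribʳ f g h i)
                       (trans (cong₂ _+_ (*-comm-≋ g f i) (*-comm-≋ h f i)) (sym (coef-+ (f *P g) (f *P h) i))))))
                  , (λ h f g → ≋⇒≈ {(f +P g) *P h} {f *P h +P g *P h} (λ i → trans (*-distribʳ h f g i) (sym (coef-+ (f *P h) (g *P h) i)))) }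
      ; *-comm = λ f g → ≋⇒≈ {f *P g} {g *P f} (*-comm-≋ f g) } }

  -- A degree bound that also makes sense for the zero polynomial, where `deg` is the default 0. In
  -- a division, `Below r (deg b)` covers a zero and a nonzero remainder alike.
  Below : Poly → ℕ → Set
  Below f n = ∀ i → n ≤ i → coef f i ≡ 0#

  below-length : ∀ f → Below f (length f)
  below-length []      i       _         = refl
  below-length (a ∷ f) (suc i) (s≤s n≤i) = below-length f i n≤i

  below-≤ : ∀ {f m n} → m ≤ n → Below f m → Below f n
  below-≤ m≤n b i n≤i = b i (ℕ.≤-trans m≤n n≤i)

  below-+ : ∀ {f g n} → Below f n → Below g n → Below (f +P g) n
  below-+ {f} {g} bf bg i n≤i = trans (coef-+ f g i) (trans (cong₂ _+_ (bf i n≤i) (bg i n≤i)) (+-identityˡ 0#))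

  below-scal : ∀ {f n} c → Below f n → Below (scal c f) n
  below-scal {f} c bf i n≤i = trans (coef-scal c f i) (trans (cong (c *_) (bf i n≤i)) (zeroʳ c))

  below-tail : ∀ {a f n} → Below (a ∷ f) (suc n) → Below f n
  below-tail b i n≤i = b (suc i) (s≤s n≤i)

  lead : Poly → Carrier
  lead f = coef f (deg f)

  norm-lead : ∀ f → norm f ≡ [] ⊎ coef (norm f) (length (norm f) ∸ 1) ≢ 0#
  norm-lead [] = inj₁ refl
  norm-lead (a ∷ f) with norm f | norm-lead f
  ... | b ∷ g | inj₂ l≢0 = inj₂ l≢0
  ... | []    | _ with a ≟ 0#
  ...   | yes _   = inj₁ refl
  ...   | no  a≢0 = inj₂ a≢0

  lead-≢0 : ∀ {f} → ¬ f ≈ zeroP → lead f ≢ 0#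
  lead-≢0 {f} f≉0 with norm-lead f
  ... | inj₁ f≈0 = contradiction f≈0 f≉0
  ... | inj₂ l≢0 = λ l≡0 → l≢0 (trans (coef-norm f _) l≡0)

  coef≢0⇒≉0 : ∀ {f i} → coef f i ≢ 0# → ¬ f ≈ zeroP
  coef≢0⇒≉0 {f} {i} c≢0 f≈0 = c≢0 (≈⇒≋ {f} {[]} f≈0 i)

  below-deg : ∀ f → Below f (suc (deg f))
  below-deg f i d<i = trans (sym (coef-norm f i))
    (below-length (norm f) i (ℕ.≤-trans (ℕ.m≤n+m∸n (length (norm f)) 1) d<i))

  deg-unique : ∀ {f n} → coef f n ≢ 0# → Below f (suc n) → deg f ≡ n
  deg-unique {f} {n} c≢0 b = ℕ.≤-antisym
    (ℕ.≮⇒≥ λ n<d → lead-≢0 {f} (coef≢0⇒≉0 {f} c≢0) (b (deg f) n<d))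
    (ℕ.≮⇒≥ λ d<n → c≢0 (below-deg f n d<n))

  below⇒deg< : ∀ {f n} → ¬ f ≈ zeroP → Below f n → deg f < n
  below⇒deg< {f} f≉0 b = ℕ.≰⇒> λ n≤d → lead-≢0 {f} f≉0 (b (deg f) n≤d)

  below-*-coef : ∀ {f g n m} → Below f (suc n) → Below g (suc m) →
                 coef (f *P g) (n ℕ.+ m) ≡ coef f n * coef g m × Below (f *P g) (suc (n ℕ.+ m))
  below-*-coef {[]} {g} {n} {m} bf bg = sym (zeroˡ (coef g m)) , λ _ _ → refl
  below-*-coef {a ∷ f} {g} {zero} {m} bf bg = top m , top-below
    where
    f*g : f *P g ≋ []
    f*g i = trans (*-cong-≋ {f} {[]} {g} {g} (λ i → bf (suc i) (s≤s z≤n)) (λ _ → refl) i) refl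
    0∷ : 0# ∷ f *P g ≋ []
    0∷ zero    = refl
    0∷ (suc i) = f*g i
    top : ∀ i → coef ((a ∷ f) *P g) i ≡ a * coef g i
    top i = trans (coef-*-∷ a f g i) (trans (cong (a * coef g i +_) (0∷ i)) (+-identityʳ _))
    top-below : Below ((a ∷ f) *P g) (suc m)
    top-below i m<i = trans (top i) (trans (cong (a *_) (bg i m<i)) (zeroʳ a))
  below-*-coef {a ∷ f} {g} {suc n} {m} bf bg with below-*-coef {f} {g} {n} {m} (below-tail {a} {f} bf) bg
  ... | eq , b =
    trans (coef-*-∷ a f g (suc (n ℕ.+ m)))
      (trans (cong₂ _+_ (trans (cong (a *_) (bg _ (s≤s (ℕ.m≤n+m m n)))) (zeroʳ a)) eq) (+-identityˡ _))
    , λ { (suc i) (s≤s n+m<i) → trans (coef-*-∷ a f g (suc i))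
        (trans (cong₂ _+_ (trans (cong (a *_) (bg (suc i) (s≤s (ℕ.≤-trans (ℕ.m≤n+m m n) (ℕ.<⇒≤ n+m<i))))) (zeroʳ a)) (b i n+m<i)) (+-identityˡ _)) }

  module _ {f g} (f≉0 : ¬ f ≈ zeroP) (g≉0 : ¬ g ≈ zeroP) where
    private top = below-*-coef {f} {g} {deg f} {deg g} (below-deg f) (below-deg g)

    coef-*-≢0 : coef (f *P g) (deg f ℕ.+ deg g) ≢ 0#
    coef-*-≢0 eq = *-≢0 (lead-≢0 {f} f≉0) (lead-≢0 {g} g≉0) (trans (sym (proj₁ top)) eq)

    *P-≉0 : ¬ f *P g ≈ zeroP
    *P-≉0 = coef≢0⇒≉0 {f *P g} coef-*-≢0

    deg-*P : deg (f *P g) ≡ deg f ℕ.+ deg g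
    deg-*P = deg-unique {f *P g} coef-*-≢0 (proj₂ top)

    lead-* : lead (f *P g) ≡ lead f * lead g
    lead-* = trans (cong (coef (f *P g)) deg-*P) (proj₁ top)

  last-coef : ∀ (a : Carrier) f → last (a ∷ f) ≡ just (coef (a ∷ f) (length f))
  last-coef a []      = refl
  last-coef a (b ∷ f) = last-coef b f

  monic⇒≉zeroP : ∀ {f} → Monic f → ¬ f ≈ zeroP
  monic⇒≉zeroP {f} mf f≈0 with trans (sym mf) (cong last f≈0)
  ... | ()

  monic⇒lead≡1 : ∀ {f} → Monic f → lead f ≡ 1#
  monic⇒lead≡1 {f} mf = trans (sym (coef-norm f (deg f))) (go (norm f) mf)
    where
    go : ∀ g → last g ≡ just 1# → coef g (length g ∸ 1) ≡ 1#
    go (a ∷ g) eq = just-injective (trans (sym (last-coef a g)) eq)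

  lead≡1⇒monic : ∀ {f} → lead f ≡ 1# → Monic f
  lead≡1⇒monic {f} l≡1 = go (norm f) (trans (coef-norm f (deg f)) l≡1)
    where
    go : ∀ g → coef g (length g ∸ 1) ≡ 1# → last g ≡ just 1#
    go []      eq = contradiction eq 0≢1
    go (a ∷ g) eq = trans (last-coef a g) (cong just eq)

  [_] : Carrier → Poly
  [ a ] = a ∷ []

  [_]-*  : ∀ a f → [ a ] *P f ≋ scal a f
  [ a ]-* f i = trans (coef-*-∷ a [] f i) (trans (cong (a * coef f i +_) (0∷[] i)) (trans (+-identityʳ _) (sym (coef-scal a f i))))
    where
    0∷[] : 0# ∷ [] ≋ []
    0∷[] zero    = refl
    0∷[] (suc i) = refl

  deg0⇒constant : ∀ {f} → deg f ≡ 0 → f ≋ [ coef f 0 ]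
  deg0⇒constant {f} d≡0 zero    = refl
  deg0⇒constant {f} d≡0 (suc i) = below-deg f (suc i) (s≤s (ℕ.≤-trans (ℕ.≤-reflexive d≡0) z≤n))

  [_]*[_] : ∀ a b → [ a ] *P [ b ] ≋ [ a * b ]
  [ a ]*[ b ] zero    = +-identityʳ _
  [ a ]*[ b ] (suc i) = refl

  deg0⇒unit : ∀ {f} → ¬ f ≈ zeroP → deg f ≡ 0 → IsUnit f
  deg0⇒unit {f} f≉0 d≡0 = [ inv (coef f 0) c≢0 ] , ≋⇒≈ {f *P [ inv (coef f 0) c≢0 ]} {oneP} λ i →
    trans (*-cong-≋ {f} {[ coef f 0 ]} {[ inv (coef f 0) c≢0 ]} {[ inv (coef f 0) c≢0 ]} (deg0⇒constant {f} d≡0) (λ _ → refl) i)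
    (trans ([ coef f 0 ]*[ inv (coef f 0) c≢0 ] i) (cong (λ a → coef [ a ] i) (inv-correct _ c≢0)))
    where
    c≢0 : coef f 0 ≢ 0#
    c≢0 = ≡.subst (λ d → coef f d ≢ 0#) d≡0 (lead-≢0 {f} f≉0)

  _≈0? : ∀ f → Dec (f ≈ zeroP)
  f ≈0? with norm f
  ... | []    = yes refl
  ... | _ ∷ _ = no λ ()

  -- Horner scheme: a remainder r of f turns into T r + a, whose leading term
  -- is then cancelled against b.
  divide : ∀ f b → ¬ b ≈ zeroP → ∃₂ λ q r → f ≋ q *P b +P r × Below r (deg b)
  divide []      b b≉0 = [] , [] , (λ _ → refl) , λ _ _ → refl
  divide (a ∷ f) b b≉0 with divide f b b≉0
  ... | q , r , eq , small = c ∷ q , r′ , eq′ , small′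
    where
    n = deg b
    c = coef (a ∷ r) n * inv (lead b) (lead-≢0 {b} b≉0)
    r′ = (a ∷ r) +P negP (scal c b)
    c·lead : c * lead b ≡ coef (a ∷ r) n
    c·lead = trans (·-assoc _ _ _) (trans (cong (coef (a ∷ r) n *_) (trans (·-comm _ _) (inv-correct _ _))) (*-identityʳ _))
    coef-r′ : ∀ i → coef r′ i ≡ coef (a ∷ r) i + - (c * coef b i)
    coef-r′ i = trans (coef-+ (a ∷ r) (negP (scal c b)) i) (cong (coef (a ∷ r) i +_) (trans (coef-neg (scal c b) i) (cong (-_) (coef-scal c b i))))
    small-a∷r : Below (a ∷ r) (suc n)
    small-a∷r (suc i) (s≤s n≤i) = small i n≤i
    small′ : Below r′ n
    small′ i n≤i with n ℕ.≟ i
    ... | yes refl = trans (coef-r′ n) (trans (cong (λ x → coef (a ∷ r) n + - x) c·lead) (-‿inverseʳ _))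
    ... | no  n≢i  = trans (coef-r′ i) (trans (cong₂ _+_ (small-a∷r i n<i)
        (trans (cong (-_) (trans (cong (c *_) (below-deg b i n<i)) (zeroʳ c))) -0#≈0#)) (+-identityˡ 0#))
      where n<i = ℕ.≤∧≢⇒< n≤i n≢i
    shifted : ∀ i → coef (a ∷ f) i ≡ coef (0# ∷ q *P b) i + coef (a ∷ r) i
    shifted zero    = sym (+-identityˡ a)
    shifted (suc i) = trans (eq i) (coef-+ (q *P b) r i)
    eq′ : a ∷ f ≋ (c ∷ q) *P b +P r′
    eq′ i = begin
      coef (a ∷ f) i                                      ≡⟨ shifted i ⟩
      x + y                                               ≡⟨ +-identityˡ _ ⟨
      0# + (x + y)                                        ≡⟨ cong (_+ (x + y)) (-‿inverseʳ z) ⟨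
      (z + - z) + (x + y)                                 ≡⟨ solve 4 (λ z m x y → (z :+ m) :+ (x :+ y) := (z :+ x) :+ (y :+ m)) refl z (- z) x y ⟩
      (z + x) + (y + - z)                                 ≡⟨ cong₂ _+_ (coef-*-∷ c q b i) (coef-r′ i) ⟨
      coef ((c ∷ q) *P b) i + coef r′ i                   ≡⟨ coef-+ ((c ∷ q) *P b) r′ i ⟨
      coef ((c ∷ q) *P b +P r′) i                         ∎
      where
      x = coef (0# ∷ q *P b) i
      y = coef (a ∷ r) i
      z = c * coef b i

  -- Pads as well as cuts: every polynomial of degree below n is thus represented by a list of
  -- length exactly n, and those can be enumerated.
  truncate : ℕ → Poly → Poly
  truncate zero    f       = []
  truncate (suc n) []      = 0# ∷ truncate n []
  truncate (suc n) (a ∷ f) = a ∷ truncate n f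

  length-truncate : ∀ n f → length (truncate n f) ≡ n
  length-truncate zero    f       = refl
  length-truncate (suc n) []      = cong suc (length-truncate n [])
  length-truncate (suc n) (a ∷ f) = cong suc (length-truncate n f)

  truncate-≋ : ∀ {n} f → Below f n → truncate n f ≋ f
  truncate-≋ {zero}  f       b i       = sym (b i z≤n)
  truncate-≋ {suc n} []      b zero    = refl
  truncate-≋ {suc n} []      b (suc i) = truncate-≋ {n} [] (λ _ _ → refl) i
  truncate-≋ {suc n} (a ∷ f) b zero    = refl
  truncate-≋ {suc n} (a ∷ f) b (suc i) = truncate-≋ {n} f (below-tail {a} {f} b) i

  search-length : ∀ n {P : Poly → Set} → (∀ f → Dec (P f)) → Dec (∃ λ f → length f ≡ n × P f)
  search-length zero    P? = map′ (λ p → [] , refl , p) (λ { ([] , _ , p) → p }) (P? [])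
  search-length (suc n) P? = map′
    (λ { (a , f , len , p) → a ∷ f , cong suc len , p })
    (λ { (a ∷ f , len , p) → a , f , ℕ.suc-injective len , p })
    (any? λ a → search-length n λ f → P? (a ∷ f))

  search : ∀ n {P : Poly → Set} → (∀ {f g} → f ≈ g → P f → P g) → (∀ f → Dec (P f)) →
           Dec (∃ λ f → deg f < n × P f)
  search zero    resp P? = no λ { (_ , () , _) }
  search (suc n) resp P? = map′
    (λ (f , len , p) → f , s≤s (small f len) , p)
    (λ (f , d<n , p) → truncate (suc n) f , length-truncate (suc n) f ,
      resp (≋⇒≈ {f} {truncate (suc n) f} (λ i → sym (truncate-≋ {suc n} f (below-≤ {f} d<n (below-deg f)) i))) p)
    (search-length (suc n) P?)
    where
    small : ∀ f → length f ≡ suc n → deg f ≤ n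
    small f len with f ≈0?
    ... | yes f≈0 = ≡.subst (λ g → length g ∸ 1 ≤ n) (sym f≈0) z≤n
    ... | no  f≉0 = ℕ.s≤s⁻¹ (below⇒deg< {f} f≉0 (≡.subst (Below f) len (below-length f)))

  poly-domain : EuclideanDomain
  poly-domain = record
    { commutativeRing = poly-ring
    ; 1≉0       = monic⇒≉zeroP {oneP} monic-one
    ; _≟0       = _≈0?
    ; *-≉0      = λ {f} {g} → *P-≉0 {f} {g}
    ; deg       = deg
    ; deg-cong  = cong (λ h → length h ∸ 1)
    ; deg-0     = refl
    ; deg-*     = λ {f} {g} → deg-*P {f} {g}
    ; divMod    = λ f b b≉0 → euclid f b (divide f b b≉0)
    ; deg0⇒unit = λ {f} → deg0⇒unit {f}
    ; search    = search
    ; Monic     = Monic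
    ; monic-1   = monic-one
    ; monic-cong = λ {f} {g} f≈g mf → trans (cong last (sym f≈g)) mf
    ; monic⇒≉0  = λ {f} → monic⇒≉zeroP {f}
    ; monic-*   = λ {f} {g} mf mg → lead≡1⇒monic {f *P g} (trans (lead-* {f} {g} (monic⇒≉zeroP {f} mf) (monic⇒≉zeroP {g} mg))
                    (trans (cong₂ _*_ (monic⇒lead≡1 {f} mf) (monic⇒lead≡1 {g} mg)) (*-identityˡ 1#)))
    ; monic-cancel = λ {f} {g} → monic-cancel {f} {g}
    ; monic-deg0 = λ {f} mf d≡0 → ≋⇒≈ {f} {oneP} λ i → trans (deg0⇒constant {f} d≡0 i)
                     (cong (λ a → coef [ a ] i) (trans (cong (coef f) (sym d≡0)) (monic⇒lead≡1 {f} mf)))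
    ; normalize = λ {f} → normalize {f}
    }
    where
    monic-one : Monic oneP
    monic-one = lead≡1⇒monic {oneP} (trans (cong (coef oneP) (deg-unique {oneP} {0} (λ eq → 0≢1 (sym eq)) λ { (suc i) _ → refl })) refl)
    euclid : ∀ f b → (∃₂ λ q r → f ≋ q *P b +P r × Below r (deg b)) →
             ∃₂ λ q r → f ≈ q *P b +P r × (r ≈ zeroP ⊎ deg r < deg b)
    euclid f b (q , r , eq , small) with r ≈0?
    ... | yes r≈0 = q , r , ≋⇒≈ {f} {q *P b +P r} eq , inj₁ r≈0
    ... | no  r≉0 = q , r , ≋⇒≈ {f} {q *P b +P r} eq , inj₂ (below⇒deg< {r} r≉0 small)
    monic-cancel : ∀ {f g} → Monic (f *P g) → Monic f → Monic g
    monic-cancel {f} {g} mfg mf with g ≈0?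
    ... | yes g≈0 = contradiction (≋⇒≈ {f *P g} {[]} λ i → trans (*-congʳ-≋ f (≈⇒≋ {g} {[]} g≈0) i) (*-[] f i)) (monic⇒≉zeroP {f *P g} mfg)
    ... | no  g≉0 = lead≡1⇒monic {g} (begin
      lead g             ≡⟨ *-identityˡ _ ⟨
      1# * lead g        ≡⟨ cong (_* lead g) (monic⇒lead≡1 {f} mf) ⟨
      lead f * lead g    ≡⟨ lead-* {f} {g} (monic⇒≉zeroP {f} mf) g≉0 ⟨
      lead (f *P g)      ≡⟨ monic⇒lead≡1 {f *P g} mfg ⟩
      1#                 ∎)
    normalize : ∀ {f} → ¬ f ≈ zeroP → ∃ λ v → IsUnit v × Monic (f *P v)
    normalize {f} f≉0 = [ c ] , ([ lead f ] , ≋⇒≈ {[ c ] *P [ lead f ]} {oneP} λ i → trans ([ c ]*[ lead f ] i) (cong (λ a → coef [ a ] i) (trans (·-comm _ _) (inv-correct _ _)))) ,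
      lead≡1⇒monic {f *P [ c ]} (trans (lead-* {f} {[ c ]} f≉0 [c]≉0) (trans (cong (lead f *_) (cong (coef [ c ]) deg[c])) (inv-correct _ _)))
      where
      c = inv (lead f) (lead-≢0 {f} f≉0)
      c≢0 = inv-≢0 (lead-≢0 {f} f≉0)
      [c]≉0 : ¬ [ c ] ≈ zeroP
      [c]≉0 = coef≢0⇒≉0 {[ c ]} {0} c≢0
      deg[c] : deg [ c ] ≡ 0
      deg[c] = deg-unique {[ c ]} {0} c≢0 λ { (suc i) _ → refl }

-- The Frobenius endomorphism

nC0≡1 : ∀ n → n C 0 ≡ 1
nC0≡1 n = ≡.trans (nCk≡nC[n∸k] {0} {n} z≤n) (nCn≡1 n)

-- The absorption identity, by Pascal's rule. With n + 1 prime it forces that prime to divide the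
-- inner binomial coefficients.
[k+1]*[n+1]C[k+1] : ∀ n k → suc k ℕ.* (suc n C suc k) ≡ suc n ℕ.* (n C k)
[k+1]*[n+1]C[k+1] n zero = ≡.trans (ℕ.*-identityˡ _) (≡.trans (nC1≡n (suc n))
  (≡.trans (≡.sym (ℕ.*-identityʳ (suc n))) (≡.cong (suc n ℕ.*_) (≡.sym (nC0≡1 n)))))
[k+1]*[n+1]C[k+1] zero (suc k) = ≡.trans (≡.cong (suc (suc k) ℕ.*_) (k>n⇒nCk≡0 {1} {suc (suc k)} (s≤s (s≤s z≤n))))
  (≡.trans (ℕ.*-zeroʳ (suc (suc k))) (≡.sym (≡.trans (ℕ.*-identityˡ _) (k>n⇒nCk≡0 {0} {suc k} (s≤s z≤n)))))
[k+1]*[n+1]C[k+1] (suc n) (suc k) = begin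
  suc (suc k) ℕ.* (suc (suc n) C suc (suc k))  ≡⟨ ≡.cong (suc (suc k) ℕ.*_) (nCk+nC[k+1]≡[n+1]C[k+1] (suc n) (suc k)) ⟨
  suc (suc k) ℕ.* (a ℕ.+ b)                    ≡⟨ solve 3 (λ k a b → (con 1 :+ k) :* (a :+ b) := a :+ (k :* a :+ (con 1 :+ k) :* b)) ≡.refl (suc k) a b ⟩
  a ℕ.+ (suc k ℕ.* a ℕ.+ suc (suc k) ℕ.* b)    ≡⟨ ≡.cong (a ℕ.+_) (≡.cong₂ ℕ._+_ ([k+1]*[n+1]C[k+1] n k) ([k+1]*[n+1]C[k+1] n (suc k))) ⟩
  a ℕ.+ (suc n ℕ.* (n C k) ℕ.+ suc n ℕ.* (n C suc k)) ≡⟨ ≡.cong (a ℕ.+_) (ℕ.*-distribˡ-+ (suc n) (n C k) (n C suc k)) ⟨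
  a ℕ.+ suc n ℕ.* (n C k ℕ.+ n C suc k)        ≡⟨ ≡.cong (λ x → a ℕ.+ suc n ℕ.* x) (nCk+nC[k+1]≡[n+1]C[k+1] n k) ⟩
  suc (suc n) ℕ.* a                            ∎
  where
  open ≡.≡-Reasoning
  open Data.Nat.Solver.+-*-Solver using (solve; _:=_; _:+_; _:*_; con)
  a = suc n C suc k
  b = suc n C suc (suc k)

prime∣pCk : ∀ {p k} → Prime p → 0 < k → k < p → p ℕ.∣ p C k
prime∣pCk {suc n} {suc k} pp _ k<p with euclidsLemma (suc k) (suc n C suc k) pp
                                          (ℕ.divides (n C k) (≡.trans ([k+1]*[n+1]C[k+1] n k) (ℕ.*-comm (suc n) (n C k))))
... | inj₁ p∣k = contradiction p∣k (ℕ.>⇒∤ k<p)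
... | inj₂ p∣C = p∣C

module Frobenius (R : CommutativeSemiring 0ℓ 0ℓ) where
  open CommutativeSemiring R
  open import Relation.Binary.Reasoning.Setoid setoid
  open Algebra.Properties.CommutativeSemiring.Binomial R using (binomialTerm) renaming (theorem to binomial-theorem)
  open Algebra.Properties.CommutativeMonoid.Sum +-commutativeMonoid using (sum-init-last; sum-cong-≋; sum-replicate-zero) renaming (sum to ∑)
  open Algebra.Properties.Semiring.Mult semiring using (×-congʳ; ×-assocˡ; ×-homo-1) renaming (_×_ to _×ₙ_)
  open Algebra.Properties.Semiring.Exp semiring using (_^_; ^-assocʳ; ^-congˡ)

  module _ {p} (pp : Prime p) (p×≈0 : ∀ x → p ×ₙ x ≈ 0#) where
    ∣⇒×≈0 : ∀ {m} → p ℕ.∣ m → ∀ x → m ×ₙ x ≈ 0#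
    ∣⇒×≈0 (ℕ.divides k ≡.refl) x = trans (sym (×-assocˡ x k p)) (trans (×-congʳ k (p×≈0 x)) (k×0 k))
      where
      k×0 : ∀ k → k ×ₙ 0# ≈ 0#
      k×0 zero    = refl
      k×0 (suc k) = trans (+-identityˡ _) (k×0 k)

    ^p-+ : ∀ x y → (x + y) ^ p ≈ x ^ p + y ^ p
    ^p-+ x y = trans (binomial-theorem p x y) (go p ≡.refl)
      where
      go : ∀ n → n ≡ p → ∑ (binomialTerm x y n) ≈ x ^ n + y ^ n
      go zero    ≡.refl = contradiction (prime⇒nonZero pp) λ { () }
      go (suc n) ≡.refl = begin
        t Fin.zero + ∑ (λ i → t (Fin.suc i))
          ≈⟨ +-cong first (sum-init-last (λ i → t (Fin.suc i))) ⟩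
        y ^ suc n + (∑ (λ i → t (Fin.suc (Fin.inject₁ i))) + t (Fin.suc (Fin.fromℕ n)))
          ≈⟨ +-congˡ (+-cong (trans (sum-cong-≋ middle) (sum-replicate-zero n)) final) ⟩
        y ^ suc n + (0# + x ^ suc n)   ≈⟨ +-congˡ (+-identityˡ _) ⟩
        y ^ suc n + x ^ suc n          ≈⟨ +-comm _ _ ⟩
        x ^ suc n + y ^ suc n          ∎
        where
        t = binomialTerm x y (suc n)
        1×_ : ∀ {m} → m ≡ 1 → ∀ z → m ×ₙ z ≈ z
        1×_ ≡.refl z = ×-homo-1 z
        first : t Fin.zero ≈ y ^ suc n
        first = trans (1×_ (nC0≡1 (suc n)) _) (*-identityˡ _)
        final : t (Fin.suc (Fin.fromℕ n)) ≈ x ^ suc n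
        final = trans (reflexive (≡.cong (λ i → (suc n C suc i) ×ₙ (x ^ suc i * y ^ (n ∸ i))) (Fin.toℕ-fromℕ n)))
          (trans (1×_ (nCn≡1 (suc n)) _) (trans (*-congˡ (reflexive (≡.cong (y ^_) (ℕ.n∸n≡0 n)))) (*-identityʳ _)))
        middle : ∀ i → t (Fin.suc (Fin.inject₁ i)) ≈ 0#
        middle i = ∣⇒×≈0 (prime∣pCk pp (s≤s z≤n) (s≤s (≡.subst (_< n) (≡.sym (Fin.toℕ-inject₁ i)) (Fin.toℕ<n i)))) _

    ^pᵉ-+ : ∀ e x y → (x + y) ^ (p ℕ.^ e) ≈ x ^ (p ℕ.^ e) + y ^ (p ℕ.^ e)
    ^pᵉ-+ zero    x y = distribʳ 1# x y
    ^pᵉ-+ (suc e) x y = begin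
      (x + y) ^ (p ℕ.* p ℕ.^ e)                            ≈⟨ ^-assocʳ (x + y) p (p ℕ.^ e) ⟨
      ((x + y) ^ p) ^ (p ℕ.^ e)                            ≈⟨ ^-congˡ (p ℕ.^ e) (^p-+ x y) ⟩
      (x ^ p + y ^ p) ^ (p ℕ.^ e)                          ≈⟨ ^pᵉ-+ e (x ^ p) (y ^ p) ⟩
      (x ^ p) ^ (p ℕ.^ e) + (y ^ p) ^ (p ℕ.^ e)            ≈⟨ +-cong (^-assocʳ x p (p ℕ.^ e)) (^-assocʳ y p (p ℕ.^ e)) ⟩
      x ^ (p ℕ.* p ℕ.^ e) + y ^ (p ℕ.* p ℕ.^ e)            ∎

-- The Carlitz action on an algebra over a finite field

record PointedAlgebra {q} (F : FiniteField q) : Set₁ where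
  private module K = FiniteField F
  field
    commutativeRing : CommutativeRing 0ℓ 0ℓ
  open CommutativeRing commutativeRing public
  field
    const   : K.Carrier → Carrier
    const-0 : const K.0# ≈ 0#
    const-1 : const K.1# ≈ 1#
    const-+ : ∀ a b → const (a K.+ b) ≈ const a + const b
    const-* : ∀ a b → const (a K.* b) ≈ const a * const b
    T       : Carrier

module CarlitzAction {q} (F : FiniteField q) {p e} (pp : Prime p) (q≡p^e : q ≡ p ℕ.^ e) (3≤q : 3 ≤ q)
  (R : PointedAlgebra F) where
  open FieldProperties F using (field-ring; p×1≡0)
  private
    module K = CommutativeRing field-ring
    module KM = Algebra.Properties.Semiring.Mult K.semiring
    module KE = Algebra.Properties.Semiring.Exp K.semiring
  open PolyDefs F using (Poly; scal; _+P_; _*P_)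
  open PolyRing F using (_≋_)
  open PointedAlgebra R
  open Algebra.Properties.Semiring.Mult semiring using (×-congʳ; ×-assoc-*) renaming (_×_ to _×ₙ_)
  open Algebra.Properties.Semiring.Exp semiring using (_^_; ^-congˡ)
  open Algebra.Properties.CommutativeSemiring.Exp commutativeSemiring using (^-distrib-*)
  open Algebra.Solver.Ring.NaturalCoefficients.Default commutativeSemiring
    using (solve; _:=_; _:+_; _:*_; con)
  open import Relation.Binary.Reasoning.Setoid setoid

  const-×1 : ∀ n → const (n KM.× K.1#) ≈ n ×ₙ 1#
  const-×1 zero    = const-0
  const-×1 (suc n) = trans (const-+ _ _) (+-cong const-1 (const-×1 n))

  const-^ : ∀ a n → const (a KE.^ n) ≈ const a ^ n
  const-^ a zero    = const-1
  const-^ a (suc n) = trans (const-* a _) (*-congˡ (const-^ a n))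

  p×≈0 : ∀ x → p ×ₙ x ≈ 0#
  p×≈0 x = begin
    p ×ₙ x                      ≈⟨ ×-congʳ p (*-identityˡ x) ⟨
    p ×ₙ (1# * x)               ≈⟨ ×-assoc-* p 1# x ⟨
    (p ×ₙ 1#) * x               ≈⟨ *-congʳ (const-×1 p) ⟨
    const (p KM.× K.1#) * x     ≈⟨ *-congʳ (reflexive (≡.cong const (p×1≡0 p e q≡p^e))) ⟩
    const K.0# * x              ≈⟨ *-congʳ const-0 ⟩
    0# * x                      ≈⟨ zeroˡ x ⟩
    0#                          ∎

  ^q-+ : ∀ x y → (x + y) ^ q ≈ x ^ q + y ^ q
  ^q-+ x y = ≡.subst (λ n → (x + y) ^ n ≈ x ^ n + y ^ n) (≡.sym q≡p^e)
               (Frobenius.^pᵉ-+ commutativeSemiring pp p×≈0 e x y)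

  const-^q : ∀ a → const a ^ q ≈ const a
  const-^q a = trans (sym (const-^ a q)) (reflexive (≡.cong const (fermat F a)))

  0^q : 0# ^ q ≈ 0#
  0^q = go q 3≤q
    where
    go : ∀ n → 3 ≤ n → 0# ^ n ≈ 0#
    go (suc n) _ = zeroˡ _

  -- The structure map from 𝔽q[T] to the algebra; its value at f is the coefficient of x in C_f(x),
  -- which is how it occurs in `c-lift`.
  horner : Poly → Carrier
  horner []      = 0#
  horner (a ∷ f) = const a + T * horner f

  c : Poly → Carrier → Carrier
  c []      x = 0#
  c (a ∷ f) x = const a * x + (T * c f x + c f x ^ q)

  private
    -- C_T, the operator iterated by the Horner scheme in `c`.
    step : Carrier → Carrier
    step y = T * y + y ^ q

    step-cong : ∀ {y z} → y ≈ z → step y ≈ step z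
    step-cong y≈z = +-cong (*-congˡ y≈z) (^-congˡ q y≈z)

    step-+ : ∀ y z → step (y + z) ≈ step y + step z
    step-+ y z = trans (+-congˡ (^q-+ y z))
      (solve 5 (λ T y z u v → T :* (y :+ z) :+ (u :+ v) := (T :* y :+ u) :+ (T :* z :+ v)) refl T y z _ _)

    step-0 : step 0# ≈ 0#
    step-0 = trans (+-cong (zeroʳ T) 0^q) (+-identityˡ 0#)

    step-const : ∀ a y → step (const a * y) ≈ const a * step y
    step-const a y = trans (+-congˡ (trans (^-distrib-* (const a) y q) (*-congʳ (const-^q a))))
      (solve 4 (λ T a y u → T :* (a :* y) :+ a :* u := a :* (T :* y :+ u)) refl T (const a) y _)

  module _ (x : Carrier) where
    c-0 : ∀ {f} → f ≋ [] → c f x ≈ 0#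
    c-0 {[]}    _   = refl
    c-0 {a ∷ f} f≋0 = trans (+-cong
      (trans (*-congʳ (trans (reflexive (≡.cong const (f≋0 0))) const-0)) (zeroˡ x))
      (trans (step-cong (c-0 {f} (λ i → f≋0 (suc i)))) step-0)) (+-identityˡ 0#)

    c-cong : ∀ {f g} → f ≋ g → c f x ≈ c g x
    c-cong {[]}    {g}     f≋g = sym (c-0 {g} (λ i → ≡.sym (f≋g i)))
    c-cong {a ∷ f} {[]}    f≋g = c-0 {a ∷ f} f≋g
    c-cong {a ∷ f} {b ∷ g} f≋g = +-cong (*-congʳ (reflexive (≡.cong const (f≋g 0))))
      (step-cong (c-cong {f} {g} (λ i → f≋g (suc i))))

    c-+ : ∀ f g → c (f +P g) x ≈ c f x + c g x
    c-+ []      g       = sym (+-identityˡ _)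
    c-+ (a ∷ f) []      = sym (+-identityʳ _)
    c-+ (a ∷ f) (b ∷ g) = trans (+-cong (*-congʳ (const-+ a b)) (trans (step-cong (c-+ f g)) (step-+ (c f x) (c g x))))
      (solve 5 (λ a b x u v → (a :+ b) :* x :+ (u :+ v) := (a :* x :+ u) :+ (b :* x :+ v)) refl (const a) (const b) x _ _)

    c-scal : ∀ a f → c (scal a f) x ≈ const a * c f x
    c-scal a []      = sym (zeroʳ _)
    c-scal a (b ∷ f) = trans (+-cong (*-congʳ (const-* a b)) (trans (step-cong (c-scal a f)) (step-const a (c f x))))
      (solve 4 (λ a b x u → a :* b :* x :+ a :* u := a :* (b :* x :+ u)) refl (const a) (const b) x _)

    c-* : ∀ f g → c (f *P g) x ≈ c f (c g x)
    c-* []      g = refl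
    c-* (a ∷ f) g = trans (c-+ (scal a g) (K.0# ∷ f *P g)) (+-cong (c-scal a g)
      (trans (+-cong (trans (*-congʳ const-0) (zeroˡ x)) (step-cong (c-* f g))) (+-identityˡ _)))

    -- Each Horner step multiplies the linear coefficient by T, and its Frobenius term is a q-th
    -- power of a multiple of x, hence a multiple of x³ because q ≥ 3.
    c-lift : ∀ f → ∃ λ z → c f x ≈ x * (horner f + x * x * z)
    c-lift [] = 0# , sym (trans (*-congˡ (trans (+-identityˡ _) (zeroʳ _))) (zeroʳ x))
    c-lift (a ∷ f) with c-lift f
    ... | z , eq = T * z + proj₁ (power 3≤q) , (begin
      const a * x + step (c f x)                            ≈⟨ +-congˡ (step-cong eq) ⟩
      const a * x + (T * (x * w) + (x * w) ^ q)             ≈⟨ +-congˡ (+-congˡ (proj₂ (power 3≤q))) ⟩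
      const a * x + (T * (x * w) + x * x * x * proj₁ (power 3≤q))
        ≈⟨ solve 6 (λ a T h x z v → a :* x :+ (T :* (x :* (h :+ x :* x :* z)) :+ x :* x :* x :* v)
                      := x :* (a :+ T :* h :+ x :* x :* (T :* z :+ v))) refl (const a) T (horner f) x z _ ⟩
      x * (const a + T * horner f + x * x * (T * z + proj₁ (power 3≤q))) ∎)
      where
      w = horner f + x * x * z
      power : ∀ {n} → 3 ≤ n → ∃ λ v → (x * w) ^ n ≈ x * x * x * v
      power {suc (suc (suc n))} _ = w * w * w * (x * w) ^ n ,
        solve 3 (λ x w u → (x :* w) :* ((x :* w) :* ((x :* w) :* u)) := x :* x :* x :* (w :* w :* w :* u)) refl x w _
      power {suc zero}       (s≤s ())
      power {suc (suc zero)} (s≤s (s≤s ()))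

  c-congʳ : ∀ f {x y} → x ≈ y → c f x ≈ c f y
  c-congʳ []      x≈y = refl
  c-congʳ (a ∷ f) x≈y = +-cong (*-congˡ x≈y) (step-cong (c-congʳ f x≈y))

  c-linear : ∀ a x → c (a ∷ K.1# ∷ []) x ≈ horner (a ∷ K.1# ∷ []) * x + x ^ q
  c-linear a x = begin
    const a * x + step (const K.1# * x + step 0#)     ≈⟨ +-congˡ (step-cong (+-cong (*-congʳ const-1) step-0)) ⟩
    const a * x + step (1# * x + 0#)                  ≈⟨ +-congˡ (step-cong (trans (+-identityʳ _) (*-identityˡ x))) ⟩
    const a * x + (T * x + x ^ q)                     ≈⟨ solve 4 (λ a x T u → a :* x :+ (T :* x :+ u)
                                                           := (a :+ T :* (con 1 :+ T :* con 0)) :* x :+ u) refl (const a) x T _ ⟩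
    (const a + T * (1# + T * 0#)) * x + x ^ q         ≈⟨ +-congʳ (*-congʳ (+-congˡ (*-congˡ (+-congʳ (sym const-1))))) ⟩
    horner (a ∷ K.1# ∷ []) * x + x ^ q                ∎

-- Carlitz polynomials over 𝔽q[T]

module CarlitzPoly {q} (F : FiniteField q) {p e} (pp : Prime p) (q≡p^e : q ≡ p ℕ.^ e) (3≤q : 3 ≤ q) where
  open FiniteField F using (0#; 1#; 0≢1; _+_; _*_)
  open PolyDefs F
  open PolyRing F
  open FieldProperties F
  private
    module K = CommutativeRing field-ring
    module R = CommutativeRing poly-ring
    module E = EuclideanDomain poly-domain
    module ^ = Algebra.Properties.Semiring.Exp R.semiring

  poly-algebra : PointedAlgebra F
  poly-algebra = record
    { commutativeRing = poly-ring
    ; const   = [_]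
    ; const-0 = norm-0∷ {0#} {[]} ≡.refl ≡.refl
    ; const-1 = ≡.refl
    ; const-+ = λ _ _ → ≡.refl
    ; const-* = λ a b → ≋⇒≈ {[ a * b ]} {[ a ] *P [ b ]} λ i → ≡.sym ([ a ]*[ b ] i)
    ; T       = Tp
    }

  module Act = CarlitzAction F {p} {e} pp q≡p^e 3≤q poly-algebra

  ^P≡^ : ∀ f n → f ^P n ≡ f ^.^ n
  ^P≡^ f zero    = ≡.refl
  ^P≡^ f (suc n) = ≡.cong (f *P_) (^P≡^ f n)

  Tp-* : ∀ f → Tp *P f ≋ 0# ∷ f
  Tp-* f i = ≡.trans (coef-0∷-* oneP f i) (∷-cong ≡.refl (*-identityˡ-≋ f) i)

  horner≈ : ∀ f → Act.horner f ≈ f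
  horner≈ []      = ≡.refl
  horner≈ (a ∷ f) = ≡.trans
    (R.+-congˡ {[ a ]} {Tp *P Act.horner f} {Tp *P f} (R.*-congˡ {Tp} {Act.horner f} {f} (horner≈ f)))
    (≋⇒≈ {[ a ] +P Tp *P f} {a ∷ f} λ i → ≡.trans (coef-+ [ a ] (Tp *P f) i) (≡.trans (≡.cong (coef [ a ] i +_) (Tp-* f i)) (go i)))
    where
    go : ∀ i → coef [ a ] i + coef (0# ∷ f) i ≡ coef (a ∷ f) i
    go zero    = K.+-identityʳ a
    go (suc i) = K.+-identityˡ _

  carlitz≈ : ∀ f x → carlitz f x ≈ Act.c f x
  carlitz≈ []      x = ≡.refl
  carlitz≈ (a ∷ f) x =
    R.+-cong {scal a x} {[ a ] *P x} {Tp *P y +P y ^P q} {Tp *P z +P z ^.^ q}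
      (≋⇒≈ {scal a x} {[ a ] *P x} λ i → ≡.sym ([ a ]-* x i))
      (R.+-cong {Tp *P y} {Tp *P z} {y ^P q} {z ^.^ q} (R.*-congˡ {Tp} {y} {z} (carlitz≈ f x))
        (≡.subst (_≈ z ^.^ q) (≡.sym (^P≡^ y q)) (^.^-congˡ q {y} {z} (carlitz≈ f x))))
    where
    y = carlitz f x
    z = Act.c f x

  carlitz-cong : ∀ u {f g} → f ≈ g → carlitz f u ≈ carlitz g u
  carlitz-cong u {f} {g} f≈g = ≡.trans (carlitz≈ f u)
    (≡.trans (Act.c-cong u {f} {g} (≈⇒≋ {f} {g} f≈g))
      (≡.sym (carlitz≈ g u)))

  carlitz-congʳ : ∀ f {u v} → u ≈ v → carlitz f u ≈ carlitz f v
  carlitz-congʳ f {u} {v} u≈v = ≡.trans (carlitz≈ f u)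
    (≡.trans (Act.c-congʳ f {u} {v} u≈v)
      (≡.sym (carlitz≈ f v)))

  carlitz-+ : ∀ u f g → carlitz (f +P g) u ≈ carlitz f u +P carlitz g u
  carlitz-+ u f g = ≡.trans (carlitz≈ (f +P g) u)
    (≡.trans (Act.c-+ u f g)
      (≡.sym
        (R.+-cong {carlitz f u} {Act.c f u} {carlitz g u} {Act.c g u} (carlitz≈ f u) (carlitz≈ g u))))

  carlitz-* : ∀ u f g → carlitz (f *P g) u ≈ carlitz f (carlitz g u)
  carlitz-* u f g = ≡.trans (carlitz≈ (f *P g) u)
    (≡.trans (Act.c-* u f g)
      (≡.sym
        (≡.trans
          (carlitz-congʳ f {carlitz g u} {Act.c g u} (carlitz≈ g u)) (carlitz≈ f (Act.c g u)))))

  carlitz-lift : ∀ f x → ∃ λ z → carlitz f x ≈ x *P (f +P x *P x *P z)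
  carlitz-lift f x with Act.c-lift x f
  ... | z , eq = z , ≡.trans (carlitz≈ f x)
    (≡.trans eq
      (R.*-congˡ {x} {Act.horner f +P x *P x *P z} {f +P x *P x *P z}
        (R.+-congʳ {x *P x *P z} {Act.horner f} {f} (horner≈ f))))

  linear : K.Carrier → Poly
  linear a = a ∷ 1# ∷ []

  carlitz-linear : ∀ a x → carlitz (linear a) x ≈ linear a *P x +P x ^P q
  carlitz-linear a x = ≡.trans (carlitz≈ (linear a) x)
    (≡.trans (Act.c-linear a x)
      (R.+-cong {Act.horner (linear a) *P x} {linear a *P x} {x ^.^ q} {x ^P q}
        (R.*-congʳ {x} {Act.horner (linear a)} {linear a} (horner≈ (linear a)))
        (≡.cong norm (≡.sym (^P≡^ x q)))))

  -- An exact degree together with nonvanishing, in terms of coefficients of the unnormalized list;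
  -- it passes through sums, products and powers without computing `deg`.
  HasDegree : Poly → ℕ → Set
  HasDegree f n = coef f n ≢ 0# × Below f (suc n)

  hasDegree : ∀ {f} → ¬ f ≈ zeroP → HasDegree f (deg f)
  hasDegree {f} f≉0 = lead-≢0 {f} f≉0 , below-deg f

  hasDegree-* : ∀ f g {n m} → HasDegree f n → HasDegree g m → HasDegree (f *P g) (n ℕ.+ m)
  hasDegree-* f g (f≢ , bf) (g≢ , bg) with below-*-coef {f} {g} bf bg
  ... | eq , b = (λ eq′ → *-≢0 f≢ g≢ (≡.trans (≡.sym eq) eq′)) , b

  hasDegree-+ : ∀ f g {n} → Below f n → HasDegree g n → HasDegree (f +P g) n
  hasDegree-+ f g {n} bf (g≢ , bg) =
    (λ eq → g≢ (≡.trans (≡.sym (≡.trans (coef-+ f g n) (≡.trans (≡.cong (_+ coef g n) (bf n ℕ.≤-refl)) (K.+-identityˡ _)))) eq))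
    , below-+ {f} {g} (below-≤ {f} (ℕ.n≤1+n n) bf) bg

  hasDegree-one : HasDegree oneP 0
  hasDegree-one = (λ 1≡0 → 0≢1 (≡.sym 1≡0)) , λ { (suc i) _ → ≡.refl }

  hasDegree-linear : ∀ a → HasDegree (linear a) 1
  hasDegree-linear a = (λ 1≡0 → 0≢1 (≡.sym 1≡0)) , λ { (suc (suc i)) _ → ≡.refl ; (suc zero) (s≤s ()) }

  hasDegree-^ : ∀ f {d} n → HasDegree f d → HasDegree (f ^P n) (n ℕ.* d)
  hasDegree-^ f zero    _ = hasDegree-one
  hasDegree-^ f (suc n) h = hasDegree-* f (f ^P n) h (hasDegree-^ f n h)

  -- The degree of C_T(y) for y of degree d. For d > 0 the term y^q dominates, but for constant y it
  -- is T y that does, giving 1 instead of q · 0. This exception is what disturbs the closed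
  -- formulas for u = 1.
  next : ℕ → ℕ
  next zero    = 1
  next (suc d) = q ℕ.* suc d

  carlitzDegree : ℕ → ℕ → ℕ
  carlitzDegree d zero    = d
  carlitzDegree d (suc j) = next (carlitzDegree d j)

  d<next : ∀ d → d < next d
  d<next zero    = s≤s z≤n
  d<next (suc d) = ℕ.<-≤-trans (ℕ.m<m+n (suc d) {suc d} (s≤s z≤n))
    (ℕ.≤-trans (ℕ.≤-reflexive (≡.cong (suc d ℕ.+_) (≡.sym (ℕ.+-identityʳ (suc d)))))
      (ℕ.*-monoˡ-≤ (suc d) (ℕ.≤-trans (ℕ.n≤1+n 2) 3≤q)))

  ≤carlitzDegree : ∀ d j → d ≤ carlitzDegree d j
  ≤carlitzDegree d zero    = ℕ.≤-refl
  ≤carlitzDegree d (suc j) = ℕ.≤-trans (≤carlitzDegree d j) (ℕ.<⇒≤ (d<next _))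

  hasDegree-step : ∀ y d → HasDegree y d → HasDegree (Tp *P y +P y ^P q) (next d)
  -- For constant y the roles are exchanged: y^q is again constant and T y carries the leading term.
  hasDegree-step y zero h = go
    (hasDegree-+ (y ^P q) (Tp *P y) (≡.subst (λ n → Below (y ^P q) (suc n)) (ℕ.*-zeroʳ q) (proj₂ (hasDegree-^ y q h)))
      (hasDegree-* Tp y (hasDegree-linear 0#) h))
    where
    go : HasDegree (y ^P q +P Tp *P y) 1 → HasDegree (Tp *P y +P y ^P q) 1
    go (≢0 , b) = (λ eq → ≢0 (≡.trans (comm 1) eq)) , λ i 1<i → ≡.trans (≡.sym (comm i)) (b i 1<i)
      where
      comm : y ^P q +P Tp *P y ≋ Tp *P y +P y ^P q
      comm i = ≡.trans (coef-+ (y ^P q) (Tp *P y) i) (≡.trans (K.+-comm _ _) (≡.sym (coef-+ (Tp *P y) (y ^P q) i)))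
  hasDegree-step y (suc d) h = hasDegree-+ (Tp *P y) (y ^P q)
    (below-≤ {Tp *P y} bound (proj₂ (hasDegree-* Tp y (hasDegree-linear 0#) h)))
    (hasDegree-^ y q h)
    where
    bound : suc (1 ℕ.+ suc d) ≤ q ℕ.* suc d
    bound = ℕ.≤-trans (ℕ.≤-trans (ℕ.m≤m+n (3 ℕ.+ d) (2 ℕ.* d))
      (ℕ.≤-reflexive (N.solve 1 (λ d → (N.con 3 N.:+ d) N.:+ N.con 2 N.:* d N.:= N.con 3 N.:* (N.con 1 N.:+ d)) ≡.refl d)))
      (ℕ.*-monoˡ-≤ (suc d) 3≤q)
      where module N = Data.Nat.Solver.+-*-Solver

  -- C_T strictly raises degrees, starting from deg u or more, so the summand a u added at each
  -- Horner step cannot reach the leading term.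
  hasDegree-carlitz : ∀ {u} → ¬ u ≈ zeroP → ∀ f {n} → HasDegree f n → HasDegree (carlitz f u) (carlitzDegree (deg u) n)
  hasDegree-carlitz u≉0 [] (0≢0 , _) = contradiction ≡.refl 0≢0
  hasDegree-carlitz {u} u≉0 (a ∷ f) {zero} (a≢0 , b) =
    (λ eq → *-≢0 a≢0 (lead-≢0 {u} u≉0) (≡.trans (≡.sym (at (deg u))) eq)) ,
    λ i d<i → ≡.trans (at i) (≡.trans (≡.cong (a *_) (below-deg u i d<i)) (K.zeroʳ a))
    where
    f≋0 : f ≋ []
    f≋0 i = b (suc i) (s≤s z≤n)
    at : ∀ i → coef (carlitz (a ∷ f) u) i ≡ a * coef u i
    at i = ≡.trans (≈⇒≋ {carlitz (a ∷ f) u} {carlitz [ a ] u} (carlitz-cong u {a ∷ f} {[ a ]} (≋⇒≈ {a ∷ f} {[ a ]} (∷-cong ≡.refl f≋0))) i)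
      (≡.trans (≈⇒≋ {carlitz [ a ] u} {Act.c [ a ] u} (carlitz≈ [ a ] u) i)
      (≡.trans (≈⇒≋ {Act.c [ a ] u} {[ a ] *P u} constant i) (≡.trans ([ a ]-* u i) (coef-scal a u i))))
      where
      constant : Act.c [ a ] u ≈ [ a ] *P u
      constant = ≡.trans
        (R.+-congˡ {[ a ] *P u} {Tp *P [] +P [] ^.^ q} {[]}
          (R.+-cong {Tp *P []} {[]} {[] ^.^ q} {[]} (R.zeroʳ Tp) Act.0^q))
        (R.+-identityʳ ([ a ] *P u))
  hasDegree-carlitz {u} u≉0 (a ∷ f) {suc n} (f≢0 , b) =
    hasDegree-+ (scal a u) (Tp *P carlitz f u +P carlitz f u ^P q)
      (below-scal {u} a (below-≤ {u} (ℕ.≤-<-trans (≤carlitzDegree (deg u) n) (d<next _)) (below-deg u)))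
      (hasDegree-step (carlitz f u) _ (hasDegree-carlitz {u} u≉0 f (f≢0 , below-tail {a} {f} b)))

  carlitzSequence : ∀ u → ¬ u ≈ zeroP → CarlitzSequence poly-domain
  carlitzSequence u u≉0 = record
    { c      = λ n → carlitz n u
    ; c-cong = λ {a} {b} → carlitz-cong u {a} {b}
    ; c-≉0   = λ {n} n≉0 → coef≢0⇒≉0 {carlitz n u} (proj₁ (hasDegree-carlitz {u} u≉0 n (hasDegree {n} n≉0)))
    ; c-comb = λ {d} {a} {b} s t d∣a d∣b → Dv.∣-respʳ {d} {carlitz (s *P a) u +P carlitz (t *P b) u} {carlitz (s *P a +P t *P b) u}
        (≡.sym (carlitz-+ u (s *P a) (t *P b)))
        (Dv.∣-+ {d} {carlitz (s *P a) u} {carlitz (t *P b) u}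
          (Dv.∣-trans {d} {carlitz a u} {carlitz (s *P a) u} d∣a (∣c-* s a)) (Dv.∣-trans {d} {carlitz b u} {carlitz (t *P b) u} d∣b (∣c-* t b)))
    ; c-lift = λ k l → proj₁ (carlitz-lift l (carlitz k u)) , lift k l
    ; δ      = carlitzDegree (deg u)
    ; deg-c  = λ {n} n≉0 → let (≢0 , b) = hasDegree-carlitz {u} u≉0 n (hasDegree {n} n≉0) in deg-unique {carlitz n u} ≢0 b
    }
    where
    module Dv = Divisibility poly-domain
    ∣c-* : ∀ s a → carlitz a u ∣ carlitz (s *P a) u
    ∣c-* s a with carlitz-lift s (carlitz a u)
    ... | z , eq = _ , ≡.sym
      (≡.trans (carlitz-* u s a) eq)
    lift : ∀ k l → carlitz (k *P l) u ≈ carlitz k u *P (l +P carlitz k u *P carlitz k u *P proj₁ (carlitz-lift l (carlitz k u)))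
    -- The factors are exchanged because the expansion wanted is that of C_l at the point x =
    -- C_k(u).
    lift k l = ≡.trans (carlitz-cong u {k *P l} {l *P k} (R.*-comm k l))
      (≡.trans (carlitz-* u l k) (proj₂ (carlitz-lift l (carlitz k u))))
      where rhs = carlitz k u *P (l +P carlitz k u *P carlitz k u *P proj₁ (carlitz-lift l (carlitz k u)))

open import Data.Nat using (_^_)

-- Degree of Ψ

-- The order of the unit group of 𝔽q[T]/(∏ l) for distinct primes l of the given degrees.
totient : ℕ → List ℕ → ℕ
totient q = foldr (λ r x → (q ^ r ∸ 1) ℕ.* x) 1

module Numeric (q : ℕ) (3≤q : 3 ≤ q) (q≢4 : q ≢ 4) where
  open import Data.Nat using (_+_; _*_)
  open ℕ.≤-Reasoning
  open Data.Nat.Solver.+-*-Solver using (solve; _:=_; _:+_; _:*_; con)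

  r+2≤q^r : ∀ r → 1 ≤ r → r + 2 ≤ q ^ r
  r+2≤q^r (suc zero)    _ = ℕ.≤-trans 3≤q (ℕ.≤-reflexive (≡.sym (ℕ.*-identityʳ q)))
  r+2≤q^r (suc (suc r)) _ = begin
    suc (suc r) + 2      ≤⟨ ℕ.m≤m+n _ (2 * r + 5) ⟩
    suc (suc r) + 2 + (2 * r + 5) ≡⟨ solve 1 (λ r → (con 2 :+ r) :+ con 2 :+ (con 2 :* r :+ con 5) := con 3 :* ((con 1 :+ r) :+ con 2)) ≡.refl r ⟩
    3 * (suc r + 2)      ≤⟨ ℕ.*-mono-≤ 3≤q (r+2≤q^r (suc r) (s≤s z≤n)) ⟩
    q * q ^ suc r        ∎

  r<q^r∸1 : ∀ r → 1 ≤ r → r < q ^ r ∸ 1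
  r<q^r∸1 r 1≤r = ℕ.≤-trans (ℕ.≤-reflexive eq) (ℕ.∸-monoˡ-≤ 1 (r+2≤q^r r 1≤r))
    where
    eq : suc r ≡ r + 2 ∸ 1
    eq = ≡.sym (≡.cong (_∸ 1) (ℕ.+-comm r 2))

  -- Every factor q^r - 1 is at least 1 + r, and ∏ (1 + r) ≥ 1 + ∑ r.
  totient>sum : ∀ {rs} → All (1 ≤_) rs → sum rs < totient q rs
  totient>sum []                     = s≤s z≤n
  totient>sum {r ∷ rs} (1≤r ∷ 1≤rs) = begin
    suc (r + sum rs)                 ≤⟨ s≤s (ℕ.+-monoʳ-≤ r (ℕ.m≤m+n _ (r * sum rs))) ⟩
    suc (r + (sum rs + r * sum rs))  ≡⟨ solve 2 (λ r s → con 1 :+ (r :+ (s :+ r :* s)) := (con 1 :+ r) :* (con 1 :+ s)) ≡.refl r (sum rs) ⟩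
    suc r * suc (sum rs)             ≤⟨ ℕ.*-mono-≤ (r<q^r∸1 r 1≤r) (totient>sum 1≤rs) ⟩
    (q ^ r ∸ 1) * totient q rs       ∎

  -- The constant 3 is the 2 required by `Large` plus the 1 lost in q^r - 1. At r = 1 the bound is
  -- false.
  qr+3≤q^r : ∀ r → 2 ≤ r → q * r + 3 ≤ q ^ r
  qr+3≤q^r (suc zero) (s≤s ())
  qr+3≤q^r (suc (suc zero)) _ = begin
    q * 2 + 3         ≤⟨ ℕ.+-monoʳ-≤ (q * 2) 3≤q ⟩
    q * 2 + q         ≡⟨ solve 1 (λ q → q :* con 2 :+ q := q :* con 3) ≡.refl q ⟩
    q * 3             ≤⟨ ℕ.*-monoʳ-≤ q 3≤q ⟩
    q * q             ≡⟨ solve 1 (λ q → q :* q := q :* (q :* con 1)) ≡.refl q ⟩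
    q * (q * 1)       ∎
  qr+3≤q^r (suc (suc (suc r))) _ = begin
    q * suc (suc (suc r)) + 3             ≤⟨ ℕ.+-mono-≤ (ℕ.*-monoʳ-≤ q {y = suc (suc r) * 3} (aux r)) (ℕ.≤-trans 3≤q (ℕ.m≤m*n q 3)) ⟩
    q * (suc (suc r) * 3) + q * 3         ≤⟨ ℕ.+-monoˡ-≤ (q * 3) (ℕ.*-monoʳ-≤ q (ℕ.*-monoʳ-≤ (suc (suc r)) 3≤q)) ⟩
    q * (suc (suc r) * q) + q * 3         ≡⟨ solve 2 (λ q r → q :* (r :* q) :+ q :* con 3 := q :* (q :* r :+ con 3)) ≡.refl q (suc (suc r)) ⟩
    q * (q * suc (suc r) + 3)             ≤⟨ ℕ.*-monoʳ-≤ q (qr+3≤q^r (suc (suc r)) (s≤s (s≤s z≤n))) ⟩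
    q * q ^ suc (suc r)                   ∎
    where
    aux : ∀ r → suc (suc (suc r)) ≤ suc (suc r) * 3
    aux r = begin
      suc (suc (suc r))         ≤⟨ ℕ.m≤m+n _ (2 * r + 3) ⟩
      suc (suc (suc r)) + (2 * r + 3) ≡⟨ solve 1 (λ r → (con 3 :+ r) :+ (con 2 :* r :+ con 3) := (con 2 :+ r) :* con 3) ≡.refl r ⟩
      suc (suc r) * 3           ∎

  -- For s = ∑ deg ℓ and x the totient. In the squarefree case with u = 1 only x ≤ 1 + q deg Ψ is
  -- known, so the 2 pays for this defect and for strictness in s < deg Ψ. The part 1 ≤ s is what
  -- lets the inequality survive a further prime.
  Large : ℕ → ℕ → Set
  Large s x = 1 ≤ s × q * s + 2 ≤ x

  large-step : ∀ {r s x} → 1 ≤ r → Large s x → Large (r + s) ((q ^ r ∸ 1) * x)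
  large-step {r} {s} {x} 1≤r (1≤s , ≤x) = ℕ.≤-trans 1≤r (ℕ.m≤m+n r s) , (begin
    q * (r + s) + 2              ≡⟨ solve 3 (λ q r s → q :* (r :+ s) :+ con 2 := r :* (q :* con 1) :+ (q :* s :+ con 2)) ≡.refl q r s ⟩
    r * (q * 1) + (q * s + 2)    ≤⟨ ℕ.+-monoˡ-≤ _ (ℕ.*-monoʳ-≤ r (ℕ.≤-trans (ℕ.*-monoʳ-≤ q 1≤s) (ℕ.m≤m+n _ 2))) ⟩
    r * (q * s + 2) + (q * s + 2) ≡⟨ ℕ.+-comm (r * _) _ ⟩
    suc r * (q * s + 2)          ≤⟨ ℕ.*-mono-≤ (r<q^r∸1 r 1≤r) ≤x ⟩
    (q ^ r ∸ 1) * x              ∎)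

  large-base : ∀ {r} → 2 ≤ r → Large r (q ^ r ∸ 1)
  large-base {r} 2≤r = ℕ.≤-trans (s≤s z≤n) 2≤r , ℕ.≤-trans (ℕ.≤-reflexive eq) (ℕ.∸-monoˡ-≤ 1 (qr+3≤q^r r 2≤r))
    where
    eq : q * r + 2 ≡ q * r + 3 ∸ 1
    eq = ≡.sym (ℕ.+-∸-assoc (q * r) {3} (s≤s z≤n))

  large-append : ∀ {s x rs} → All (1 ≤_) rs → Large s x → Large (s + sum rs) (x * totient q rs)
  large-append {s} {x} [] L = ≡.subst₂ Large (≡.sym (ℕ.+-identityʳ s)) (≡.sym (ℕ.*-identityʳ x)) L
  large-append {s} {x} {r ∷ rs} (1≤r ∷ 1≤rs) L = ≡.subst₂ Large
    (solve 3 (λ r s t → (r :+ s) :+ t := s :+ (r :+ t)) ≡.refl r s (sum rs))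
    (solve 3 (λ y x t → (y :* x) :* t := x :* (y :* t)) ≡.refl (q ^ r ∸ 1) x (totient q rs))
    (large-append 1≤rs (large-step 1≤r L))

  -- The degree patterns that the inequality of `Large` may leave open, and everything else under
  -- `large`.
  data Shape : List ℕ → Set where
    empty  : Shape []
    single : ∀ r → Shape (r ∷ [])
    pair   : q ≡ 3 → Shape (1 ∷ 1 ∷ [])
    triple : q ≡ 3 → Shape (1 ∷ 1 ∷ 1 ∷ [])
    large  : ∀ {rs} → Large (sum rs) (totient q rs) → Shape rs

  1⊎2≤ : ∀ {r} → 1 ≤ r → 1 ≡ r ⊎ 2 ≤ r
  1⊎2≤ {suc zero}    _ = inj₁ ≡.refl
  1⊎2≤ {suc (suc r)} _ = inj₂ (s≤s (s≤s z≤n))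

  -- (q - 1)² ≥ 2q + 2 holds from q = 5 on; at q = 4 it just fails, with 9 against 10.
  large-11 : q ≢ 3 → Large 2 ((q ^ 1 ∸ 1) * ((q ^ 1 ∸ 1) * 1))
  large-11 q≢3 = s≤s z≤n , ≡.subst (λ Q → q * 2 + 2 ≤ (Q ∸ 1) * ((Q ∸ 1) * 1)) (≡.sym (ℕ.*-identityʳ q)) (go q 3≤q q≢3 q≢4)
    where
    go : ∀ q → 3 ≤ q → q ≢ 3 → q ≢ 4 → q * 2 + 2 ≤ (q ∸ 1) * ((q ∸ 1) * 1)
    go (suc (suc (suc zero)))          _ q≢3 _   = contradiction ≡.refl q≢3
    go (suc (suc (suc (suc zero))))    _ _   q≢4 = contradiction ≡.refl q≢4
    go (suc (suc (suc (suc (suc k))))) _ _   _   = begin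
      (5 + k) * 2 + 2                            ≤⟨ ℕ.m≤m+n _ (4 + 6 * k + k * k) ⟩
      (5 + k) * 2 + 2 + (4 + 6 * k + k * k)      ≡⟨ solve 1 (λ k → (con 5 :+ k) :* con 2 :+ con 2 :+ (con 4 :+ con 6 :* k :+ k :* k)
                                                      := (con 4 :+ k) :* ((con 4 :+ k) :* con 1)) ≡.refl k ⟩
      (4 + k) * ((4 + k) * 1)                    ∎
    go (suc (suc zero)) (s≤s (s≤s ()))
    go (suc zero) (s≤s ())

  -- Three linear primes give 8 against 11, four give 16 against 14. There are only three monic
  -- linear primes over 𝔽₃, but the inequality disposes of a fourth without counting them.
  large-1111 : q ≡ 3 → Large (sum (1 ∷ 1 ∷ 1 ∷ 1 ∷ [])) (totient q (1 ∷ 1 ∷ 1 ∷ 1 ∷ []))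
  large-1111 ≡.refl = ℕ.≤ᵇ⇒≤ 1 4 _ , ℕ.≤ᵇ⇒≤ 14 16 _

  shape : ∀ {rs} → All (1 ≤_) rs → Shape rs
  shape [] = empty
  shape {r ∷ rs} (1≤r ∷ 1≤rs) with 1⊎2≤ 1≤r
  ... | inj₂ 2≤r = large (large-append 1≤rs (large-base 2≤r))
  ... | inj₁ ≡.refl with shape 1≤rs
  ...   | empty       = single 1
  ...   | large L     = large (large-step 1≤r L)
  ...   | triple q≡3  = large (large-1111 q≡3)
  ...   | pair q≡3    = triple q≡3
  ...   | single a with 1⊎2≤ (All.head 1≤rs)
  ...     | inj₂ 2≤a    = large (large-step 1≤r (large-append {rs = []} [] (large-base 2≤a)))
  ...     | inj₁ ≡.refl with q ℕ.≟ 3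
  ...       | yes q≡3 = pair q≡3
  ...       | no  q≢3 = large (large-11 q≢3)

module Degree (E : EuclideanDomain) (C : CarlitzSequence E) (q : ℕ) (1≤q : 1 ≤ q) where
  open EuclideanDomain E hiding (_+_; _*_)
  open EuclideanDomain E using () renaming (_*_ to _·_)
  open Divisibility E
  open CarlitzSequence C
  open Primitive E C
  open import Data.Nat using (_+_; _*_)
  open ≡.≡-Reasoning
  open Data.Nat.Solver.+-*-Solver using (solve; _:=_; _:+_; _:*_; con)

  totient-∷ : ∀ r rs → totient q (r ∷ rs) + totient q rs ≡ q ^ r * totient q rs
  totient-∷ r rs = begin
    (q ^ r ∸ 1) * t + t       ≡⟨ solve 2 (λ y t → y :* t :+ t := (y :+ con 1) :* t) ≡.refl (q ^ r ∸ 1) t ⟩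
    (q ^ r ∸ 1 + 1) * t       ≡⟨ ≡.cong (_* t) (ℕ.m∸n+n≡m (ℕ.m^n>0 q {{ℕ.>-nonZero 1≤q}} r)) ⟩
    q ^ r * t                 ∎
    where t = totient q rs

  deg-w*l : ∀ {w l} → ¬ w ≈ 0# → MonicPrime l → deg (w · l) ≡ deg w + deg l
  deg-w*l w≉0 (_ , l≉0 , _) = deg-* w≉0 l≉0

  -- The hypothesis says δ j = (K/κ) q^j from j₀ on: κ = 1, K = deg u, j₀ = 0 when u is not
  -- constant, and κ = q, K = 1, j₀ = 1 when u = 1. The induction moves primes into w, which only
  -- raises deg w, so j₀ ≤ deg w persists.
  deg-Ψ : ∀ {κ K j₀} → (∀ j → j₀ ≤ j → κ * δ j ≡ K * q ^ j) →
          ∀ {S} (adm : Admissible S) w (w≉0 : ¬ w ≈ 0#) → j₀ ≤ deg w →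
          κ * deg (Ψ adm w w≉0) ≡ K * q ^ deg w * totient q (degs S)
  deg-Ψ {κ} {K} hyp [] w w≉0 j₀≤ =
    ≡.trans (≡.cong (κ *_) (deg-Ψ-[] w w≉0)) (≡.trans (hyp _ j₀≤) (≡.sym (ℕ.*-identityʳ _)))
  deg-Ψ {κ} {K} {j₀} hyp {l ∷ S} (p ∷ adm) w w≉0 j₀≤ = ℕ.+-cancelʳ-≡ (κ * deg (Ψ adm w w≉0)) _ _ (begin
    κ * deg (Ψ (p ∷ adm) w w≉0) + κ * deg (Ψ adm w w≉0)     ≡⟨ ≡.sym (ℕ.*-distribˡ-+ κ _ _) ⟩
    κ * (deg (Ψ (p ∷ adm) w w≉0) + deg (Ψ adm w w≉0))       ≡⟨ ≡.cong (κ *_) (deg-Ψ-∷ p adm w w≉0 wl≉0) ⟩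
    κ * deg (Ψ adm (w · l) wl≉0)                            ≡⟨ deg-Ψ {κ} {K} hyp adm (w · l) wl≉0 (ℕ.≤-trans j₀≤ (ℕ.≤-trans (ℕ.m≤m+n _ _) (ℕ.≤-reflexive (≡.sym wl)))) ⟩
    K * q ^ deg (w · l) * t                                 ≡⟨ ≡.cong (λ d → K * d * t) (≡.trans (≡.cong (q ^_) wl) (ℕ.^-distribˡ-+-* q (deg w) (deg l))) ⟩
    K * (q ^ deg w * q ^ deg l) * t                         ≡⟨ solve 4 (λ K a b t → K :* (a :* b) :* t := K :* a :* (b :* t)) ≡.refl K (q ^ deg w) (q ^ deg l) t ⟩
    K * q ^ deg w * (q ^ deg l * t)                         ≡⟨ ≡.cong (K * q ^ deg w *_) (≡.sym (totient-∷ (deg l) (degs S))) ⟩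
    K * q ^ deg w * (totient q (degs (l ∷ S)) + t)          ≡⟨ ℕ.*-distribˡ-+ (K * q ^ deg w) _ t ⟩
    K * q ^ deg w * totient q (degs (l ∷ S)) + K * q ^ deg w * t ≡⟨ ≡.cong (K * q ^ deg w * totient q (degs (l ∷ S)) +_) (≡.sym (deg-Ψ {κ} {K} hyp adm w w≉0 j₀≤)) ⟩
    K * q ^ deg w * totient q (degs (l ∷ S)) + κ * deg (Ψ adm w w≉0) ∎)
    where
    t = totient q (degs S)
    wl = deg-w*l w≉0 (proj₁ p)
    wl≉0 : ¬ w · l ≈ 0#
    wl≉0 = *-≉0 w≉0 (proj₁ (proj₂ (proj₁ p)))

  -- The closed form would need δ 0 = 1/q; since δ 0 = 0 it is off by ±1/q.
  deg-Ψ-squarefree : δ 0 ≡ 0 → (∀ j → 1 ≤ j → q * δ j ≡ q ^ j) →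
    ∀ {S} (adm : Admissible S) w (w≉0 : ¬ w ≈ 0#) → deg w ≡ 0 →
    totient q (degs S) ≤ suc (q * deg (Ψ adm w w≉0)) × q * deg (Ψ adm w w≉0) ≤ suc (totient q (degs S))
  deg-Ψ-squarefree δ0 hyp [] w w≉0 w≡0 =
    s≤s z≤n , ≡.subst (λ d → q * d ≤ 2) (≡.sym (≡.trans (deg-Ψ-[] w w≉0) (≡.trans (≡.cong δ w≡0) δ0)))
                (≡.subst (_≤ 2) (≡.sym (ℕ.*-zeroʳ q)) z≤n)
  deg-Ψ-squarefree δ0 hyp {l ∷ S} (p ∷ adm) w w≉0 w≡0 with deg-Ψ-squarefree δ0 hyp adm w w≉0 w≡0
  -- The defect changes sign with every new prime: the upper bound for S yields the lower bound for
  -- l ∷ S, and conversely.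
  ... | t≤ , d≤ = exchange (≡.trans (ℕ.+-comm t (totient q (degs (l ∷ S)))) (≡.trans (≡.sym total) (ℕ.+-comm (q * d′) (q * d)))) d≤
                , exchange (≡.trans (ℕ.+-comm (q * d) (q * d′)) (≡.trans total (ℕ.+-comm (totient q (degs (l ∷ S))) t))) t≤
    where
    t = totient q (degs S)
    d = deg (Ψ adm w w≉0)
    d′ = deg (Ψ (p ∷ adm) w w≉0)
    wl≉0 : ¬ w · l ≈ 0#
    wl≉0 = *-≉0 w≉0 (proj₁ (proj₂ (proj₁ p)))
    wl : deg (w · l) ≡ deg l
    wl = ≡.trans (deg-w*l w≉0 (proj₁ p)) (≡.cong (_+ deg l) w≡0)
    total : q * d′ + q * d ≡ totient q (degs (l ∷ S)) + t
    total = begin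
      q * d′ + q * d                   ≡⟨ ≡.sym (ℕ.*-distribˡ-+ q d′ d) ⟩
      q * (d′ + d)                     ≡⟨ ≡.cong (q *_) (deg-Ψ-∷ p adm w w≉0 wl≉0) ⟩
      q * deg (Ψ adm (w · l) wl≉0)     ≡⟨ deg-Ψ {q} {1} {1} (λ j 1≤j → ≡.trans (hyp j 1≤j) (≡.sym (ℕ.*-identityˡ _))) adm (w · l) wl≉0 (≡.subst (1 ≤_) (≡.sym wl) (prime⇒0<deg (proj₂ (proj₁ p)))) ⟩
      1 * q ^ deg (w · l) * t          ≡⟨ ≡.cong (_* t) (≡.trans (ℕ.*-identityˡ _) (≡.cong (q ^_) wl)) ⟩
      q ^ deg l * t                    ≡⟨ ≡.sym (totient-∷ (deg l) (degs S)) ⟩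
      totient q (degs (l ∷ S)) + t     ∎
    exchange : ∀ {a b x y} → a + x ≡ b + y → b ≤ suc a → x ≤ suc y
    exchange {a} {b} {x} {y} eq b≤ = ℕ.+-cancelˡ-≤ a x (suc y)
      (ℕ.≤-trans (ℕ.≤-reflexive eq) (ℕ.≤-trans (ℕ.+-monoˡ-≤ y b≤) (ℕ.≤-reflexive (≡.sym (ℕ.+-suc a y)))))

-- Existence of Zsigmondy primes

module Existence (E : EuclideanDomain) (C : CarlitzSequence E) (q : ℕ) (3≤q : 3 ≤ q) (q≢4 : q ≢ 4) where
  open EuclideanDomain E
  open Divisibility E
  open CarlitzSequence C
  open Primitive E C
  open Degree E C q (ℕ.≤-trans (s≤s z≤n) 3≤q)
  open Numeric q 3≤q q≢4
  open import Relation.Binary.Reasoning.Setoid setoid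
  open Algebra.Solver.Ring.NaturalCoefficients.Default commutativeSemiring
    using (solve; _:=_; _:*_; con)

  1≤degs : ∀ {S} → All MonicPrime S → All (1 ≤_) (degs S)
  1≤degs []              = []
  1≤degs ((_ , pp) ∷ ps) = prime⇒0<deg pp ∷ 1≤degs ps

  totient≤degΨ : ∀ {κ K j₀} → (∀ j → j₀ ≤ j → κ ℕ.* δ j ≡ K ℕ.* q ^ j) → κ ≤ K ℕ.* q ^ j₀ → 0 < κ →
                 ∀ {S} (adm : Admissible S) w (w≉0 : ¬ w ≈ 0#) → j₀ ≤ deg w →
                 totient q (degs S) ≤ deg (Ψ adm w w≉0)
  totient≤degΨ {κ} {K} {j₀} hyp κ≤ 0<κ {S} adm w w≉0 j₀≤ =
    ℕ.*-cancelˡ-≤ κ {{ℕ.>-nonZero 0<κ}} (ℕ.≤-trans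
      (ℕ.*-monoˡ-≤ (totient q (degs S)) (ℕ.≤-trans κ≤ (ℕ.*-monoʳ-≤ K (ℕ.^-monoʳ-≤ q {{ℕ.>-nonZero (ℕ.≤-trans (s≤s z≤n) 3≤q)}} j₀≤))))
      (ℕ.≤-reflexive (≡.sym (deg-Ψ {κ} {K} hyp adm w w≉0 j₀≤))))

  module _ {m} (mm : Monic m) where
    -- The condition κ ≤ K q^j₀ makes deg Ψ at least the totient, which already exceeds ∑ deg ℓ.
    -- This settles nonconstant u, and u = 1 with m not squarefree.
    generic : ∀ {κ K j₀} → (∀ j → j₀ ≤ j → κ ℕ.* δ j ≡ K ℕ.* q ^ j) → κ ≤ K ℕ.* q ^ j₀ → 0 < κ →
              (rad : Radical m) → j₀ ≤ deg (Radical.w rad) → ∃ (ZsigmondyPrime m)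
    generic {κ} {K} hyp κ≤ 0<κ rad j₀≤ = large-Ψ⇒zsigmondy mm rad
      (ℕ.<-≤-trans (totient>sum (1≤degs primes))
        (totient≤degΨ {κ} {K} hyp κ≤ 0<κ (admissible primes coprime) w (monic⇒≉0 w-monic) j₀≤))
      where open Radical rad

    -- The exceptional case as far as an abstract Euclidean domain can express it; that l₁ and l₂
    -- differ by 1 is added over 𝔽₃[T].
    record SplitPair : Set where
      field
        {l₁ l₂}  : Carrier
        monic₁   : MonicPrime l₁
        monic₂   : MonicPrime l₂
        deg₁     : deg l₁ ≡ 1
        deg₂     : deg l₂ ≡ 1
        coprime  : Coprime l₁ l₂
        m≈       : m ≈ l₁ * l₂

    module _ (δ0 : δ 0 ≡ 0) (hyp : ∀ j → 1 ≤ j → q ℕ.* δ j ≡ q ^ j) (0<m : 0 < deg m)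
             -- Abstract form of two facts over 𝔽₃: distinct monic linear polynomials differ by ±1,
             -- and C_{T+a}(1) = T + a + 1.
             (linears : ∀ {x y} → q ≡ 3 → MonicPrime x → MonicPrime y → deg x ≡ 1 → deg y ≡ 1 →
                        Coprime x y → c y ≈ x ⊎ c x ≈ y) where

      private
        Φ : Radical m → Carrier
        Φ rad = Ψ (admissible primes coprime) w (monic⇒≉0 w-monic)
          where open Radical rad

        bounds : (rad : Radical m) → deg (Radical.w rad) ≡ 0 → totient q (degs (Radical.S rad)) ≤ suc (q ℕ.* deg (Φ rad))
        bounds rad w≡0 = proj₁ (deg-Ψ-squarefree δ0 hyp (admissible primes coprime) w (monic⇒≉0 w-monic) w≡0)
          where open Radical rad

        0<degΦ : (rad : Radical m) → deg (Radical.w rad) ≡ 0 → 2 ≤ totient q (degs (Radical.S rad)) → 0 < deg (Φ rad)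
        0<degΦ rad w≡0 2≤t = ℕ.n≢0⇒n>0 λ d≡0 → ℕ.<⇒≱ 2≤t (≡.subst (λ d → totient q (degs (Radical.S rad)) ≤ suc d)
          (≡.trans (≡.cong (q ℕ.*_) d≡0) (ℕ.*-zeroʳ q)) (bounds rad w≡0))

        divisorΦ : (rad : Radical m) → deg (Radical.w rad) ≡ 0 → 2 ≤ totient q (degs (Radical.S rad)) →
                   ∃ λ p → MonicPrime p × p ∣ Φ rad
        divisorΦ rad w≡0 2≤t = prime-divisor (Ψ≉0 (admissible primes coprime) w (monic⇒≉0 w-monic)) (0<degΦ rad w≡0 2≤t)
          where open Radical rad

      large-case : (rad : Radical m) → deg (Radical.w rad) ≡ 0 →
                   Large (sum (degs (Radical.S rad))) (totient q (degs (Radical.S rad))) → ∃ (ZsigmondyPrime m)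
      large-case rad w≡0 (_ , ≤t) = large-Ψ⇒zsigmondy mm rad (ℕ.*-cancelˡ-< q _ _
        (ℕ.s≤s⁻¹ (≡.subst (_≤ suc (q ℕ.* deg (Φ rad))) (ℕ.+-comm _ 2) (ℕ.≤-trans ≤t (bounds rad w≡0)))))

      single-case : ∀ r (rad : Radical m) → deg (Radical.w rad) ≡ 0 → r ∷ [] ≡ degs (Radical.S rad) → ∃ (ZsigmondyPrime m)
      single-case r rad@(record { w = w ; S = l ∷ [] ; w-monic = mw ; primes = pl ∷ [] }) w≡0 _
        with divisorΦ rad w≡0 (ℕ.≤-trans (ℕ.≤-trans (s≤s (prime⇒0<deg (proj₂ pl))) (r<q^r∸1 (deg l) (prime⇒0<deg (proj₂ pl))))
                                (ℕ.≤-reflexive (≡.sym (ℕ.*-identityʳ _))))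
      ... | π , pπ , π∣Φ = π , zsigmondy mm rad pπ π∣Φ no-common
        where
        no-common : ∀ {l₁ k} → l₁ ∈ l ∷ [] → k * l₁ ≈ w * prod (l ∷ []) → π ∣ l₁ → π ∣ c k → ⊥
        no-common {k = k} (here ≡.refl) kl _ π∣ck = proj₁ (proj₂ (proj₂ pπ)) (∣-unit π∣ck (deg0⇒unit (c-≉0 k≉0) ck≡0))
          where
          k≈w : k ≈ w
          k≈w = *-cancelʳ (proj₁ (proj₂ pl)) (trans kl (*-congˡ (*-identityʳ l)))
          k≉0 : ¬ k ≈ 0#
          k≉0 k≈0 = monic⇒≉0 mw (trans (sym k≈w) k≈0)
          ck≡0 : deg (c k) ≡ 0
          ck≡0 = ≡.trans (deg-c k≉0) (≡.trans (≡.cong δ (≡.trans (deg-cong k≈w) w≡0)) δ0)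

      pair-case : (rad : Radical m) → deg (Radical.w rad) ≡ 0 → 1 ∷ 1 ∷ [] ≡ degs (Radical.S rad) → SplitPair
      pair-case (record { w = w ; S = l₁ ∷ l₂ ∷ [] ; w-monic = mw ; primes = p₁ ∷ p₂ ∷ [] ; coprime = (cop ∷ []) ∷ _ ; m≈ = m≈ }) w≡0 eq = record
        { monic₁ = p₁ ; monic₂ = p₂ ; coprime = cop
        ; deg₁ = ≡.sym (∷-injectiveˡ eq) ; deg₂ = ≡.sym (∷-injectiveˡ (∷-injectiveʳ eq))
        ; m≈ = trans m≈ (trans (*-congʳ (monic-deg0 mw w≡0)) (solve 2 (λ x y → con 1 :* (x :* (y :* con 1)) := x :* y) refl l₁ l₂)) }

      -- Of the three linear primes, each is c of another one, so a prime dividing it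
      -- also divides c of the cofactor of the third.
      triple-case : q ≡ 3 → (rad : Radical m) → deg (Radical.w rad) ≡ 0 → 1 ∷ 1 ∷ 1 ∷ [] ≡ degs (Radical.S rad) → ∃ (ZsigmondyPrime m)
      triple-case q≡3 rad@(record { w = w ; S = l₁ ∷ l₂ ∷ l₃ ∷ [] ; w-monic = mw ; primes = ps@(p₁ ∷ p₂ ∷ p₃ ∷ [])
                                  ; coprime = cs@((c₁₂ ∷ c₁₃ ∷ []) ∷ (c₂₃ ∷ []) ∷ [] ∷ []) }) w≡0 eq
        with divisorΦ rad w≡0 (≡.subst₂ (λ q rs → 2 ≤ totient q rs) (≡.sym q≡3) eq (ℕ.≤ᵇ⇒≤ 2 8 _))
      ... | π , pπ , π∣Φ = π , zsigmondy mm rad pπ π∣Φ no-common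
        where
        S = l₁ ∷ l₂ ∷ l₃ ∷ []
        d₁ : deg l₁ ≡ 1
        d₁ = ≡.sym (∷-injectiveˡ eq)
        d₂ : deg l₂ ≡ 1
        d₂ = ≡.sym (∷-injectiveˡ (∷-injectiveʳ eq))
        d₃ : deg l₃ ≡ 1
        d₃ = ≡.sym (∷-injectiveˡ (∷-injectiveʳ (∷-injectiveʳ eq)))
        -- The cofactor of y is x w l, so l = c x divides its value under `c`. A prime π ∣ l
        -- dividing Ψ would then divide y as well, against coprimality.
        via : ∀ {l x y} → Coprime l y → y ∈ S → x * (w * l) * y ≈ w * prod S → c x ≈ l → π ∣ l → ⊥
        via {l} {x} cop y∈S kl cx≈l π∣l = proj₁ (proj₂ (proj₂ pπ)) (coprime-∣ cop π∣l
          (∣Ψ∣c⇒∣l (admissible ps cs) (monic⇒≉0 mw) y∈S kl π∣Φ (∣-trans (∣-respʳ (sym cx≈l) π∣l) (∣c-* x (w * l)))))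
        exclude : ∀ {l x y} → MonicPrime l → MonicPrime x → MonicPrime y → deg l ≡ 1 → deg x ≡ 1 → deg y ≡ 1 →
                  Coprime l x → Coprime l y → Coprime x y → x ∈ S → y ∈ S →
                  x * (w * l) * y ≈ w * prod S → y * (w * l) * x ≈ w * prod S → π ∣ l → ⊥
        exclude pl px py dl dx dy lx ly xy x∈S y∈S eqy eqx π∣l with linears q≡3 pl px dl dx lx | linears q≡3 pl py dl dy ly
        ... | inj₁ cx≈l | _         = via ly y∈S eqy cx≈l π∣l
        ... | inj₂ _    | inj₁ cy≈l = via lx x∈S eqx cy≈l π∣l
        -- If neither x nor y is sent to l, then c l is both x and y, which are coprime.
        ... | inj₂ cl≈x | inj₂ cl≈y = proj₁ (proj₂ (proj₂ px)) (coprime-∣ xy ∣-refl (∣-respʳ (trans (sym cl≈x) cl≈y) ∣-refl))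
        no-common : ∀ {l k} → l ∈ S → k * l ≈ w * prod S → π ∣ l → π ∣ c k → ⊥
        no-common (here ≡.refl) _ π∣l _ = exclude p₁ p₂ p₃ d₁ d₂ d₃ c₁₂ c₁₃ c₂₃ (there (here ≡.refl)) (there (there (here ≡.refl)))
          (solve 4 (λ w l x y → x :* (w :* l) :* y := w :* (l :* (x :* (y :* con 1)))) refl w l₁ l₂ l₃)
          (solve 4 (λ w l x y → y :* (w :* l) :* x := w :* (l :* (x :* (y :* con 1)))) refl w l₁ l₂ l₃) π∣l
        no-common (there (here ≡.refl)) _ π∣l _ = exclude p₂ p₁ p₃ d₂ d₁ d₃ (coprime-sym c₁₂) c₂₃ c₁₃ (here ≡.refl) (there (there (here ≡.refl)))
          (solve 4 (λ w l x y → x :* (w :* l) :* y := w :* (x :* (l :* (y :* con 1)))) refl w l₂ l₁ l₃)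
          (solve 4 (λ w l x y → y :* (w :* l) :* x := w :* (x :* (l :* (y :* con 1)))) refl w l₂ l₁ l₃) π∣l
        no-common (there (there (here ≡.refl))) _ π∣l _ = exclude p₃ p₁ p₂ d₃ d₁ d₂ (coprime-sym c₁₃) (coprime-sym c₂₃) c₁₂ (here ≡.refl) (there (here ≡.refl))
          (solve 4 (λ w l x y → x :* (w :* l) :* y := w :* (x :* (y :* (l :* con 1)))) refl w l₃ l₁ l₂)
          (solve 4 (λ w l x y → y :* (w :* l) :* x := w :* (x :* (y :* (l :* con 1)))) refl w l₃ l₁ l₂) π∣l

      existence : (rad : Radical m) → ∃ (ZsigmondyPrime m) ⊎ (q ≡ 3 × SplitPair)
      existence rad with deg (Radical.w rad) in w≡
      ... | suc d = inj₁ (generic {q} {1} {1} (λ j 1≤j → ≡.trans (hyp j 1≤j) (≡.sym (ℕ.*-identityˡ _)))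
                      (ℕ.≤-reflexive (≡.sym (≡.trans (ℕ.*-identityˡ _) (ℕ.*-identityʳ q)))) (ℕ.≤-trans (s≤s z≤n) 3≤q) rad
                      (≡.subst (1 ≤_) (≡.sym w≡) (s≤s z≤n)))
      ... | zero = by-shape (shape (1≤degs (Radical.primes rad))) ≡.refl
        where
        by-shape : ∀ {rs} → Shape rs → rs ≡ degs (Radical.S rad) → ∃ (ZsigmondyPrime m) ⊎ (q ≡ 3 × SplitPair)
        by-shape empty eq      = contradiction 0<m (ℕ.<-irrefl (≡.sym (deg≡0 (Radical.S rad) eq (Radical.m≈ rad))))
          where
          deg≡0 : ∀ S → [] ≡ degs S → m ≈ Radical.w rad * prod S → deg m ≡ 0
          deg≡0 [] _ m≈ = ≡.trans (deg-cong (trans m≈ (*-identityʳ _))) w≡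
        by-shape (single r) eq = inj₁ (single-case r rad w≡ eq)
        by-shape (pair q≡3) eq = inj₂ (q≡3 , pair-case rad w≡ eq)
        by-shape (triple q≡3) eq = inj₁ (triple-case q≡3 rad w≡ eq)
        by-shape (large L) eq  = inj₁ (large-case rad w≡ (≡.subst (λ rs → Large (sum rs) (totient q rs)) eq L))

-- Odd prime powers and the field with three elements

module _ {p e q} (pp : Prime p) (p≢2 : p ≢ 2) (1≤e : 1 ≤ e) (q≡p^e : q ≡ p ^ e) where
  private
    3≤p : 3 ≤ p
    3≤p = ℕ.≤∧≢⇒< (ℕ.nonTrivial⇒n>1 p {{prime⇒nonTrivial pp}}) (λ 2≡p → p≢2 (≡.sym 2≡p))

    p∣q : p ℕ.∣ q
    p∣q = ≡.subst (p ℕ.∣_) (≡.sym q≡p^e) (go 1≤e)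
      where
      go : ∀ {e} → 1 ≤ e → p ℕ.∣ p ^ e
      go {suc e} _ = ℕ.m∣m*n (p ^ e)

  odd-prime-power≥3 : 3 ≤ q
  odd-prime-power≥3 = ℕ.≤-trans 3≤p (ℕ.∣⇒≤ {{≡.subst ℕ.NonZero (≡.sym q≡p^e) (ℕ.m^n≢0 p e {{prime⇒nonZero pp}})}} p∣q)

  odd-prime-power≢4 : q ≢ 4
  odd-prime-power≢4 q≡4 = ℕ.<⇒≱ 3≤p ([ ℕ.∣⇒≤ , ℕ.∣⇒≤ ]′ (euclidsLemma 2 2 pp (≡.subst (p ℕ.∣_) q≡4 p∣q)))

module _ (F : FiniteField 3) where
  open FieldProperties F
  open FiniteField F using (0≢1)
  open CommutativeRing field-ring hiding (sym; trans; refl; _≈_)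
  open ≡ using (cong; cong₂; sym; trans; refl)
  open import Algebra.Properties.Ring ring using (+-cancelˡ)

  -- Among a, a + 1, a + 2 and b two must coincide, and the first three are distinct.
  𝔽₃-trichotomy : ∀ a b → a ≡ b ⊎ b ≡ a + 1# ⊎ a ≡ b + 1#
  𝔽₃-trichotomy a b = let i , j , i<j , eq = pigeonhole f in cases i j i<j eq
    where
    f : Fin 4 → Carrier
    f Fin.zero                               = a
    f (Fin.suc Fin.zero)                     = a + 1#
    f (Fin.suc (Fin.suc Fin.zero))           = a + 1# + 1#
    f (Fin.suc (Fin.suc (Fin.suc Fin.zero))) = b
    x≢x+1 : ∀ x → x ≢ x + 1#
    x≢x+1 x eq = 0≢1 (+-cancelˡ x 0# 1# (trans (+-identityʳ x) eq))
    +3 : a + 1# + 1# + 1# ≡ a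
    +3 = trans (+-assoc (a + 1#) 1# 1#) (trans (+-assoc a 1# (1# + 1#))
      (trans (cong (λ x → a + (1# + (1# + x))) (sym (+-identityʳ 1#))) (trans (cong (a +_) q×1≡0) (+-identityʳ a))))
    cases : ∀ i j → i Fin.< j → f i ≡ f j → a ≡ b ⊎ b ≡ a + 1# ⊎ a ≡ b + 1#
    cases _ Fin.zero ()
    cases Fin.zero (Fin.suc Fin.zero) _ eq = contradiction eq (x≢x+1 a)
    cases Fin.zero (Fin.suc (Fin.suc Fin.zero)) _ eq = contradiction (trans (sym +3) (cong (_+ 1#) (sym eq))) (x≢x+1 a)
    cases Fin.zero (Fin.suc (Fin.suc (Fin.suc Fin.zero))) _ eq = inj₁ eq
    cases (Fin.suc i) (Fin.suc Fin.zero) (s≤s ())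
    cases (Fin.suc Fin.zero) (Fin.suc (Fin.suc Fin.zero)) _ eq = contradiction eq (x≢x+1 (a + 1#))
    cases (Fin.suc Fin.zero) (Fin.suc (Fin.suc (Fin.suc Fin.zero))) _ eq = inj₂ (inj₁ (sym eq))
    cases (Fin.suc (Fin.suc i)) (Fin.suc (Fin.suc Fin.zero)) (s≤s (s≤s ()))
    cases (Fin.suc (Fin.suc Fin.zero)) (Fin.suc (Fin.suc (Fin.suc Fin.zero))) _ eq = inj₂ (inj₂ (trans (sym +3) (cong (_+ 1#) eq)))
    cases (Fin.suc (Fin.suc (Fin.suc i))) (Fin.suc (Fin.suc (Fin.suc Fin.zero))) (s≤s (s≤s (s≤s ())))

-- The exceptional case and existence over 𝔽q[T]

module Main {q} (F : FiniteField q) {p e} (pp : Prime p) (q≡p^e : q ≡ p ^ e) (3≤q : 3 ≤ q) (q≢4 : q ≢ 4) where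
  open FiniteField F using (0#; 1#; _+_; _*_)
  open PolyDefs F
  open PolyRing F
  open CarlitzPoly F {p} {e} pp q≡p^e 3≤q
  private
    module K = CommutativeRing (FieldProperties.field-ring F)
    module R = CommutativeRing poly-ring
    module Dv = Divisibility poly-domain

  linear-form : ∀ {f} → Monic f → deg f ≡ 1 → f ≈ linear (coef f 0)
  linear-form {f} mf d≡1 = ≋⇒≈ {f} {linear (coef f 0)} λ where
    zero          → ≡.refl
    (suc zero)    → ≡.trans (≡.cong (coef f) (≡.sym d≡1)) (monic⇒lead≡1 {f} mf)
    (suc (suc i)) → below-deg f (suc (suc i)) (s≤s (≡.subst (_≤ suc i) (≡.sym d≡1) (s≤s z≤n)))

  linear-cong : ∀ {a b} → a ≡ b → linear a ≈ linear b
  linear-cong ≡.refl = ≡.refl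

  linear-1 : ∀ a b → b ≡ a + 1# → linear a ≈ linear b -P oneP
  linear-1 a b ≡.refl = linear-cong (≡.sym (≡.trans (K.+-assoc a 1# (K.- 1#)) (≡.trans (≡.cong (a +_) (K.-‿inverseʳ 1#)) (K.+-identityʳ a))))

  oneP-^ : ∀ n → oneP ^P n ≈ oneP
  oneP-^ zero    = ≡.refl
  oneP-^ (suc n) = ≡.trans (R.*-identityˡ (oneP ^P n)) (oneP-^ n)

  carlitz-linear-1 : ∀ {u} a → u ≈ oneP → carlitz (linear a) u ≈ linear (a + 1#)
  carlitz-linear-1 {u} a u≈1 = ≡.trans (carlitz-congʳ (linear a) {u} {oneP} u≈1) (≡.trans (carlitz-linear a oneP)
    (≡.trans (R.+-cong {linear a *P oneP} {linear a} {oneP ^P q} {oneP} (R.*-identityʳ (linear a)) (oneP-^ q))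
      (≋⇒≈ {linear a +P oneP} {linear (a + 1#)} λ { zero → ≡.refl ; (suc i) → ≡.refl })))

  deg-linear : ∀ a → deg (linear a) ≡ 1
  deg-linear a = deg-unique {linear a} (proj₁ (hasDegree-linear a)) (proj₂ (hasDegree-linear a))

  linear≉0 : ∀ a → ¬ linear a ≈ zeroP
  linear≉0 a = coef≢0⇒≉0 {linear a} {1} (proj₁ (hasDegree-linear a))

  module _ {u} (mu : Monic u) where
    private
      u≉0 : ¬ u ≈ zeroP
      u≉0 = monic⇒≉zeroP {u} mu
      C = carlitzSequence u u≉0
      module Ex = Existence poly-domain C q 3≤q q≢4

    deg-u≡0⇒u≈1 : deg u ≡ 0 → u ≈ oneP
    deg-u≡0⇒u≈1 = EuclideanDomain.monic-deg0 poly-domain {u} mu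

    -- For P = ℘, C_{P-1}(1) = P and therefore C_m(1) = C_P(P) = P² + P³ = P · P · (P + 1). Both P =
    -- C_{P-1}(1) and P + 1 = C_P(1) are values at polynomials of degree 1 < deg m, so no prime
    -- divisor is new.
    exceptional⇒none : ∀ {m} → Exceptional u m → ¬ Σ Poly (Zsigmondy u m)
    exceptional⇒none {m} (q≡3 , u≈1 , P , (mP , pP) , dP , m≈) (π , (_ , pπ) , π∣cm , new) =
      [ π∤P , [ π∤P , π∤P+1 ]′ ]′ (split-triple π∣product)
      where
      a b : K.Carrier
      a = coef P 0
      b = a + K.- 1#
      a≡b+1 : a ≡ b + 1#
      a≡b+1 = ≡.sym (≡.trans (K.+-assoc a (K.- 1#) 1#) (≡.trans (≡.cong (a +_) (K.-‿inverseˡ 1#)) (K.+-identityʳ a)))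
      P≈ : P ≈ linear a
      P≈ = linear-form {P} mP dP
      P-1≈ : P -P oneP ≈ linear b
      P-1≈ = R.+-congʳ {negP oneP} {P} {linear a} P≈
      m≈′ : m ≈ linear a *P linear b
      m≈′ = ≡.trans m≈ (≡.trans (R.*-cong {P -P oneP} {linear b} {P} {linear a} P-1≈ P≈) (R.*-comm (linear b) (linear a)))
      deg-m : deg m ≡ 2
      deg-m = ≡.trans (≡.cong (λ h → length h ∸ 1) m≈′) (≡.trans (deg-*P {linear a} {linear b} (linear≉0 a) (linear≉0 b))
        (≡.cong₂ ℕ._+_ (deg-linear a) (deg-linear b)))
      new-linear : ∀ x → ¬ π ∣ carlitz (linear x) u
      new-linear x = new (linear x) (linear≉0 x) (≡.subst₂ _<_ (≡.sym (deg-linear x)) (≡.sym deg-m) (s≤s (s≤s z≤n)))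
      c-b : carlitz (linear b) u ≈ linear a
      c-b = ≡.trans (carlitz-linear-1 {u} b u≈1) (linear-cong (≡.sym a≡b+1))
      L = linear a
      cm≈ : carlitz m u ≈ L *P (L *P (L +P oneP))
      cm≈ = ≡.trans (carlitz-cong u {m} {L *P linear b} m≈′) (≡.trans (carlitz-* u L (linear b))
        (≡.trans (carlitz-congʳ L {carlitz (linear b) u} {L} c-b) (≡.trans (carlitz-linear a L)
          (≡.trans (≡.cong (λ n → norm (L *P L +P L ^P n)) q≡3) factor))))
        where
        factor : L *P L +P L *P (L *P (L *P oneP)) ≈ L *P (L *P (L +P oneP))
        factor = ≡.trans (R.+-congˡ {L *P L} {L *P (L *P (L *P oneP))} {L *P (L *P L)}
            (R.*-congˡ {L} {L *P (L *P oneP)} {L *P L} (R.*-congˡ {L} {L *P oneP} {L} (R.*-identityʳ L))))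
          (≡.trans (≡.sym (R.distribˡ L L (L *P L)))
            (R.*-congˡ {L} {L +P L *P L} {L *P (L +P oneP)} (≡.trans (R.+-comm L (L *P L))
              (≡.trans (R.+-congˡ {L *P L} {L} {L *P oneP} (≡.sym (R.*-identityʳ L))) (≡.sym (R.distribˡ L L oneP))))))
      π∣product : π ∣ L *P (L *P (L +P oneP))
      π∣product = Dv.∣-respʳ {π} {carlitz m u} {L *P (L *P (L +P oneP))} cm≈ π∣cm
      split-triple : π ∣ L *P (L *P (L +P oneP)) → π ∣ L ⊎ π ∣ L ⊎ π ∣ L +P oneP
      split-triple d with proj₂ (proj₂ pπ) L (L *P (L +P oneP)) d
      ... | inj₁ x = inj₁ x
      ... | inj₂ y = inj₂ (proj₂ (proj₂ pπ) L (L +P oneP) y)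
      π∤P : ¬ π ∣ L
      π∤P d = new-linear b (Dv.∣-respʳ {π} {L} {carlitz (linear b) u} (≡.sym c-b) d)
      π∤P+1 : ¬ π ∣ L +P oneP
      π∤P+1 d = new-linear a (Dv.∣-respʳ {π} {L +P oneP} {carlitz L u}
        (≡.sym (≡.trans (carlitz-linear-1 {u} a u≈1) (≋⇒≈ {linear (a + 1#)} {L +P oneP} λ { zero → ≡.refl ; (suc i) → ≡.refl }))) d)

    -- Equal constant terms would give x ≈ y, which coprimality of nonunits forbids; trichotomy in
    -- 𝔽₃ leaves the two stated cases.
    consecutive : q ≡ 3 → ∀ {x y} → Monic x → Monic y → deg x ≡ 1 → deg y ≡ 1 → Dv.Coprime x y →
                  coef y 0 ≡ coef x 0 + 1# ⊎ coef x 0 ≡ coef y 0 + 1#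
    consecutive q≡3 {x} {y} mx my dx dy cop = go (trichotomy q≡3 (coef x 0) (coef y 0))
      where
      trichotomy : q ≡ 3 → ∀ a b → a ≡ b ⊎ b ≡ a + 1# ⊎ a ≡ b + 1#
      trichotomy ≡.refl = 𝔽₃-trichotomy F
      go : _ → _
      go (inj₂ r) = r
      go (inj₁ a≡b) = contradiction (Dv.unit⇒deg0 {x} (Dv.coprime-∣ {x} {y} {x} cop (Dv.∣-refl {x})
        (oneP , ≡.trans (R.*-identityʳ x) x≈y))) (λ d≡0 → contradiction (≡.trans (≡.sym d≡0) dx) λ ())
        where
        x≈y : x ≈ y
        x≈y = ≡.trans (linear-form {x} mx dx) (≡.trans (linear-cong a≡b) (≡.sym (linear-form {y} my dy)))

    linears : u ≈ oneP → ∀ {x y} → q ≡ 3 → MonicPrime x → MonicPrime y → deg x ≡ 1 → deg y ≡ 1 →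
              Dv.Coprime x y → carlitz y u ≈ x ⊎ carlitz x u ≈ y
    linears u≈1 {x} {y} q≡3 (mx , _) (my , _) dx dy cop = go (consecutive q≡3 {x} {y} mx my dx dy cop)
      where
      c-of : ∀ {x y} → Monic x → Monic y → deg x ≡ 1 → deg y ≡ 1 → coef y 0 ≡ coef x 0 + 1# → carlitz x u ≈ y
      c-of {x} {y} mx my dx dy eq = ≡.trans (carlitz-cong u {x} {linear (coef x 0)} (linear-form {x} mx dx))
        (≡.trans (carlitz-linear-1 {u} (coef x 0) u≈1) (≡.trans (linear-cong (≡.sym eq)) (≡.sym (linear-form {y} my dy))))
      go : _ → _
      go (inj₁ y≡x+1) = inj₂ (c-of {x} {y} mx my dx dy y≡x+1)
      go (inj₂ x≡y+1) = inj₁ (c-of {y} {x} my mx dy dx x≡y+1)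

    splitPair⇒exceptional : ∀ {m} (mm : Monic m) → q ≡ 3 → u ≈ oneP → Ex.SplitPair {m} mm → Exceptional u m
    splitPair⇒exceptional {m} mm q≡3 u≈1 sp = q≡3 , u≈1 , go (consecutive q≡3 {l₁} {l₂} (proj₁ monic₁) (proj₁ monic₂) deg₁ deg₂ coprime)
      where
      open Ex.SplitPair {m} {mm} sp
      minus-one : ∀ {x y} → Monic x → Monic y → deg x ≡ 1 → deg y ≡ 1 → coef y 0 ≡ coef x 0 + 1# → x ≈ y -P oneP
      minus-one {x} {y} mx my dx dy eq = ≡.trans (linear-form {x} mx dx) (≡.trans (linear-1 (coef x 0) (coef y 0) eq)
        (R.+-congʳ {negP oneP} {linear (coef y 0)} {y} (≡.sym (linear-form {y} my dy))))
      go : _ → _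
      -- The prime whose constant term is larger by 1 plays the role of ℘.
      go (inj₁ eq) = l₂ , monic₂ , deg₂ , ≡.trans m≈
        (R.*-congʳ {l₂} {l₁} {l₂ -P oneP} (minus-one {l₁} {l₂} (proj₁ monic₁) (proj₁ monic₂) deg₁ deg₂ eq))
      go (inj₂ eq) = l₁ , monic₁ , deg₁ , ≡.trans m≈ (≡.trans (R.*-comm l₁ l₂)
        (R.*-congʳ {l₁} {l₂} {l₁ -P oneP} (minus-one {l₂} {l₁} (proj₁ monic₂) (proj₁ monic₁) deg₂ deg₁ eq)))

    carlitzDegree-pos : ∀ d j → 1 ℕ.* carlitzDegree (suc d) j ≡ suc d ℕ.* q ^ j
    carlitzDegree-pos d j = ≡.trans (ℕ.*-identityˡ _) (go j)
      where
      next-pos : ∀ x → 0 < x → next x ≡ q ℕ.* x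
      next-pos (suc x) _ = ≡.refl
      go : ∀ j → carlitzDegree (suc d) j ≡ suc d ℕ.* q ^ j
      go zero    = ≡.sym (ℕ.*-identityʳ (suc d))
      go (suc j) = ≡.trans (next-pos _ (ℕ.≤-trans (s≤s z≤n) (≤carlitzDegree (suc d) j))) (≡.trans (≡.cong (q ℕ.*_) (go j))
        (≡.trans (≡.sym (ℕ.*-assoc q (suc d) (q ^ j))) (≡.trans (≡.cong (ℕ._* q ^ j) (ℕ.*-comm q (suc d))) (ℕ.*-assoc (suc d) q (q ^ j)))))

    -- That is, δ j = q^(j-1): the first application of C_T only lifts the degree from 0 to 1, and
    -- each later one multiplies it by q.
    carlitzDegree-0 : ∀ j → 1 ≤ j → q ℕ.* carlitzDegree 0 j ≡ q ^ j
    carlitzDegree-0 (suc zero)    _ = ≡.refl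
    carlitzDegree-0 (suc (suc j)) _ = ≡.cong (q ℕ.*_) (≡.trans (next-pos _ (0<δ j)) (carlitzDegree-0 (suc j) (s≤s z≤n)))
      where
      next-pos : ∀ x → 0 < x → next x ≡ q ℕ.* x
      next-pos (suc x) _ = ≡.refl
      0<δ : ∀ j → 0 < carlitzDegree 0 (suc j)
      0<δ j = ℕ.≤-<-trans z≤n (d<next (carlitzDegree 0 j))

    zsigmondy-exists : ∀ {m} → Monic m → 0 < deg m ⊎ 0 < deg u → ¬ Exceptional u m → Σ Poly (Zsigmondy u m)
    zsigmondy-exists {m} mm pos ¬exc = by-degree (deg u) ≡.refl
      where
      by-degree : ∀ d → deg u ≡ d → Σ Poly (Zsigmondy u m)
      -- With u nonconstant the degree formula holds from j = 0 on, so squarefree m needs no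
      -- separate treatment.
      by-degree (suc d) du = Ex.generic {m} mm {1} {suc d} {0}
        (λ j _ → ≡.subst (λ h → 1 ℕ.* carlitzDegree h j ≡ suc d ℕ.* q ^ j) (≡.sym du) (carlitzDegree-pos d j))
        (s≤s z≤n) (s≤s z≤n) (Dv.radical m mm) z≤n
      by-degree zero du = [ (λ z → z) , (λ (q≡3 , sp) → contradiction (splitPair⇒exceptional {m} mm q≡3 u≈1 sp) ¬exc) ]′
        (Ex.existence {m} mm du
          (λ j 1≤j → ≡.subst (λ h → q ℕ.* carlitzDegree h j ≡ q ^ j) (≡.sym du) (carlitzDegree-0 j 1≤j))
          0<m (λ {x} {y} → linears u≈1 {x} {y}) (Dv.radical m mm))
        where
        u≈1 = deg-u≡0⇒u≈1 du
        0<m : 0 < deg m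
        0<m = [ (λ x → x) , (λ 0<u → contradiction (≡.subst (0 <_) du 0<u) λ ()) ]′ pos

theorem4p4 : (p e q : ℕ) → Prime p → p ≢ 2 → 1 ≤ e → q ≡ p ^ e →
    (F : FiniteField q) → let open PolyDefs F in
    (m u : Poly) → Monic m → Monic u → (0 < deg m ⊎ 0 < deg u) →
    (Σ Poly (Zsigmondy u m) ⇔ (¬ Exceptional u m))
theorem4p4 p e q pp p≢2 1≤e q≡p^e F m u mm mu pos = mk⇔
  (λ z exc → M.exceptional⇒none {u} mu {m} exc z)
  (M.zsigmondy-exists {u} mu {m} mm pos)
  where
  module M = Main F {p} {e} pp q≡p^e (odd-prime-power≥3 pp p≢2 1≤e q≡p^e) (odd-prime-power≢4 pp p≢2 1≤e q≡p^e)
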